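{- Let $\mathcal{M}$ be a metric space setting (a class of metrics, such as general finite metrics, edge-weighted trees or the Euclidean plane) and let $\alpha\geq 1$. Suppose that for every constant $K\in\mathbb{N}$ there is a polynomial time $\alpha$-approximation algorithm for the segmented TSP with $K$ segments on instances whose metric belongs to $\mathcal{M}$. Then for every constant $\epsilon>0$ there is a polynomial time $\alpha(1+\epsilon)$-approximation algorithm for the Traveling Repairman Problem on instances whose metric belongs to $\mathcal{M}$.
   Context: Traveling Repairman Problem (TRP): an instance is a set $V$ of $n+1$ points, one of which is the origin $r$, with symmetric integer distances $d_{ij}$ satisfying the triangle inequality. A solution is a permutation $\Pi=(v_0,v_1,\dots,v_n)$ of $V$ with $v_0=r$. The completion time of $v_i$ is $C(v_i)=\sum_{j=1}^{i}d_{v_{j-1},v_j}$. The goal is to minimize $\sum_{v\in V}C(v)$. A $\rho$-approximation algorithm returns a solution of value at most $\rho$ times the optimum. Segmented TSP with $K$ segments: an instance is a set $V$ of $n+1$ points, one of which is the origin, with symmetric integer distances satisfying the triangle inequality, together with numbers $l_1\leq l_2\leq\dots\leq l_K$ and $n_1\leq n_2\leq\dots\leq n_K$. A solution is a tour that starts and ends in the origin, has length at most $l_K$, and visits at least $n_h$ points of $V$ within the first $l_h$ distance along the tour, for all $h\in\{1,\dots,K\}$. The instance is feasible if a solution exists. An algorithm is an $\alpha$-approximation ($\alpha\geq 1$) if for every feasible instance it finds a tour starting and ending in the origin that visits at least $n_h$ points within path-distance $\alpha l_h$ from the start for all $h$, and whose total length is at most $\alpha l_K$. -}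

module Defs where

open import Level using (Level)
open import Data.Nat as ℕ using (ℕ; zero; suc)
import Data.Nat.Properties as ℕ
open import Data.Nat.Binary.Base as ℕᵇ using (ℕᵇ; 2[1+_]; 1+[2_])
open import Data.Integer as ℤ using ()
open import Data.Rational as ℚ using (ℚ; 0ℚ; 1ℚ; ½)
import Data.Rational.Properties as ℚ
open import Data.Rational.Solver using (module +-*-Solver)
open import Data.Fin as Fin using (Fin; toℕ)
open import Data.Fin.Permutation using (Permutation′; _⟨$⟩ʳ_)
open import Data.List using (List; []; _∷_; _∷ʳ_; length; map; foldr; tabulate; take; deduplicate)
open import Data.Nat.ListAction using (sum)
open import Data.Product using (∃-syntax; Σ-syntax; _×_; _,_; proj₁; proj₂)
open import Relation.Binary.PropositionalEquality using (_≡_; _≢_; refl; sym; trans; cong; subst)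

Cauchy : (ℕ → ℚ) → Set
Cauchy a = ∀ δ → 0ℚ ℚ.< δ →
  ∃[ N ] (∀ m n → N ℕ.≤ m → N ℕ.≤ n → ℚ.∣ a m ℚ.- a n ∣ ℚ.≤ δ)

record ℝ : Set where
  constructor mkℝ
  field
    seq    : ℕ → ℚ
    cauchy : Cauchy seq

open ℝ public

infix  4 _≤ᴿ_ _<ᴿ_
infixl 6 _+ᴿ_
infixl 7 _*ᴿ_

_≤ᴿ_ : ℝ → ℝ → Set
x ≤ᴿ y = ∀ δ → 0ℚ ℚ.< δ → ∃[ N ] (∀ n → N ℕ.≤ n → seq x n ℚ.≤ seq y n ℚ.+ δ)

_<ᴿ_ : ℝ → ℝ → Set
x <ᴿ y = ∃[ δ ] (0ℚ ℚ.< δ × ∃[ N ] (∀ n → N ℕ.≤ n → seq x n ℚ.+ δ ℚ.≤ seq y n))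

fromℚ : ℚ → ℝ
fromℚ q = mkℝ (λ _ → q) λ δ 0<δ → 0 , λ _ _ _ _ →
  subst (λ z → ℚ.∣ z ∣ ℚ.≤ δ) (sym (ℚ.+-inverseʳ q)) (ℚ.<⇒≤ 0<δ)

fromℕ : ℕ → ℝ
fromℕ n = fromℚ (ℤ.+ n ℚ./ 1)

0ᴿ 1ᴿ : ℝ
0ᴿ = fromℕ 0
1ᴿ = fromℕ 1

private
  +-cauchy : ∀ a b → Cauchy a → Cauchy b → Cauchy (λ n → a n ℚ.+ b n)
  +-cauchy a b ca cb δ 0<δ
    with ca (½ ℚ.* δ) (0<½δ) | cb (½ ℚ.* δ) 0<½δ
    where
    0<½δ : 0ℚ ℚ.< ½ ℚ.* δ
    0<½δ = ℚ.positive⁻¹ (½ ℚ.* δ) {{ℚ.pos*pos⇒pos ½ δ {{ℚ.positive 0<δ}}}}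
  ... | M , p | N , q = M ℕ.+ N , λ m n h k → begin
      ℚ.∣ (a m ℚ.+ b m) ℚ.- (a n ℚ.+ b n) ∣
        ≡⟨ cong ℚ.∣_∣ (rearrange (a m) (b m) (a n) (b n)) ⟩
      ℚ.∣ (a m ℚ.- a n) ℚ.+ (b m ℚ.- b n) ∣
        ≤⟨ ℚ.∣p+q∣≤∣p∣+∣q∣ (a m ℚ.- a n) (b m ℚ.- b n) ⟩
      ℚ.∣ a m ℚ.- a n ∣ ℚ.+ ℚ.∣ b m ℚ.- b n ∣
        ≤⟨ ℚ.+-mono-≤ (p m n (ℕ.≤-trans (ℕ.m≤m+n M N) h) (ℕ.≤-trans (ℕ.m≤m+n M N) k))
                      (q m n (ℕ.≤-trans (ℕ.m≤n+m N M) h) (ℕ.≤-trans (ℕ.m≤n+m N M) k)) ⟩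
      ½ ℚ.* δ ℚ.+ ½ ℚ.* δ
        ≡⟨ sym (ℚ.*-distribʳ-+ δ ½ ½) ⟩
      1ℚ ℚ.* δ
        ≡⟨ ℚ.*-identityˡ δ ⟩
      δ ∎
    where
    open ℚ.≤-Reasoning
    rearrange : ∀ s t u v → (s ℚ.+ t) ℚ.- (u ℚ.+ v) ≡ (s ℚ.- u) ℚ.+ (t ℚ.- v)
    rearrange = solve 4 (λ s t u v → (s :+ t) :- (u :+ v) := (s :- u) :+ (t :- v)) refl
      where open +-*-Solver

  Bounded : (ℕ → ℚ) → Set
  Bounded a = ∃[ B ] (0ℚ ℚ.< B × ∃[ N ] (∀ n → N ℕ.≤ n → ℚ.∣ a n ∣ ℚ.≤ B))

  bounded : ∀ a → Cauchy a → Bounded a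
  bounded a ca with ca 1ℚ (ℚ.positive⁻¹ 1ℚ)
  ... | N , p = 1ℚ ℚ.+ ℚ.∣ a N ∣
              , ℚ.+-mono-<-≤ (ℚ.positive⁻¹ 1ℚ) (ℚ.0≤∣p∣ (a N))
              , N , λ n h → begin
      ℚ.∣ a n ∣
        ≡⟨ cong ℚ.∣_∣ (split (a n) (a N)) ⟩
      ℚ.∣ (a n ℚ.- a N) ℚ.+ a N ∣
        ≤⟨ ℚ.∣p+q∣≤∣p∣+∣q∣ (a n ℚ.- a N) (a N) ⟩
      ℚ.∣ a n ℚ.- a N ∣ ℚ.+ ℚ.∣ a N ∣
        ≤⟨ ℚ.+-monoˡ-≤ ℚ.∣ a N ∣ (p n N h ℕ.≤-refl) ⟩
      1ℚ ℚ.+ ℚ.∣ a N ∣ ∎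
    where
    open ℚ.≤-Reasoning
    split : ∀ s t → s ≡ (s ℚ.- t) ℚ.+ t
    split = solve 2 (λ s t → s := (s :- t) :+ t) refl
      where open +-*-Solver

  ∣*∣-bound : ∀ s t {S T} → 0ℚ ℚ.≤ S → ℚ.∣ s ∣ ℚ.≤ S → ℚ.∣ t ∣ ℚ.≤ T →
              ℚ.∣ s ℚ.* t ∣ ℚ.≤ S ℚ.* T
  ∣*∣-bound s t {S} {T} 0≤S s≤S t≤T = begin
      ℚ.∣ s ℚ.* t ∣
        ≡⟨ ℚ.∣p*q∣≡∣p∣*∣q∣ s t ⟩
      ℚ.∣ s ∣ ℚ.* ℚ.∣ t ∣
        ≤⟨ ℚ.*-monoʳ-≤-nonNeg ℚ.∣ t ∣ {{ℚ.nonNegative (ℚ.0≤∣p∣ t)}} s≤S ⟩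
      S ℚ.* ℚ.∣ t ∣
        ≤⟨ ℚ.*-monoˡ-≤-nonNeg S {{ℚ.nonNegative 0≤S}} t≤T ⟩
      S ℚ.* T ∎
    where open ℚ.≤-Reasoning

  *-close : ∀ s t u v {A B η} → 0ℚ ℚ.≤ A → 0ℚ ℚ.≤ B →
            ℚ.∣ s ∣ ℚ.≤ A → ℚ.∣ v ∣ ℚ.≤ B → ℚ.∣ s ℚ.- u ∣ ℚ.≤ η → ℚ.∣ t ℚ.- v ∣ ℚ.≤ η →
            ℚ.∣ s ℚ.* t ℚ.- u ℚ.* v ∣ ℚ.≤ (A ℚ.+ B) ℚ.* η
  *-close s t u v {A} {B} {η} 0≤A 0≤B s≤A v≤B su tv = begin
      ℚ.∣ s ℚ.* t ℚ.- u ℚ.* v ∣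
        ≡⟨ cong ℚ.∣_∣ (rearrange s t u v) ⟩
      ℚ.∣ s ℚ.* (t ℚ.- v) ℚ.+ v ℚ.* (s ℚ.- u) ∣
        ≤⟨ ℚ.∣p+q∣≤∣p∣+∣q∣ (s ℚ.* (t ℚ.- v)) (v ℚ.* (s ℚ.- u)) ⟩
      ℚ.∣ s ℚ.* (t ℚ.- v) ∣ ℚ.+ ℚ.∣ v ℚ.* (s ℚ.- u) ∣
        ≤⟨ ℚ.+-mono-≤ (∣*∣-bound s (t ℚ.- v) 0≤A s≤A tv) (∣*∣-bound v (s ℚ.- u) 0≤B v≤B su) ⟩
      A ℚ.* η ℚ.+ B ℚ.* η
        ≡⟨ sym (ℚ.*-distribʳ-+ η A B) ⟩
      (A ℚ.+ B) ℚ.* η ∎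
    where
    open ℚ.≤-Reasoning
    rearrange : ∀ s t u v → s ℚ.* t ℚ.- u ℚ.* v ≡ s ℚ.* (t ℚ.- v) ℚ.+ v ℚ.* (s ℚ.- u)
    rearrange = solve 4 (λ s t u v → s :* t :- u :* v := s :* (t :- v) :+ v :* (s :- u)) refl
      where open +-*-Solver

  quotient : ∀ C δ → 0ℚ ℚ.< C → 0ℚ ℚ.< δ → ∃[ η ] (0ℚ ℚ.< η × C ℚ.* η ≡ δ)
  quotient C δ 0<C 0<δ =
      ℚ.1/ C ℚ.* δ
    , ℚ.positive⁻¹ (ℚ.1/ C ℚ.* δ) {{ℚ.pos*pos⇒pos (ℚ.1/ C) {{ℚ.1/pos⇒pos C}} δ {{ℚ.positive 0<δ}}}}
    , trans (sym (ℚ.*-assoc C (ℚ.1/ C) δ))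
            (trans (cong (ℚ._* δ) (ℚ.*-inverseʳ C)) (ℚ.*-identityˡ δ))
    where
    instance
      C-pos : ℚ.Positive C
      C-pos = ℚ.positive 0<C
      C-nonZero : ℚ.NonZero C
      C-nonZero = ℚ.pos⇒nonZero C

  *-cauchy′ : ∀ a b → Bounded a → Bounded b → Cauchy a → Cauchy b →
              Cauchy (λ n → a n ℚ.* b n)
  *-cauchy′ a b (A , 0<A , Nᴬ , boundA) (B , 0<B , Nᴮ , boundB) ca cb δ 0<δ =
    close (quotient (A ℚ.+ B) δ (ℚ.+-mono-< 0<A 0<B) 0<δ)
    where
    close : ∃[ η ] (0ℚ ℚ.< η × (A ℚ.+ B) ℚ.* η ≡ δ) →
      ∃[ N ] (∀ m n → N ℕ.≤ m → N ℕ.≤ n → ℚ.∣ a m ℚ.* b m ℚ.- a n ℚ.* b n ∣ ℚ.≤ δ)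
    close (η , 0<η , [A+B]η≡δ) = L , λ m n h k →
      subst (λ z → ℚ.∣ a m ℚ.* b m ℚ.- a n ℚ.* b n ∣ ℚ.≤ z) [A+B]η≡δ
        (*-close (a m) (b m) (a n) (b n) (ℚ.<⇒≤ 0<A) (ℚ.<⇒≤ 0<B)
          (boundA m (ℕ.≤-trans Nᴬ≤L h)) (boundB n (ℕ.≤-trans Nᴮ≤L k))
          (proj₂ (ca η 0<η) m n (ℕ.≤-trans M≤L h) (ℕ.≤-trans M≤L k))
          (proj₂ (cb η 0<η) m n (ℕ.≤-trans N≤L h) (ℕ.≤-trans N≤L k)))
      where
      M = proj₁ (ca η 0<η)
      N = proj₁ (cb η 0<η)
      L = (Nᴬ ℕ.+ Nᴮ) ℕ.+ (M ℕ.+ N)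
      Nᴬ≤L : Nᴬ ℕ.≤ L
      Nᴬ≤L = ℕ.≤-trans (ℕ.m≤m+n Nᴬ Nᴮ) (ℕ.m≤m+n (Nᴬ ℕ.+ Nᴮ) (M ℕ.+ N))
      Nᴮ≤L : Nᴮ ℕ.≤ L
      Nᴮ≤L = ℕ.≤-trans (ℕ.m≤n+m Nᴮ Nᴬ) (ℕ.m≤m+n (Nᴬ ℕ.+ Nᴮ) (M ℕ.+ N))
      M≤L : M ℕ.≤ L
      M≤L = ℕ.≤-trans (ℕ.m≤m+n M N) (ℕ.m≤n+m (M ℕ.+ N) (Nᴬ ℕ.+ Nᴮ))
      N≤L : N ℕ.≤ L
      N≤L = ℕ.≤-trans (ℕ.m≤n+m N M) (ℕ.m≤n+m (M ℕ.+ N) (Nᴬ ℕ.+ Nᴮ))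

  *-cauchy : ∀ a b → Cauchy a → Cauchy b → Cauchy (λ n → a n ℚ.* b n)
  *-cauchy a b ca cb = *-cauchy′ a b (bounded a ca) (bounded b cb) ca cb

_+ᴿ_ : ℝ → ℝ → ℝ
x +ᴿ y = mkℝ (λ n → seq x n ℚ.+ seq y n) (+-cauchy (seq x) (seq y) (cauchy x) (cauchy y))

_*ᴿ_ : ℝ → ℝ → ℝ
x *ᴿ y = mkℝ (λ n → seq x n ℚ.* seq y n) (*-cauchy (seq x) (seq y) (cauchy x) (cauchy y))

-- The machine model is a one-variable version of N. D. Jones's WHILE
-- language over binary trees ("Computability and Complexity from a
-- Programming Perspective", MIT Press 1997).  With trees stored as shared
-- pointer structures every operation is a constant number of pointer
-- moves, and a multi-tape Turing machine is simulated with constant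
-- overhead per step by keeping each tape as two stacks.  Sharing cannot
-- hide large outputs: a list of binary numerals has only polynomially many
-- nodes when its spine and the spines of its entries are paths in a
-- polynomial-size heap.  Hence polynomial time here, for the inputs and
-- outputs encoded below, is Turing-machine polynomial time.

infixr 5 _∙_

data Tree : Set where
  nil : Tree
  _∙_ : Tree → Tree → Tree

size : Tree → ℕ
size nil     = 1
size (s ∙ t) = suc (size s ℕ.+ size t)

hd tl : Tree → Tree
hd nil     = nil
hd (s ∙ t) = s
tl nil     = nil
tl (s ∙ t) = t

infixr 9 _⨟_

data Program : Set where
  `id `nil `hd `tl : Program
  `cons            : Program → Program → Program
  _⨟_              : Program → Program → Program
  `if              : Program → Program → Program → Program
  `while           : Program → Program → Program

infix 4 ⟦_⟧_⇓_within_

-- ⟦ p ⟧ x ⇓ y within t : on input x, p halts with result y after exactly t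
-- steps.  In tests, nil is false and every other tree is true.
data ⟦_⟧_⇓_within_ : Program → Tree → Tree → ℕ → Set where
  run-id    : ∀ {x} → ⟦ `id ⟧ x ⇓ x within 1
  run-nil   : ∀ {x} → ⟦ `nil ⟧ x ⇓ nil within 1
  run-hd    : ∀ {x} → ⟦ `hd ⟧ x ⇓ hd x within 1
  run-tl    : ∀ {x} → ⟦ `tl ⟧ x ⇓ tl x within 1
  run-cons  : ∀ {p q x y z s t} →
              ⟦ p ⟧ x ⇓ y within s → ⟦ q ⟧ x ⇓ z within t →
              ⟦ `cons p q ⟧ x ⇓ y ∙ z within suc (s ℕ.+ t)
  run-⨟     : ∀ {p q x y z s t} →
              ⟦ p ⟧ x ⇓ y within s → ⟦ q ⟧ y ⇓ z within t →
              ⟦ p ⨟ q ⟧ x ⇓ z within suc (s ℕ.+ t)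
  if-true   : ∀ {c p q x b y s t} →
              ⟦ c ⟧ x ⇓ b within s → b ≢ nil → ⟦ p ⟧ x ⇓ y within t →
              ⟦ `if c p q ⟧ x ⇓ y within suc (s ℕ.+ t)
  if-false  : ∀ {c p q x y s t} →
              ⟦ c ⟧ x ⇓ nil within s → ⟦ q ⟧ x ⇓ y within t →
              ⟦ `if c p q ⟧ x ⇓ y within suc (s ℕ.+ t)
  loop-exit : ∀ {c p x s} →
              ⟦ c ⟧ x ⇓ nil within s →
              ⟦ `while c p ⟧ x ⇓ x within suc s
  loop-step : ∀ {c p x b y z s t u} →
              ⟦ c ⟧ x ⇓ b within s → b ≢ nil → ⟦ p ⟧ x ⇓ y within t →
              ⟦ `while c p ⟧ y ⇓ z within u →
              ⟦ `while c p ⟧ x ⇓ z within suc (s ℕ.+ t ℕ.+ u)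

PolyTimeSolvable : ∀ {ℓ} {I : Set} → (I → Tree) → (I → Set ℓ) → (I → Tree → Set) → Set ℓ
PolyTimeSolvable {I = I} encode Dom Correct =
  Σ[ p ∈ Program ] Σ[ c ∈ ℕ ] Σ[ e ∈ ℕ ]
    (∀ (i : I) → Dom i →
      ∃[ y ] ∃[ t ] (⟦ p ⟧ encode i ⇓ y within t × t ℕ.≤ c ℕ.* size (encode i) ℕ.^ e × Correct i y))

encodeℕᵇ : ℕᵇ → Tree
encodeℕᵇ ℕᵇ.zero  = nil
encodeℕᵇ 2[1+ n ] = nil ∙ encodeℕᵇ n
encodeℕᵇ 1+[2 n ] = (nil ∙ nil) ∙ encodeℕᵇ n

-- Numbers are written in binary, so that sizes are logarithmic.
encodeℕ : ℕ → Tree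
encodeℕ n = encodeℕᵇ (ℕᵇ.fromℕ n)

encodeList : List Tree → Tree
encodeList = foldr _∙_ nil

encodeFin : ∀ {n} → Fin n → Tree
encodeFin i = encodeℕ (toℕ i)

encodePoints : ∀ {n} → List (Fin n) → Tree
encodePoints vs = encodeList (map encodeFin vs)

-- Integer distances; nonnegativity is forced by symmetry and the triangle
-- inequality, so ℕ loses nothing.  Distinct points may be at distance 0.
record Metric (n : ℕ) : Set where
  field
    dist     : Fin n → Fin n → ℕ
    dist-ii  : ∀ i → dist i i ≡ 0
    dist-sym : ∀ i j → dist i j ≡ dist j i
    triangle : ∀ i j k → dist i k ℕ.≤ dist i j ℕ.+ dist j k

open Metric public

MetricClass : (ℓ : Level) → Set (Level.suc ℓ)
MetricClass ℓ = ∀ {n} → Metric n → Set ℓ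

pathLength : ∀ {n} → Metric n → List (Fin n) → ℕ
pathLength D []           = 0
pathLength D (u ∷ [])     = 0
pathLength D (u ∷ v ∷ vs) = dist D u v ℕ.+ pathLength D (v ∷ vs)

numVisited : ∀ {n} → List (Fin n) → ℕ
numVisited vs = length (deduplicate Fin._≟_ vs)

encodeMetric : ∀ {n} → Metric n → Tree
encodeMetric D = encodeList (tabulate λ i → encodeList (tabulate λ j → encodeℕ (dist D i j)))

record TRP : Set where
  field
    n      : ℕ
    metric : Metric (suc n)
    origin : Fin (suc n)

encodeTRP : TRP → Tree
encodeTRP I = encodeFin origin ∙ encodeMetric metric
  where open TRP I

module _ (I : TRP) where
  open TRP I

  record Solution : Set where
    field
      perm        : Permutation′ (suc n)
      starts-at-r : perm ⟨$⟩ʳ Fin.zero ≡ origin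

    sequence : List (Fin (suc n))
    sequence = tabulate (perm ⟨$⟩ʳ_)

    completionTime : Fin (suc n) → ℕ
    completionTime i = pathLength metric (take (suc (toℕ i)) sequence)

    value : ℕ
    value = sum (tabulate completionTime)

  open Solution

  Optimal : Solution → Set
  Optimal Π = ∀ Π′ → value Π ℕ.≤ value Π′

  IsTRPApprox : ℝ → Tree → Set
  IsTRPApprox ρ y = Σ[ Π ∈ Solution ]
    (y ≡ encodePoints (sequence Π) ×
     (∀ Π* → Optimal Π* → fromℕ (value Π) ≤ᴿ ρ *ᴿ fromℕ (value Π*)))

PolyTimeTRPApprox : ∀ {ℓ} → MetricClass ℓ → ℝ → Set ℓ
PolyTimeTRPApprox M ρ =
  PolyTimeSolvable encodeTRP (λ I → M (TRP.metric I)) (λ I → IsTRPApprox I ρ)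

-- There are K = suc k segments: the bound l_K on the length must exist.
record SegTSP (k : ℕ) : Set where
  field
    n        : ℕ
    metric   : Metric (suc n)
    origin   : Fin (suc n)
    len      : Fin (suc k) → ℕ
    num      : Fin (suc k) → ℕ
    len-mono : ∀ {g h} → g Fin.≤ h → len g ℕ.≤ len h
    num-mono : ∀ {g h} → g Fin.≤ h → num g ℕ.≤ num h

encodeSegTSP : ∀ {k} → SegTSP k → Tree
encodeSegTSP I = encodeFin origin ∙ encodeMetric metric
               ∙ encodeList (tabulate λ h → encodeℕ (len h))
               ∙ encodeList (tabulate λ h → encodeℕ (num h))
  where open SegTSP I

module _ {k : ℕ} (I : SegTSP k) where
  open SegTSP I

  -- The closed walk from the origin to itself through the given points,
  -- where points may be repeated.
  tour : List (Fin (suc n)) → List (Fin (suc n))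
  tour vs = origin ∷ (vs ∷ʳ origin)

  -- The requirements on a tour, where `d ≼ l' says that the travelled
  -- distance d counts as within the limit l.  The origin is a point of V
  -- and is counted as visited.
  Meets : (ℕ → ℕ → Set) → List (Fin (suc n)) → Set
  Meets _≼_ τ =
    (∀ h → ∃[ i ] (pathLength metric (take i τ) ≼ len h × num h ℕ.≤ numVisited (take i τ))) ×
    pathLength metric τ ≼ len (Fin.fromℕ k)

  Feasible : Set
  Feasible = ∃[ vs ] Meets ℕ._≤_ (tour vs)

  IsSegTSPApprox : ℝ → Tree → Set
  IsSegTSPApprox α y = Feasible →
    ∃[ vs ] (y ≡ encodePoints (tour vs) × Meets (λ d l → fromℕ d ≤ᴿ α *ᴿ fromℕ l) (tour vs))

PolyTimeSegTSPApprox : ∀ {ℓ} → MetricClass ℓ → ℕ → ℝ → Set ℓ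
PolyTimeSegTSPApprox M k α =
  PolyTimeSolvable (encodeSegTSP {k}) (λ I → M (SegTSP.metric I)) (λ I → IsSegTSPApprox I α)

{-# OPTIONS --safe #-}

-- Round the completion times of an optimal solution up to thresholds growing by a factor of about 1 + 1/p, and cut the
-- time axis at every H-th threshold.  In each window the repairman forgets the past and follows, from the origin, an
-- α-approximate segmented tour whose H + 2 requirements are read off the optimal solution.  The requirements only count
-- points, so they can be enumerated; the approximate tours so obtained are glued by a dynamic program over the number m of
-- visited points that keeps for each m the cheapest walk found.  Restarting at a cut B delays the points still unvisited by
-- O(αB); as thresholds grow geometrically, for fixed p these delays summed over all thresholds are O(α) times the optimum,
-- so some offset of the cuts incurs only O(α/H) of it.  The program never uses α, nor does it test whether a requirement is
-- feasible: what the oracle returns on infeasible requirements is decoded into some tour and can only add candidates.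
-- Running times are bounded in the depth of the input, because sharing lets the oracle return trees of exponential size but
-- not depth.
module Submission where

open import Defs
open import Data.Bool using (Bool; true; false; not; _∨_; if_then_else_)
open import Data.Unit using (⊤; tt)
import Data.Nat.Binary as ℕᵇ
import Data.Nat.Binary.Properties as ℕᵇ
open import Data.Nat.Binary.Base using (ℕᵇ; 2[1+_]; 1+[2_])
open import Data.Nat
open import Data.Nat.Properties
open import Data.Nat.Tactic.RingSolver using (solve-∀)
open import Data.Product using (∃-syntax; _×_; _,_; proj₁; proj₂)
open import Data.Sum using (_⊎_; inj₁; inj₂)
open import Data.Fin as Fin using (Fin; toℕ)
import Data.Fin.Properties as Fin
open import Data.Fin.Permutation using (permutation; _⟨$⟩ʳ_; _⟨$⟩ˡ_; inverseˡ)
open import Data.Nat.ListAction using (sum)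
open import Data.List using (List; []; _∷_; _++_; length; map; drop; take; tabulate; allFin; reverse; _ʳ++_; downFrom)
import Data.List as List
import Data.List.Properties as List
open import Data.List.Membership.Propositional using (_∈_; _∉_)
open import Data.List.Membership.Propositional.Properties using (∈-allFin; ∈-lookup; ∈-map⁺; ∈-map⁻; ∈-deduplicate⁺; ∈-deduplicate⁻; ∈-tabulate⁺)
import Data.List.Membership.DecPropositional as DecMembership
open import Data.List.Relation.Unary.Any as Any using (here; there)
open import Data.List.Relation.Unary.Any.Properties using (lookup-index)
open import Data.List.Relation.Unary.All as All using (All; []; _∷_)
import Data.List.Relation.Unary.All.Properties as All
open import Data.List.Relation.Unary.AllPairs using ([]; _∷_)
open import Data.List.Relation.Unary.Unique.Propositional using (Unique)
import Data.List.Relation.Unary.Unique.Propositional.Properties as Unique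
open import Data.List.Relation.Unary.Unique.DecPropositional.Properties using (deduplicate-!)
open import Function using (_∘_; id)
open import Relation.Nullary using (¬_; Dec; yes; no; does; contradiction)
open import Relation.Nullary.Decidable using (dec-true; dec-false)
open import Relation.Binary.PropositionalEquality using (_≡_; _≢_; refl; sym; trans; cong; cong₂; subst; subst₂)
import Data.Integer as ℤ
import Data.Integer.Properties as ℤ
open import Data.Rational as ℚ using (ℚ)
import Data.Rational.Properties as ℚ
open import Data.Rational.Solver using (module +-*-Solver)
import Data.Rational.Unnormalised as ℚᵘ
import Data.Rational.Unnormalised.Properties as ℚᵘ

-- Polynomial-time programs

-- Gluing works because the accounting is by the number of points and not by their identity. A step
-- weighs the number of points still unvisited, and this weight is split over indices c, the unit
-- with index c being owed until more than c points are visited. Once a tour alone has visited more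
-- than c points, so has a walker who follows it after visiting other points. Hence earlier progress
-- never hurts, and requirements on counts suffice to bound the cost of a glued walk. The constants,
-- for thresholds l growing by about 1 + 1/p with p = 2^a: rounding up costs a factor of at most 1 +
-- 1/p. The optimal solution followed up to B = l b and back has length at most 2B, and l (p + b)
-- lies between 2B and 3^p B; up to α, this is what a point not finished by B pays. The B below a
-- completion time C sum to at most (p + 1) C, so with H = (p + 1) p 3^p offsets some offset keeps
-- these payments within 1/p of the total. The result is α (1 + 2/p), with 2/p at most a rational
-- below ε.

slack : ∀ {m n} k → m + k ≡ n → m ≤ n
slack k refl = m≤m+n _ k

infixl 6 _⊕_
infixl 7 _⊗_
infixr 8 _⊚_

-- Polynomials are syntax closed under composition, so that costs can be computed by recursion on
-- programs. Natural coefficients make evaluation monotone, which lets an upper bound on an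
-- intermediate depth be substituted for the depth.
data Poly : Set where
  con         : ℕ → Poly
  𝕏           : Poly
  _⊕_ _⊗_ _⊚_ : Poly → Poly → Poly

infix 9 _⟨_⟩

_⟨_⟩ : Poly → ℕ → ℕ
con k ⟨ n ⟩   = k
𝕏 ⟨ n ⟩       = n
(P ⊕ Q) ⟨ n ⟩ = P ⟨ n ⟩ + Q ⟨ n ⟩
(P ⊗ Q) ⟨ n ⟩ = P ⟨ n ⟩ * Q ⟨ n ⟩
(P ⊚ Q) ⟨ n ⟩ = P ⟨ Q ⟨ n ⟩ ⟩

poly-mono : ∀ P {m n} → m ≤ n → P ⟨ m ⟩ ≤ P ⟨ n ⟩
poly-mono (con k) m≤n = ≤-refl
poly-mono 𝕏       m≤n = m≤n
poly-mono (P ⊕ Q) m≤n = +-mono-≤ (poly-mono P m≤n) (poly-mono Q m≤n)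
poly-mono (P ⊗ Q) m≤n = *-mono-≤ (poly-mono P m≤n) (poly-mono Q m≤n)
poly-mono (P ⊚ Q) m≤n = poly-mono P (poly-mono Q m≤n)

^-distribʳ-* : ∀ e m n → (m * n) ^ e ≡ m ^ e * n ^ e
^-distribʳ-* zero    m n = refl
^-distribʳ-* (suc e) m n = trans (cong (m * n *_) (^-distribʳ-* e m n)) (interchange m n (m ^ e) (n ^ e))
  where
  interchange : ∀ a b c d → a * b * (c * d) ≡ a * c * (b * d)
  interchange = solve-∀

-- Powers of `suc n` are at least 1. Sums need this to raise both terms to a common exponent, and
-- compositions to absorb a constant term into the coefficient.
poly-bound : ∀ P → ∃[ c ] ∃[ e ] (∀ n → P ⟨ n ⟩ ≤ c * suc n ^ e)
poly-bound (con k) = k , 0 , λ n → ≤-reflexive (sym (*-identityʳ k))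
poly-bound 𝕏       = 1 , 1 , λ n → slack 1 (lemma n)
  where
  lemma : ∀ n → n + 1 ≡ 1 * (suc n * 1)
  lemma = solve-∀
poly-bound (P ⊕ Q) with poly-bound P | poly-bound Q
... | c , e , p | c′ , e′ , q = c + c′ , e + e′ , λ n → begin
    P ⟨ n ⟩ + Q ⟨ n ⟩
      ≤⟨ +-mono-≤ (p n) (q n) ⟩
    c * suc n ^ e + c′ * suc n ^ e′
      ≤⟨ +-mono-≤ (*-monoʳ-≤ c (^-monoʳ-≤ (suc n) (m≤m+n e e′)))
                  (*-monoʳ-≤ c′ (^-monoʳ-≤ (suc n) (m≤n+m e′ e))) ⟩
    c * suc n ^ (e + e′) + c′ * suc n ^ (e + e′)
      ≡⟨ sym (*-distribʳ-+ (suc n ^ (e + e′)) c c′) ⟩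
    (c + c′) * suc n ^ (e + e′) ∎
  where open ≤-Reasoning
poly-bound (P ⊗ Q) with poly-bound P | poly-bound Q
... | c , e , p | c′ , e′ , q = c * c′ , e + e′ , λ n → begin
    P ⟨ n ⟩ * Q ⟨ n ⟩
      ≤⟨ *-mono-≤ (p n) (q n) ⟩
    (c * suc n ^ e) * (c′ * suc n ^ e′)
      ≡⟨ interchange c (suc n ^ e) c′ (suc n ^ e′) ⟩
    c * c′ * (suc n ^ e * suc n ^ e′)
      ≡⟨ cong (c * c′ *_) (sym (^-distribˡ-+-* (suc n) e e′)) ⟩
    c * c′ * suc n ^ (e + e′) ∎
  where
  open ≤-Reasoning
  interchange : ∀ a b c d → a * b * (c * d) ≡ a * c * (b * d)
  interchange = solve-∀
poly-bound (P ⊚ Q) with poly-bound P | poly-bound Q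
... | c , e , p | c′ , e′ , q = c * suc c′ ^ e , e′ * e , λ n → begin
    P ⟨ Q ⟨ n ⟩ ⟩
      ≤⟨ p (Q ⟨ n ⟩) ⟩
    c * suc (Q ⟨ n ⟩) ^ e
      ≤⟨ *-monoʳ-≤ c (^-monoˡ-≤ e (s≤s (q n))) ⟩
    c * suc (c′ * suc n ^ e′) ^ e
      ≤⟨ *-monoʳ-≤ c (^-monoˡ-≤ e (+-monoˡ-≤ (c′ * suc n ^ e′) (m^n>0 (suc n) e′))) ⟩
    c * (suc c′ * suc n ^ e′) ^ e
      ≡⟨ cong (c *_) (^-distribʳ-* e (suc c′) (suc n ^ e′)) ⟩
    c * (suc c′ ^ e * (suc n ^ e′) ^ e)
      ≡⟨ sym (*-assoc c (suc c′ ^ e) _) ⟩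
    c * suc c′ ^ e * (suc n ^ e′) ^ e
      ≡⟨ cong (c * suc c′ ^ e *_) (^-*-assoc (suc n) e′ e) ⟩
    c * suc c′ ^ e * suc n ^ (e′ * e) ∎
  where open ≤-Reasoning

-- Depth as the measure of inputs and results

depth : Tree → ℕ
depth nil     = 0
depth (s ∙ t) = suc (depth s ⊔ depth t)

depth-left : ∀ s t → depth s ≤ depth (s ∙ t)
depth-left s t = m≤n⇒m≤1+n (m≤m⊔n (depth s) (depth t))

depth-right : ∀ s t → depth t ≤ depth (s ∙ t)
depth-right s t = m≤n⇒m≤1+n (m≤n⊔m (depth s) (depth t))

depth≤size : ∀ t → depth t ≤ size t
depth≤size nil     = z≤n
depth≤size (s ∙ t) = s≤s (⊔-lub (≤-trans (depth≤size s) (m≤m+n _ _)) (≤-trans (depth≤size t) (m≤n+m _ _)))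

depth-hd : ∀ t → depth (hd t) ≤ depth t
depth-hd nil     = z≤n
depth-hd (s ∙ t) = depth-left s t

depth-tl : ∀ t → depth (tl t) ≤ depth t
depth-tl nil     = z≤n
depth-tl (s ∙ t) = depth-right s t

-- Sharing makes the size of a result exponential in the running time, but its depth grows by at most one per step.
depth-output : ∀ {p x y t} → ⟦ p ⟧ x ⇓ y within t → depth y ≤ t + depth x
depth-output run-id          = n≤1+n _
depth-output run-nil         = z≤n
depth-output (run-hd {x})    = m≤n⇒m≤1+n (depth-hd x)
depth-output (run-tl {x})    = m≤n⇒m≤1+n (depth-tl x)
depth-output (run-cons {x = x} {s = s} {t = t} p q) = s≤s (⊔-lub
  (≤-trans (depth-output p) (+-monoˡ-≤ (depth x) (m≤m+n s t)))
  (≤-trans (depth-output q) (+-monoˡ-≤ (depth x) (m≤n+m t s))))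
depth-output (run-⨟ {x = x} {s = s} {t = t} p q) =
  ≤-trans (depth-output q) (≤-trans (+-monoʳ-≤ t (depth-output p)) (slack 1 (lemma t s (depth x))))
  where
  lemma : ∀ t s d → t + (s + d) + 1 ≡ suc (s + t) + d
  lemma = solve-∀
depth-output (if-true {x = x} {s = s} {t = t} _ _ q) =
  ≤-trans (depth-output q) (+-monoˡ-≤ (depth x) (m≤n⇒m≤1+n (m≤n+m t s)))
depth-output (if-false {x = x} {s = s} {t = t} _ q) =
  ≤-trans (depth-output q) (+-monoˡ-≤ (depth x) (m≤n⇒m≤1+n (m≤n+m t s)))
depth-output (loop-exit {x = x} {s = s} _) = m≤n+m (depth x) (suc s)
depth-output (loop-step {x = x} {s = s} {t = t} {u = u} _ _ p q) =
  ≤-trans (depth-output q) (≤-trans (+-monoʳ-≤ u (depth-output p)) (slack (suc s) (lemma s t u (depth x))))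
  where
  lemma : ∀ s t u d → u + (t + d) + suc s ≡ suc (s + t + u) + d
  lemma = solve-∀

-- Programs with compositional cost bounds

infixr 5 _∷ᵉ_

data Exp : Set where
  #_    : ℕ → Exp
  allᵉ  : Exp
  nilᵉ  : Exp
  hdᵉ   : Exp → Exp
  tlᵉ   : Exp → Exp
  _∷ᵉ_  : Exp → Exp → Exp

drops : ℕ → Tree → Tree
drops zero    x = x
drops (suc k) x = drops k (tl x)

⟪_⟫ : Exp → Tree → Tree
⟪ # k ⟫ x      = hd (drops k x)
⟪ allᵉ ⟫ x     = x
⟪ nilᵉ ⟫ x     = nil
⟪ hdᵉ e ⟫ x    = hd (⟪ e ⟫ x)
⟪ tlᵉ e ⟫ x    = tl (⟪ e ⟫ x)
⟪ e ∷ᵉ f ⟫ x   = ⟪ e ⟫ x ∙ ⟪ f ⟫ x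

trueᵉ : Exp
trueᵉ = nilᵉ ∷ᵉ nilᵉ

varCode : ℕ → Program
varCode zero    = `hd
varCode (suc k) = `tl ⨟ varCode k

varSteps : ℕ → ℕ
varSteps zero    = 1
varSteps (suc k) = suc (1 + varSteps k)

run-var : ∀ k {x} → ⟦ varCode k ⟧ x ⇓ hd (drops k x) within varSteps k
run-var zero    = run-hd
run-var (suc k) = run-⨟ run-tl (run-var k)

expCode : Exp → Program
expCode (# k)    = varCode k
expCode allᵉ     = `id
expCode nilᵉ     = `nil
expCode (hdᵉ e)  = expCode e ⨟ `hd
expCode (tlᵉ e)  = expCode e ⨟ `tl
expCode (e ∷ᵉ f) = `cons (expCode e) (expCode f)

expSteps : Exp → ℕ
expSteps (# k)    = varSteps k
expSteps allᵉ     = 1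
expSteps nilᵉ     = 1
expSteps (hdᵉ e)  = suc (expSteps e + 1)
expSteps (tlᵉ e)  = suc (expSteps e + 1)
expSteps (e ∷ᵉ f) = suc (expSteps e + expSteps f)

run-exp : ∀ e {x} → ⟦ expCode e ⟧ x ⇓ ⟪ e ⟫ x within expSteps e
run-exp (# k)    = run-var k
run-exp allᵉ     = run-id
run-exp nilᵉ     = run-nil
run-exp (hdᵉ e)  = run-⨟ (run-exp e) run-hd
run-exp (tlᵉ e)  = run-⨟ (run-exp e) run-tl
run-exp (e ∷ᵉ f) = run-cons (run-exp e) (run-exp f)

infixr 7 _⨾_
infixr 4 _≫_ _on_

-- Programs with time bounds that are polynomial in the depth of the input.  An input is a list of variables.
-- P ≫ Q binds the result of P as variable 0 of Q.  On acc ∙ list ∙ env, loop β B traverses the list; its body maps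
-- acc ∙ remaining list ∙ env to the next accumulator, and β bounds the depth of the accumulators.
data Prog : Set where
  raw  : Program → Poly → Prog
  exp  : Exp → Prog
  _⨾_  : Prog → Prog → Prog
  _≫_  : Prog → Prog → Prog
  ifP  : Exp → Prog → Prog → Prog
  loop : Poly → Prog → Prog

_on_ : Prog → Exp → Prog
P on e = exp e ⨾ P

mutual

  code : Prog → Program
  code (raw p c)   = p
  code (exp e)     = expCode e
  code (P ⨾ Q)     = code P ⨟ code Q
  code (P ≫ Q)     = `cons (code P) `id ⨟ code Q
  code (ifP e P Q) = `if (expCode e) (code P) (code Q)
  code (loop β B)  = whileCode B ⨟ `hd

  whileCode : Prog → Program
  whileCode B = `while (`tl ⨟ `hd) (`cons (code B) (`cons (`tl ⨟ `hd ⨟ `tl) (`tl ⨟ `tl)))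

-- The cost of a second program is evaluated at a bound on the depth of its input, since the result
-- of the first is deeper than its input by at most its steps. A loop makes one iteration per spine
-- node of its list, hence at most as many as the depth of the input.
cost : Prog → Poly
cost (raw p c)   = c
cost (exp e)     = con (expSteps e)
cost (P ⨾ Q)     = con 1 ⊕ (cost P ⊕ cost Q ⊚ (cost P ⊕ 𝕏))
cost (P ≫ Q)     = con 3 ⊕ (cost P ⊕ cost Q ⊚ (con 2 ⊕ cost P ⊕ 𝕏))
cost (ifP e P Q) = con 1 ⊕ (con (expSteps e) ⊕ (cost P ⊕ cost Q))
cost (loop β B)  = con 6 ⊕ 𝕏 ⊗ (con 14 ⊕ cost B ⊚ (con 2 ⊕ (β ⊕ 𝕏)))

infix 4 _∶_⇒_

record _∶_⇒_ (P : Prog) (x y : Tree) : Set where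
  constructor runs
  field
    {steps} : ℕ
    run     : ⟦ code P ⟧ x ⇓ y within steps
    bounded : steps ≤ cost P ⟨ depth x ⟩

⇒-resp : ∀ {P x y z} → y ≡ z → P ∶ x ⇒ y → P ∶ x ⇒ z
⇒-resp refl r = r

⨾-⇒ : ∀ {P Q x y z} → P ∶ x ⇒ y → Q ∶ y ⇒ z → P ⨾ Q ∶ x ⇒ z
⨾-⇒ {Q = Q} {x = x} (runs r s≤) (runs r′ t≤) = runs (run-⨟ r r′)
  (s≤s (+-mono-≤ s≤ (≤-trans t≤ (poly-mono (cost Q) (≤-trans (depth-output r) (+-monoˡ-≤ (depth x) s≤))))))

exp-⇒ : ∀ {e x} → exp e ∶ x ⇒ ⟪ e ⟫ x
exp-⇒ {e} = runs (run-exp e) ≤-refl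

on-⇒ : ∀ {P e x y} → P ∶ ⟪ e ⟫ x ⇒ y → (P on e) ∶ x ⇒ y
on-⇒ r = ⨾-⇒ exp-⇒ r

≫-⇒ : ∀ {P Q x y z} → P ∶ x ⇒ y → Q ∶ y ∙ x ⇒ z → (P ≫ Q) ∶ x ⇒ z
≫-⇒ {P} {Q} {x = x} {y} (runs {s} r s≤) (runs {t} r′ t≤) = runs (run-⨟ (run-cons r run-id) r′)
  (≤-trans (≤-reflexive (lemma s t)) (s≤s (s≤s (s≤s (+-mono-≤ s≤ (≤-trans t≤ (poly-mono (cost Q) bound)))))))
  where
  lemma : ∀ s t → suc (suc (s + 1) + t) ≡ 3 + (s + t)
  lemma = solve-∀
  bound : depth (y ∙ x) ≤ 2 + cost P ⟨ depth x ⟩ + depth x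
  bound = s≤s (⊔-lub
    (m≤n⇒m≤1+n (≤-trans (depth-output r) (+-monoˡ-≤ (depth x) s≤)))
    (m≤n⇒m≤1+n (m≤n+m (depth x) _)))

encodeBool : Bool → Tree
encodeBool false = nil
encodeBool true  = nil ∙ nil

ifP-cons : ∀ {e P Q x y s t} → ⟪ e ⟫ x ≡ s ∙ t → P ∶ x ⇒ y → ifP e P Q ∶ x ⇒ y
ifP-cons {e} eq (runs r s≤) = runs
  (if-true (run-exp e) (λ eq′ → contradiction (trans (sym eq) eq′) λ ()) r)
  (s≤s (+-monoʳ-≤ (expSteps e) (≤-trans s≤ (m≤m+n _ _))))

ifP-nil : ∀ {e P Q x y} → ⟪ e ⟫ x ≡ nil → Q ∶ x ⇒ y → ifP e P Q ∶ x ⇒ y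
ifP-nil {e} {x = x} eq (runs r s≤) = runs
  (if-false (subst (λ b → ⟦ expCode e ⟧ x ⇓ b within expSteps e) eq (run-exp e)) r)
  (s≤s (+-monoʳ-≤ (expSteps e) (≤-trans s≤ (m≤n+m _ _))))

ifP-⇒ : ∀ {e P Q x} {y : Bool → Tree} b → ⟪ e ⟫ x ≡ encodeBool b →
        (b ≡ true → P ∶ x ⇒ y true) → (b ≡ false → Q ∶ x ⇒ y false) → ifP e P Q ∶ x ⇒ y b
ifP-⇒ true  eq p q = ifP-cons eq (p refl)
ifP-⇒ false eq p q = ifP-nil eq (q refl)

length≤depth : ∀ ts → length ts ≤ depth (encodeList ts)
length≤depth []       = z≤n
length≤depth (t ∷ ts) = s≤s (≤-trans (length≤depth ts) (m≤n⊔m (depth t) _))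

module _ {β : Poly} {B : Prog} {env : Tree} (Inv : List Tree → Tree → Set)
  (step : ∀ t ts a → Inv (t ∷ ts) a → ∃[ a′ ] ((B ∶ a ∙ encodeList (t ∷ ts) ∙ env ⇒ a′) × Inv ts a′)) where

  -- The depth of the accumulators is bounded in advance, in terms of the initial depth `D`.
  -- Bounding each iteration by the output of the previous one would iterate the polynomial `cost B`
  -- and leave the polynomials.
  while-⇒ : ∀ D ts a → Inv ts a → depth (encodeList ts ∙ env) ≤ D →
    (∀ ts a → Inv ts a → depth a ≤ β ⟨ D ⟩) →
    ∃[ a′ ] ∃[ t ] ((⟦ whileCode B ⟧ a ∙ encodeList ts ∙ env ⇓ a′ ∙ nil ∙ env within t) ×
      t ≤ 4 + length ts * (14 + cost B ⟨ 2 + (β ⟨ D ⟩ + D) ⟩) × Inv [] a′)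
  while-⇒ D [] a inv env≤ acc≤ =
    a , 4 , loop-exit (run-⨟ run-tl run-hd) , ≤-refl , inv
  while-⇒ D (t ∷ ts) a inv env≤ acc≤ with step t ts a inv
  ... | a₁ , runs {s} body s≤ , inv₁ with while-⇒ D ts a₁ inv₁ (≤-trans tail≤ env≤) acc≤
    where
    tail≤ : depth (encodeList ts ∙ env) ≤ depth (encodeList (t ∷ ts) ∙ env)
    tail≤ = s≤s (⊔-monoˡ-≤ (depth env) (depth-right t (encodeList ts)))
  ... | a₂ , u , rest , u≤ , inv₂ = a₂ , _ ,
    loop-step (run-⨟ run-tl run-hd)
      (λ ()) (run-cons body (run-cons (run-⨟ run-tl (run-⨟ run-hd run-tl)) (run-⨟ run-tl run-tl))) rest ,
    bound , inv₂
    where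
    T = cost B ⟨ 2 + (β ⟨ D ⟩ + D) ⟩
    s≤T : s ≤ T
    s≤T = ≤-trans s≤ (poly-mono (cost B) (s≤s (⊔-lub
      (≤-trans (acc≤ _ a inv) (m≤n⇒m≤1+n (m≤m+n (β ⟨ D ⟩) D)))
      (≤-trans env≤ (m≤n⇒m≤1+n (m≤n+m D (β ⟨ D ⟩)))))))
    lemma : ∀ s u → suc (3 + suc (s + 9) + u) ≡ 14 + s + u
    lemma = solve-∀
    lemma₂ : ∀ T m → 14 + T + (4 + m) ≡ 4 + (14 + T + m)
    lemma₂ = solve-∀
    bound : suc (3 + suc (s + 9) + u) ≤ 4 + (14 + T + length ts * (14 + T))
    bound = ≤-trans (≤-reflexive (lemma s u))
      (≤-trans (+-mono-≤ (+-monoʳ-≤ 14 s≤T) u≤) (≤-reflexive (lemma₂ T (length ts * (14 + T)))))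

  loop-rule : ∀ ts a → Inv ts a →
    (∀ ts′ a′ → Inv ts′ a′ → depth a′ ≤ β ⟨ depth (a ∙ encodeList ts ∙ env) ⟩) →
    ∃[ a′ ] ((loop β B ∶ a ∙ encodeList ts ∙ env ⇒ a′) × Inv [] a′)
  loop-rule ts a inv acc≤ with while-⇒ (depth (a ∙ encodeList ts ∙ env)) ts a inv (depth-right a (encodeList ts ∙ env)) acc≤
  ... | a′ , t , r , t≤ , inv′ = a′ , runs (run-⨟ r run-hd) bound , inv′
    where
    D = depth (a ∙ encodeList ts ∙ env)
    T = 14 + cost B ⟨ 2 + (β ⟨ D ⟩ + D) ⟩
    lemma : ∀ m → suc (4 + m + 1) ≡ 6 + m
    lemma = solve-∀
    ts≤D : length ts ≤ D
    ts≤D = ≤-trans (length≤depth ts) (≤-trans (depth-left (encodeList ts) env) (depth-right a (encodeList ts ∙ env)))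
    bound : suc (t + 1) ≤ 6 + D * T
    bound = ≤-trans (s≤s (+-monoˡ-≤ 1 t≤)) (≤-trans (≤-reflexive (lemma (length ts * T))) (+-monoʳ-≤ 6 (*-monoˡ-≤ T ts≤D)))

encL : ∀ {A : Set} → (A → Tree) → List A → Tree
encL enc as = encodeList (map enc as)

foldTails : ∀ {A S : Set} → (A → List A → S → S) → List A → S → S
foldTails f []       s = s
foldTails f (a ∷ as) s = foldTails f as (f a as s)

-- The loop invariant carries the equation between the fold of the rest from the current state and
-- the fold of the whole, so that the result is identified when the list is used up.
fold-⇒ : ∀ {A S : Set} {encA : A → Tree} {encS : S → Tree} (f : A → List A → S → S) (Inv : List A → S → Set)
  {β B env} as s → Inv as s →
  (∀ a r s → Inv (a ∷ r) s → B ∶ encS s ∙ encL encA (a ∷ r) ∙ env ⇒ encS (f a r s)) →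
  (∀ a r s → Inv (a ∷ r) s → Inv r (f a r s)) →
  (∀ r s′ → Inv r s′ → depth (encS s′) ≤ β ⟨ depth (encS s ∙ encL encA as ∙ env) ⟩) →
  loop β B ∶ encS s ∙ encL encA as ∙ env ⇒ encS (foldTails f as s)
fold-⇒ {A} {S} {encA} {encS} f Inv {β} {B} {env} as s inv step pres bound = finish
  (loop-rule {β} {B} {env} Inv′ step′ (map encA as) (encS s) (as , s , refl , refl , refl , inv) bound′)
  where
  Inv′ : List Tree → Tree → Set
  Inv′ ts a = ∃[ r ] ∃[ s′ ] (ts ≡ map encA r × a ≡ encS s′ × foldTails f r s′ ≡ foldTails f as s × Inv r s′)
  step′ : ∀ t ts a → Inv′ (t ∷ ts) a → ∃[ a′ ] ((B ∶ a ∙ encodeList (t ∷ ts) ∙ env ⇒ a′) × Inv′ ts a′)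
  step′ t ts a (b ∷ r , s′ , refl , refl , eq , inv′) =
    encS (f b r s′) , step b r s′ inv′ , r , f b r s′ , refl , refl , eq , pres b r s′ inv′
  bound′ : ∀ ts a → Inv′ ts a → depth a ≤ β ⟨ depth (encS s ∙ encL encA as ∙ env) ⟩
  bound′ ts a (r , s′ , _ , a≡ , _ , inv′) = ≤-trans (≤-reflexive (cong depth a≡)) (bound r s′ inv′)
  finish : ∃[ a ] ((loop β B ∶ encS s ∙ encL encA as ∙ env ⇒ a) × Inv′ [] a) →
    loop β B ∶ encS s ∙ encL encA as ∙ env ⇒ encS (foldTails f as s)
  finish (a , r , [] , s′ , _ , a≡ , eq , _) = ⇒-resp (trans a≡ (cong encS eq)) r

grow : Poly → Poly
grow γ = 𝕏 ⊕ 𝕏 ⊗ γ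

length≤depth-encL : ∀ {A : Set} (enc : A → Tree) as → length as ≤ depth (encL enc as)
length≤depth-encL enc []       = z≤n
length≤depth-encL enc (a ∷ as) = s≤s (≤-trans (length≤depth-encL enc as) (m≤n⊔m (depth (enc a)) _))

-- Additive growth keeps iteration polynomial: with `D` the initial depth, at most `D` steps each
-- add at most `γ ⟨ D ⟩`. The invariant pays in advance for the remaining steps by adding
-- `length r * G` to the current depth.
growᴵ-⇒ : ∀ {A S : Set} {encA : A → Tree} {encS : S → Tree} (f : A → List A → S → S) (Inv : List A → S → Set)
  {γ B env} as s → Inv as s →
  (∀ a r s → Inv (a ∷ r) s → B ∶ encS s ∙ encL encA (a ∷ r) ∙ env ⇒ encS (f a r s)) →
  (∀ a r s → Inv (a ∷ r) s → Inv r (f a r s)) →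
  (∀ a r s′ → Inv (a ∷ r) s′ → depth (encL encA (a ∷ r)) ≤ depth (encS s ∙ encL encA as ∙ env) →
    depth (encS (f a r s′)) ≤ γ ⟨ depth (encS s ∙ encL encA as ∙ env) ⟩ + depth (encS s′)) →
  loop (grow γ) B ∶ encS s ∙ encL encA as ∙ env ⇒ encS (foldTails f as s)
growᴵ-⇒ {A} {S} {encA} {encS} f Inv {γ} {B} {env} as s inv step pres growth =
  fold-⇒ {encA = encA} {encS = encS} f Inv′ as s
    (inv , as≤D , +-mono-≤ (depth-left (encS s) (encL encA as ∙ env)) (*-monoˡ-≤ G (≤-trans (length≤depth-encL encA as) as≤D)))
    (λ a r s′ i → step a r s′ (proj₁ i))
    (λ { a r s′ (i , r≤ , s≤) → pres a r s′ i , ≤-trans (depth-right (encA a) (encL encA r)) r≤ ,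
        ≤-trans (+-monoˡ-≤ (length r * G) (growth a r s′ i r≤))
          (≤-trans (≤-reflexive (lemma G (depth (encS s′)) (length r * G))) s≤) })
    (λ { r s′ (_ , _ , s≤) → ≤-trans (m≤m+n _ (length r * G)) s≤ })
  where
  D = depth (encS s ∙ encL encA as ∙ env)
  G = γ ⟨ D ⟩
  as≤D : depth (encL encA as) ≤ D
  as≤D = ≤-trans (depth-left (encL encA as) env) (depth-right (encS s) (encL encA as ∙ env))
  Inv′ : List A → S → Set
  Inv′ r s′ = Inv r s′ × depth (encL encA r) ≤ D × depth (encS s′) + length r * G ≤ D + D * G
  lemma : ∀ g d m → g + d + m ≡ d + (g + m)
  lemma = solve-∀

grow-⇒ : ∀ {A S : Set} {encA : A → Tree} {encS : S → Tree} (f : A → List A → S → S)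
  {γ B env} as s →
  (∀ a r s → B ∶ encS s ∙ encL encA (a ∷ r) ∙ env ⇒ encS (f a r s)) →
  (∀ a r s′ → depth (encL encA (a ∷ r)) ≤ depth (encS s ∙ encL encA as ∙ env) →
    depth (encS (f a r s′)) ≤ γ ⟨ depth (encS s ∙ encL encA as ∙ env) ⟩ + depth (encS s′)) →
  loop (grow γ) B ∶ encS s ∙ encL encA as ∙ env ⇒ encS (foldTails f as s)
grow-⇒ {encA = encA} {encS} f {γ} as s step growth =
  growᴵ-⇒ {encA = encA} {encS = encS} f (λ _ _ → ⊤) {γ} as s tt
    (λ a r s _ → step a r s) (λ _ _ _ _ → tt) (λ a r s _ → growth a r s)

depth-∙-≤ : ∀ {s t m n} → depth s ≤ m → depth t ≤ n → depth (s ∙ t) ≤ suc (m + n)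
depth-∙-≤ {m = m} {n} s≤m t≤n = s≤s (⊔-lub (≤-trans s≤m (m≤m+n m n)) (≤-trans t≤n (m≤n+m n m)))

revOnto : Prog
revOnto = loop (grow (con 1 ⊕ 𝕏)) (exp (hdᵉ (# 1) ∷ᵉ # 0))

revOnto-⇒ : ∀ {A : Set} (enc : A → Tree) as bs {env} →
  revOnto ∶ encL enc bs ∙ encL enc as ∙ env ⇒ encL enc (as ʳ++ bs)
revOnto-⇒ enc as bs = ⇒-resp (cong (encL enc) (foldTails≡ʳ++ as bs))
  (grow-⇒ {encA = enc} {encS = encL enc} (λ a _ s → a ∷ s) as bs (λ _ _ _ → exp-⇒)
    (λ a r s le → depth-∙-≤ {enc a} {encL enc s} (≤-trans (depth-left (enc a) (encL enc r)) le) ≤-refl))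
  where
  foldTails≡ʳ++ : ∀ as bs → foldTails (λ a _ s → a ∷ s) as bs ≡ as ʳ++ bs
  foldTails≡ʳ++ []       bs = refl
  foldTails≡ʳ++ (a ∷ as) bs = foldTails≡ʳ++ as (a ∷ bs)

-- Binary arithmetic

-- Bijective base two: `true` is the digit 1, `false` the digit 2, the least significant digit comes
-- first and 0 is the empty numeral. Every number has exactly one numeral, so equality can be tested
-- digit by digit.
val : List Bool → ℕ
val []          = 0
val (false ∷ b) = 2 * suc (val b)
val (true ∷ b)  = suc (2 * val b)

toBits : ℕᵇ → List Bool
toBits ℕᵇ.zero  = []
toBits 2[1+ x ] = false ∷ toBits x
toBits 1+[2 x ] = true ∷ toBits x

fromBits : List Bool → ℕᵇ
fromBits []          = ℕᵇ.zero
fromBits (false ∷ b) = 2[1+ fromBits b ]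
fromBits (true ∷ b)  = 1+[2 fromBits b ]

bits : ℕ → List Bool
bits n = toBits (ℕᵇ.fromℕ n)

encodeBits : List Bool → Tree
encodeBits = encL encodeBool

encodeℕ-bits : ∀ n → encodeℕ n ≡ encodeBits (bits n)
encodeℕ-bits n = go (ℕᵇ.fromℕ n)
  where
  go : ∀ x → encodeℕᵇ x ≡ encodeBits (toBits x)
  go ℕᵇ.zero  = refl
  go 2[1+ x ] = cong (nil ∙_) (go x)
  go 1+[2 x ] = cong ((nil ∙ nil) ∙_) (go x)

val-bits : ∀ n → val (bits n) ≡ n
val-bits n = trans (go (ℕᵇ.fromℕ n)) (ℕᵇ.toℕ-fromℕ n)
  where
  go : ∀ x → val (toBits x) ≡ ℕᵇ.toℕ x
  go ℕᵇ.zero  = refl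
  go 2[1+ x ] = cong (λ n → 2 * suc n) (go x)
  go 1+[2 x ] = cong (λ n → suc (2 * n)) (go x)

bits-val : ∀ b → bits (val b) ≡ b
bits-val b = trans (cong (toBits ∘ ℕᵇ.fromℕ) (sym (toℕ-fromBits b)))
               (trans (cong toBits (ℕᵇ.fromℕ-toℕ (fromBits b))) (toBits-fromBits b))
  where
  toℕ-fromBits : ∀ b → ℕᵇ.toℕ (fromBits b) ≡ val b
  toℕ-fromBits []          = refl
  toℕ-fromBits (false ∷ b) = cong (λ n → 2 * suc n) (toℕ-fromBits b)
  toℕ-fromBits (true ∷ b)  = cong (λ n → suc (2 * n)) (toℕ-fromBits b)
  toBits-fromBits : ∀ b → toBits (fromBits b) ≡ b
  toBits-fromBits []          = refl
  toBits-fromBits (false ∷ b) = cong (false ∷_) (toBits-fromBits b)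
  toBits-fromBits (true ∷ b)  = cong (true ∷_) (toBits-fromBits b)

encodeBits-val : ∀ b → encodeBits b ≡ encodeℕ (val b)
encodeBits-val b = trans (cong encodeBits (sym (bits-val b))) (sym (encodeℕ-bits (val b)))

len : ℕ → ℕ
len n = length (bits n)

-- Numerals of length k denote the numbers from 2^k - 1 to 2^(k+1) - 2; this lemma and the next give
-- the two ends.
2^length≤val : ∀ b → 2 ^ length b ≤ suc (val b)
2^length≤val []          = ≤-refl
2^length≤val (false ∷ b) = ≤-trans (*-monoʳ-≤ 2 (2^length≤val b)) (n≤1+n _)
2^length≤val (true ∷ b)  = ≤-trans (*-monoʳ-≤ 2 (2^length≤val b)) (≤-reflexive (*-suc 2 (val b)))

val<2^length : ∀ b → 2 + val b ≤ 2 ^ suc (length b)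
val<2^length []          = ≤-refl
val<2^length (false ∷ b) = ≤-trans (≤-reflexive (lemma (val b))) (*-monoʳ-≤ 2 (val<2^length b))
  where
  lemma : ∀ v → 2 + 2 * suc v ≡ 2 * (2 + v)
  lemma = solve-∀
val<2^length (true ∷ b)  = ≤-trans (slack 1 (lemma (val b))) (*-monoʳ-≤ 2 (val<2^length b))
  where
  lemma : ∀ v → 2 + suc (2 * v) + 1 ≡ 2 * (2 + v)
  lemma = solve-∀

2^len≤ : ∀ n → 2 ^ len n ≤ suc n
2^len≤ n = subst (λ m → 2 ^ len n ≤ suc m) (val-bits n) (2^length≤val (bits n))

<2^len : ∀ n → 2 + n ≤ 2 ^ suc (len n)
<2^len n = subst (λ m → 2 + m ≤ 2 ^ suc (len n)) (val-bits n) (val<2^length (bits n))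

m<2^m : ∀ m → m < 2 ^ m
m<2^m zero    = ≤-refl
m<2^m (suc m) = ≤-trans (+-mono-≤ (m^n>0 2 m) (m<2^m m)) (≤-reflexive (cong (2 ^ m +_) (sym (+-identityʳ (2 ^ m)))))

2^-cancel-< : ∀ m n → 2 ^ m < 2 ^ n → m < n
2^-cancel-< m n lt with m <? n
... | yes m<n = m<n
... | no  m≮n = contradiction lt (≤⇒≯ (^-monoʳ-≤ 2 (≮⇒≥ m≮n)))

len-double : ∀ {m n} → m ≤ suc (2 * n) → len m ≤ suc (len n)
len-double {m} {n} m≤ = s≤s⁻¹ (2^-cancel-< (len m) (2 + len n) (begin-strict
    2 ^ len m         ≤⟨ 2^len≤ m ⟩
    suc m             ≤⟨ s≤s m≤ ⟩
    2 + 2 * n         <⟨ slack 1 (lemma n) ⟩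
    2 * (2 + n)       ≤⟨ *-monoʳ-≤ 2 (<2^len n) ⟩
    2 ^ (2 + len n)   ∎))
  where
  open ≤-Reasoning
  lemma : ∀ n → suc (2 + 2 * n) + 1 ≡ 2 * (2 + n)
  lemma = solve-∀

len-+ : ∀ m n → len (m + n) ≤ suc (len m + len n)
len-+ m n with ≤-total m n
... | inj₁ m≤n = ≤-trans (len-double {m + n} {n} (≤-trans (+-monoˡ-≤ n m≤n) (slack 1 (lemma n)))) (s≤s (m≤n+m (len n) (len m)))
  where
  lemma : ∀ n → n + n + 1 ≡ suc (2 * n)
  lemma = solve-∀
... | inj₂ n≤m = ≤-trans (len-double {m + n} {m} (≤-trans (+-monoʳ-≤ m n≤m) (slack 1 (lemma m)))) (s≤s (m≤m+n (len m) (len n)))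
  where
  lemma : ∀ n → n + n + 1 ≡ suc (2 * n)
  lemma = solve-∀

depth-encodeBool : ∀ b → depth (encodeBool b) ≤ 1
depth-encodeBool false = z≤n
depth-encodeBool true  = ≤-refl

depth-encodeBits : ∀ b → depth (encodeBits b) ≤ suc (length b)
depth-encodeBits []      = z≤n
depth-encodeBits (d ∷ b) = s≤s (⊔-lub (≤-trans (depth-encodeBool d) (s≤s z≤n)) (depth-encodeBits b))

depth-encodeℕ : ∀ n → depth (encodeℕ n) ≤ suc (len n)
depth-encodeℕ n = subst (λ t → depth t ≤ suc (len n)) (sym (encodeℕ-bits n)) (depth-encodeBits (bits n))

len≤depth : ∀ n → len n ≤ depth (encodeℕ n)
len≤depth n = subst (λ t → len n ≤ depth t) (sym (encodeℕ-bits n)) (length≤depth-encL encodeBool (bits n))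

sucBits : List Bool → List Bool
sucBits []          = true ∷ []
sucBits (false ∷ b) = true ∷ sucBits b
sucBits (true ∷ b)  = false ∷ b

val-sucBits : ∀ b → val (sucBits b) ≡ suc (val b)
val-sucBits []          = refl
val-sucBits (false ∷ b) = cong (λ v → suc (2 * v)) (val-sucBits b)
val-sucBits (true ∷ b)  = *-suc 2 (val b)

length-sucBits : ∀ b → length (sucBits b) ≤ suc (length b)
length-sucBits []          = ≤-refl
length-sucBits (false ∷ b) = s≤s (length-sucBits b)
length-sucBits (true ∷ b)  = n≤1+n _

encodeCarry : Bool × List Bool → Tree
encodeCarry (c , o) = encodeBool c ∙ encodeBits o

sucStep : Bool → List Bool → Bool × List Bool → Bool × List Bool
sucStep d     _ (false , o) = false , d ∷ o
sucStep true  _ (true  , o) = false , false ∷ o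
sucStep false _ (true  , o) = true , true ∷ o

sucBody : Prog
sucBody = ifP (hdᵉ (# 0))
  (ifP (hdᵉ (# 1)) (exp (nilᵉ ∷ᵉ nilᵉ ∷ᵉ tlᵉ (# 0))) (exp (trueᵉ ∷ᵉ trueᵉ ∷ᵉ tlᵉ (# 0))))
  (exp (nilᵉ ∷ᵉ hdᵉ (# 1) ∷ᵉ tlᵉ (# 0)))

sucProg : Prog
sucProg = (loop (grow (con 3)) sucBody on ((trueᵉ ∷ᵉ nilᵉ) ∷ᵉ # 0 ∷ᵉ nilᵉ))
  ⨾ ifP (hdᵉ allᵉ) (revOnto on ((trueᵉ ∷ᵉ nilᵉ) ∷ᵉ tlᵉ allᵉ ∷ᵉ nilᵉ)) (revOnto on (nilᵉ ∷ᵉ tlᵉ allᵉ ∷ᵉ nilᵉ))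

-- The loop emits digits in reverse and remembers the carry; the final reversal starts from a single
-- digit 1 if the carry has survived the whole numeral.
sucBits-⇒ : ∀ b {env} → sucProg ∶ encodeBits b ∙ env ⇒ encodeBits (sucBits b)
sucBits-⇒ b = ⨾-⇒ (on-⇒ (grow-⇒ {encA = encodeBool} {encS = encodeCarry} sucStep b (true , []) step
  (λ d r s _ → growth d r s))) finish
  where
  step : ∀ d r s → sucBody ∶ encodeCarry s ∙ encodeBits (d ∷ r) ∙ nil ⇒ encodeCarry (sucStep d r s)
  step d     r (false , o) = ifP-nil refl exp-⇒
  step true  r (true  , o) = ifP-cons refl (ifP-cons refl exp-⇒)
  step false r (true  , o) = ifP-cons refl (ifP-nil refl exp-⇒)
  growth′ : ∀ c d c′ o → depth (encodeCarry (c , d ∷ o)) ≤ 3 + depth (encodeCarry (c′ , o))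
  growth′ c d c′ o = s≤s (⊔-lub (≤-trans (depth-encodeBool c) (s≤s z≤n)) (s≤s (⊔-lub
    (≤-trans (depth-encodeBool d) (s≤s z≤n))
    (≤-trans (depth-right (encodeBool c′) (encodeBits o)) (n≤1+n _)))))
  growth : ∀ d r s → depth (encodeCarry (sucStep d r s)) ≤ 3 + depth (encodeCarry s)
  growth d     r (false , o) = growth′ false d false o
  growth true  r (true  , o) = growth′ false false true o
  growth false r (true  , o) = growth′ true true true o
  fin : Prog
  fin = ifP (hdᵉ allᵉ) (revOnto on ((trueᵉ ∷ᵉ nilᵉ) ∷ᵉ tlᵉ allᵉ ∷ᵉ nilᵉ)) (revOnto on (nilᵉ ∷ᵉ tlᵉ allᵉ ∷ᵉ nilᵉ))
  unwind : ∀ b c o → fin ∶ encodeCarry (foldTails sucStep b (c , o)) ⇒ encodeBits (o ʳ++ (if c then sucBits b else b))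
  unwind []          false o = ifP-nil refl (on-⇒ (revOnto-⇒ encodeBool o []))
  unwind []          true  o = ifP-cons refl (on-⇒ (revOnto-⇒ encodeBool o (true ∷ [])))
  unwind (d ∷ b)     false o = unwind b false (d ∷ o)
  unwind (false ∷ b) true  o = unwind b true (true ∷ o)
  unwind (true ∷ b)  true  o = unwind b false (false ∷ o)
  finish : fin ∶ encodeCarry (foldTails sucStep b (true , [])) ⇒ encodeBits (sucBits b)
  finish = unwind b true []

suc-⇒ : ∀ n {env} → sucProg ∶ encodeℕ n ∙ env ⇒ encodeℕ (suc n)
suc-⇒ n {env} = subst₂ (λ s t → sucProg ∶ s ∙ env ⇒ t) (sym (encodeℕ-bits n))
  (trans (encodeBits-val (sucBits (bits n))) (cong encodeℕ (trans (val-sucBits (bits n)) (cong suc (val-bits n)))))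
  (sucBits-⇒ (bits n))

-- A carry is added at once to the rest of the second numeral by `sucBits`. The additional passes
-- are affordable, and the loop needs no carry in its state.
addBits : List Bool → List Bool → List Bool
addBits []          y           = y
addBits (d ∷ x)     []          = d ∷ addBits x []
addBits (true ∷ x)  (true ∷ y)  = false ∷ addBits x y
addBits (true ∷ x)  (false ∷ y) = true ∷ addBits x (sucBits y)
addBits (false ∷ x) (true ∷ y)  = true ∷ addBits x (sucBits y)
addBits (false ∷ x) (false ∷ y) = false ∷ addBits x (sucBits y)

val-addBits : ∀ x y → val (addBits x y) ≡ val x + val y
val-addBits []          y  = refl
val-addBits (true ∷ x)  [] = trans (cong (λ v → suc (2 * v)) (val-addBits x [])) (lemma (val x))
  where
  lemma : ∀ v → suc (2 * (v + 0)) ≡ suc (2 * v) + 0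
  lemma = solve-∀
val-addBits (false ∷ x) [] = trans (cong (λ v → 2 * suc v) (val-addBits x [])) (lemma (val x))
  where
  lemma : ∀ v → 2 * suc (v + 0) ≡ 2 * suc v + 0
  lemma = solve-∀
val-addBits (true ∷ x)  (true ∷ y)  = trans (cong (λ v → 2 * suc v) (val-addBits x y)) (lemma (val x) (val y))
  where
  lemma : ∀ v w → 2 * suc (v + w) ≡ suc (2 * v) + suc (2 * w)
  lemma = solve-∀
val-addBits (true ∷ x)  (false ∷ y) = trans
  (cong (λ v → suc (2 * v)) (trans (val-addBits x (sucBits y)) (cong (val x +_) (val-sucBits y)))) (lemma (val x) (val y))
  where
  lemma : ∀ v w → suc (2 * (v + suc w)) ≡ suc (2 * v) + 2 * suc w
  lemma = solve-∀
val-addBits (false ∷ x) (true ∷ y)  = trans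
  (cong (λ v → suc (2 * v)) (trans (val-addBits x (sucBits y)) (cong (val x +_) (val-sucBits y)))) (lemma (val x) (val y))
  where
  lemma : ∀ v w → suc (2 * (v + suc w)) ≡ 2 * suc v + suc (2 * w)
  lemma = solve-∀
val-addBits (false ∷ x) (false ∷ y) = trans
  (cong (λ v → 2 * suc v) (trans (val-addBits x (sucBits y)) (cong (val x +_) (val-sucBits y)))) (lemma (val x) (val y))
  where
  lemma : ∀ v w → 2 * suc (v + suc w) ≡ 2 * suc v + 2 * suc w
  lemma = solve-∀

addStep : Bool → List Bool → List Bool × List Bool → List Bool × List Bool
addStep d     _ ([] , o)        = [] , d ∷ o
addStep true  _ (true ∷ y , o)  = y , false ∷ o
addStep true  _ (false ∷ y , o) = sucBits y , true ∷ o
addStep false _ (true ∷ y , o)  = sucBits y , true ∷ o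
addStep false _ (false ∷ y , o) = sucBits y , false ∷ o

encodeAdd : List Bool × List Bool → Tree
encodeAdd (y , o) = encodeBits y ∙ encodeBits o

addBody : Prog
addBody = ifP (hdᵉ (# 0))
  (ifP (hdᵉ (# 1))
    (ifP (hdᵉ (hdᵉ (# 0)))
      (exp (tlᵉ (hdᵉ (# 0)) ∷ᵉ nilᵉ ∷ᵉ tlᵉ (# 0)))
      (carry ≫ exp (# 0 ∷ᵉ trueᵉ ∷ᵉ tlᵉ (# 1))))
    (ifP (hdᵉ (hdᵉ (# 0)))
      (carry ≫ exp (# 0 ∷ᵉ trueᵉ ∷ᵉ tlᵉ (# 1)))
      (carry ≫ exp (# 0 ∷ᵉ nilᵉ ∷ᵉ tlᵉ (# 1)))))
  (exp (nilᵉ ∷ᵉ hdᵉ (# 1) ∷ᵉ tlᵉ (# 0)))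
  where
  carry : Prog
  carry = sucProg on (tlᵉ (hdᵉ (# 0)) ∷ᵉ nilᵉ)

addProg : Prog
addProg = (loop (grow (con 3)) addBody on ((# 1 ∷ᵉ nilᵉ) ∷ᵉ # 0 ∷ᵉ nilᵉ)) ⨾ (revOnto on (hdᵉ allᵉ ∷ᵉ tlᵉ allᵉ ∷ᵉ nilᵉ))

addBits-⇒ : ∀ x y {env} → addProg ∶ encodeBits x ∙ encodeBits y ∙ env ⇒ encodeBits (addBits x y)
addBits-⇒ x y = ⨾-⇒ (on-⇒ (grow-⇒ {encA = encodeBool} {encS = encodeAdd} addStep x (y , []) step
  (λ d r s _ → growth d r s))) (unwind x y [])
  where
  step : ∀ d r s → addBody ∶ encodeAdd s ∙ encodeBits (d ∷ r) ∙ nil ⇒ encodeAdd (addStep d r s)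
  step d     r ([] , o)        = ifP-nil refl exp-⇒
  step true  r (true ∷ y , o)  = ifP-cons refl (ifP-cons refl (ifP-cons refl exp-⇒))
  step true  r (false ∷ y , o) = ifP-cons refl (ifP-cons refl (ifP-nil refl (≫-⇒ (on-⇒ (sucBits-⇒ y)) exp-⇒)))
  step false r (true ∷ y , o)  = ifP-cons refl (ifP-nil refl (ifP-cons refl (≫-⇒ (on-⇒ (sucBits-⇒ y)) exp-⇒)))
  step false r (false ∷ y , o) = ifP-cons refl (ifP-nil refl (ifP-nil refl (≫-⇒ (on-⇒ (sucBits-⇒ y)) exp-⇒)))
  growth′ : ∀ d y y′ o → length y′ ≤ length y → depth (encodeAdd (y′ , d ∷ o)) ≤ 3 + depth (encodeAdd (y , o))
  growth′ d y y′ o y′≤y = s≤s (⊔-lub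
    (≤-trans (depth-encodeBits y′) (≤-trans (s≤s (≤-trans y′≤y (≤-trans (length≤depth-encL encodeBool y)
      (depth-left (encodeBits y) (encodeBits o))))) (n≤1+n _)))
    (s≤s (⊔-lub (≤-trans (depth-encodeBool d) (s≤s z≤n)) (≤-trans (depth-right (encodeBits y) (encodeBits o)) (n≤1+n _)))))
  growth : ∀ d r s → depth (encodeAdd (addStep d r s)) ≤ 3 + depth (encodeAdd s)
  growth d     r ([] , o) = growth′ d [] [] o ≤-refl
  growth true  r (true ∷ y , o) = growth′ false (true ∷ y) y o (n≤1+n _)
  growth true  r (false ∷ y , o) = growth′ true (false ∷ y) (sucBits y) o (length-sucBits y)
  growth false r (true ∷ y , o) = growth′ true (true ∷ y) (sucBits y) o (length-sucBits y)
  growth false r (false ∷ y , o) = growth′ false (false ∷ y) (sucBits y) o (length-sucBits y)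
  unwind : ∀ x y o → (revOnto on (hdᵉ allᵉ ∷ᵉ tlᵉ allᵉ ∷ᵉ nilᵉ)) ∶ encodeAdd (foldTails addStep x (y , o)) ⇒ encodeBits
    (o ʳ++ addBits x y)
  unwind []          y           o = on-⇒ (revOnto-⇒ encodeBool o y)
  unwind (d ∷ x)     []          o = unwind x [] (d ∷ o)
  unwind (true ∷ x)  (true ∷ y)  o = unwind x y (false ∷ o)
  unwind (true ∷ x)  (false ∷ y) o = unwind x (sucBits y) (true ∷ o)
  unwind (false ∷ x) (true ∷ y)  o = unwind x (sucBits y) (true ∷ o)
  unwind (false ∷ x) (false ∷ y) o = unwind x (sucBits y) (false ∷ o)

add-⇒ : ∀ m n {env} → addProg ∶ encodeℕ m ∙ encodeℕ n ∙ env ⇒ encodeℕ (m + n)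
add-⇒ m n {env} = subst₂ (λ s t → addProg ∶ s ⇒ t)
  (cong₂ (λ s t → s ∙ t ∙ env) (sym (encodeℕ-bits m)) (sym (encodeℕ-bits n)))
  (trans (encodeBits-val (addBits (bits m) (bits n)))
    (cong encodeℕ (trans (val-addBits (bits m) (bits n)) (cong₂ _+_ (val-bits m) (val-bits n)))))
  (addBits-⇒ (bits m) (bits n))

-- Started with `false`, the comparison decides the strict order, started with `true` the weak one;
-- the penalty is the unit by which they differ.
penalty : Bool → ℕ
penalty true  = 0
penalty false = 1

penalty≤1 : ∀ f → penalty f ≤ 1
penalty≤1 true  = z≤n
penalty≤1 false = ≤-refl

compareDigit : Bool → Bool → Bool → Bool
compareDigit true  true  f = f
compareDigit true  false f = true
compareDigit false true  f = false
compareDigit false false f = f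

-- The flag says whether the digits read so far, which are the least significant ones, favour x < y.
ltBits : Bool → List Bool → List Bool → Bool
ltBits f []      []      = f
ltBits f []      (e ∷ y) = true
ltBits f (d ∷ x) []      = false
ltBits f (d ∷ x) (e ∷ y) = ltBits (compareDigit d e f) x y

ltBits-true : ∀ f x y → ltBits f x y ≡ true → penalty f + val x ≤ val y
ltBits-true true  []          []          eq = z≤n
ltBits-true true  []          (e ∷ y)     eq = z≤n
ltBits-true false []          (true ∷ y)  eq = s≤s z≤n
ltBits-true false []          (false ∷ y) eq = s≤s z≤n
ltBits-true f     (true ∷ x)  (true ∷ y)  eq = subst (_≤ suc (2 * val y)) (sym (+-suc (penalty f) _))
  (s≤s (≤-trans (slack (penalty f) (lemma (penalty f) (val x))) (*-monoʳ-≤ 2 (ltBits-true f x y eq))))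
  where
  lemma : ∀ p v → p + 2 * v + p ≡ 2 * (p + v)
  lemma = solve-∀
ltBits-true f     (true ∷ x)  (false ∷ y) eq = ≤-trans (+-mono-≤ (penalty≤1 f) (s≤s (*-monoʳ-≤ 2 (ltBits-true true x y eq))))
  (≤-reflexive (lemma (val y)))
  where
  lemma : ∀ v → 1 + suc (2 * v) ≡ 2 * suc v
  lemma = solve-∀
ltBits-true f     (false ∷ x) (true ∷ y)  eq = ≤-trans (+-monoˡ-≤ (2 * suc (val x)) (penalty≤1 f))
  (s≤s (*-monoʳ-≤ 2 (ltBits-true false x y eq)))
ltBits-true f     (false ∷ x) (false ∷ y) eq = ≤-trans (slack (penalty f) (lemma (penalty f) (val x)))
  (*-monoʳ-≤ 2 (s≤s (ltBits-true f x y eq)))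
  where
  lemma : ∀ p v → p + 2 * suc v + p ≡ 2 * suc (p + v)
  lemma = solve-∀

ltBits-false : ∀ f x y → ltBits f x y ≡ false → penalty (not f) + val y ≤ val x
ltBits-false false []          []          eq = z≤n
ltBits-false true  (true ∷ x)  []          eq = s≤s z≤n
ltBits-false true  (false ∷ x) []          eq = s≤s z≤n
ltBits-false false (d ∷ x)     []          eq = z≤n
ltBits-false f     (true ∷ x)  (true ∷ y)  eq = subst (_≤ suc (2 * val x)) (sym (+-suc (penalty (not f)) _))
  (s≤s (≤-trans (slack (penalty (not f)) (lemma (penalty (not f)) (val y))) (*-monoʳ-≤ 2 (ltBits-false f x y eq))))
  where
  lemma : ∀ p v → p + 2 * v + p ≡ 2 * (p + v)
  lemma = solve-∀
ltBits-false f     (true ∷ x)  (false ∷ y) eq = ≤-trans (+-monoˡ-≤ (2 * suc (val y)) (penalty≤1 (not f)))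
  (s≤s (*-monoʳ-≤ 2 (ltBits-false true x y eq)))
ltBits-false f     (false ∷ x) (true ∷ y)  eq = ≤-trans
  (+-mono-≤ (penalty≤1 (not f)) (s≤s (*-monoʳ-≤ 2 (ltBits-false false x y eq))))
  (≤-reflexive (lemma (val x)))
  where
  lemma : ∀ v → 1 + suc (2 * v) ≡ 2 * suc v
  lemma = solve-∀
ltBits-false f     (false ∷ x) (false ∷ y) eq = ≤-trans (slack (penalty (not f)) (lemma (penalty (not f)) (val y)))
  (*-monoʳ-≤ 2 (s≤s (ltBits-false f x y eq)))
  where
  lemma : ∀ p v → p + 2 * suc v + p ≡ 2 * suc (p + v)
  lemma = solve-∀

ltStep : Bool → List Bool → Bool × List Bool → Bool × List Bool
ltStep d _ (f , [])    = false , []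
ltStep d _ (f , e ∷ y) = compareDigit d e f , y

ltBody : Prog
ltBody = ifP (tlᵉ (# 0))
  (ifP (hdᵉ (# 1)) (ifP (hdᵉ (tlᵉ (# 0))) keep (exp (trueᵉ ∷ᵉ rest))) (ifP (hdᵉ (tlᵉ (# 0))) (exp (nilᵉ ∷ᵉ rest)) keep))
  (exp (nilᵉ ∷ᵉ nilᵉ))
  where
  rest : Exp
  rest = tlᵉ (tlᵉ (# 0))
  keep : Prog
  keep = exp (hdᵉ (# 0) ∷ᵉ rest)

ltFinish : Prog
ltFinish = ifP (tlᵉ allᵉ) (exp trueᵉ) (exp (hdᵉ allᵉ))

ltProg : Prog
ltProg = (loop (grow (con 1)) ltBody on ((nilᵉ ∷ᵉ # 1) ∷ᵉ # 0 ∷ᵉ nilᵉ)) ⨾ ltFinish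

ltBits-⇒ : ∀ x y {env} → ltProg ∶ encodeBits x ∙ encodeBits y ∙ env ⇒ encodeBool (ltBits false x y)
ltBits-⇒ x y = ⨾-⇒ (on-⇒ (grow-⇒ {encA = encodeBool} {encS = encodeCarry} ltStep x (false , y) step (λ d r s _ → growth d r s)))
  (finish x y false)
  where
  step : ∀ d r s → ltBody ∶ encodeCarry s ∙ encodeBits (d ∷ r) ∙ nil ⇒ encodeCarry (ltStep d r s)
  step d     r (f , [])        = ifP-nil refl exp-⇒
  step true  r (f , true ∷ y)  = ifP-cons refl (ifP-cons refl (ifP-cons refl exp-⇒))
  step true  r (f , false ∷ y) = ifP-cons refl (ifP-cons refl (ifP-nil refl exp-⇒))
  step false r (f , true ∷ y)  = ifP-cons refl (ifP-nil refl (ifP-cons refl exp-⇒))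
  step false r (f , false ∷ y) = ifP-cons refl (ifP-nil refl (ifP-nil refl exp-⇒))
  growth : ∀ d r s → depth (encodeCarry (ltStep d r s)) ≤ 1 + depth (encodeCarry s)
  growth d r (f , [])    = s≤s z≤n
  growth d r (f , e ∷ y) = s≤s (⊔-lub (≤-trans (depth-encodeBool (compareDigit d e f)) (s≤s z≤n))
    (≤-trans (depth-right (encodeBool e) (encodeBits y)) (depth-right (encodeBool f) (encodeBits (e ∷ y)))))
  finish : ∀ x y f → ltFinish ∶ encodeCarry (foldTails ltStep x (f , y)) ⇒ encodeBool (ltBits f x y)
  finish []      []      f = ifP-nil refl exp-⇒
  finish []      (e ∷ y) f = ifP-cons refl exp-⇒
  finish (d ∷ x) (e ∷ y) f = finish x y (compareDigit d e f)
  finish (d ∷ x) []      f = empty x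
    where
    empty : ∀ x → ltFinish ∶ encodeCarry (foldTails ltStep x (false , [])) ⇒ nil
    empty []      = ifP-nil refl exp-⇒
    empty (d ∷ x) = empty x

lt : ℕ → ℕ → Bool
lt m n = ltBits false (bits m) (bits n)

lt-true : ∀ m n → lt m n ≡ true → m < n
lt-true m n eq = subst₂ _<_ (val-bits m) (val-bits n) (ltBits-true false (bits m) (bits n) eq)

lt-false : ∀ m n → lt m n ≡ false → n ≤ m
lt-false m n eq = subst₂ _≤_ (val-bits n) (val-bits m) (ltBits-false false (bits m) (bits n) eq)

lt-⇒ : ∀ m n {env} → ltProg ∶ encodeℕ m ∙ encodeℕ n ∙ env ⇒ encodeBool (lt m n)
lt-⇒ m n {env} = subst (λ s → ltProg ∶ s ⇒ encodeBool (lt m n))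
  (cong₂ (λ s t → s ∙ t ∙ env) (sym (encodeℕ-bits m)) (sym (encodeℕ-bits n))) (ltBits-⇒ (bits m) (bits n))

agree : Bool → Tree → Bool
agree true  nil     = false
agree true  (_ ∙ _) = true
agree false nil     = true
agree false (_ ∙ _) = false

-- The second operand is an arbitrary tree, because what the oracle returns on an infeasible
-- instance need not encode anything.
match : Bool → List Bool → Tree → Bool
match ok []      nil     = ok
match ok []      (_ ∙ _) = false
match ok (d ∷ b) nil     = false
match ok (d ∷ b) (s ∙ t) = match (if agree d s then ok else false) b t

match-refl : ∀ b → match true b (encodeBits b) ≡ true
match-refl []          = refl
match-refl (false ∷ b) = match-refl b
match-refl (true ∷ b)  = match-refl b

match-false : ∀ b t → match false b t ≡ false
match-false []      nil     = refl
match-false []      (_ ∙ _) = refl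
match-false (d ∷ b) nil     = refl
match-false (d ∷ b) (s ∙ t) with agree d s
... | true  = match-false b t
... | false = match-false b t

match-sound : ∀ b b′ → match true b (encodeBits b′) ≡ true → b ≡ b′
match-sound []          []           eq = refl
match-sound (true ∷ b)  (true ∷ b′)  eq = cong (true ∷_) (match-sound b b′ eq)
match-sound (false ∷ b) (false ∷ b′) eq = cong (false ∷_) (match-sound b b′ eq)
match-sound (true ∷ b)  (false ∷ b′) eq = contradiction (trans (sym eq) (match-false b (encodeBits b′))) λ ()
match-sound (false ∷ b) (true ∷ b′)  eq = contradiction (trans (sym eq) (match-false b (encodeBits b′))) λ ()

matchStep : Bool → List Bool → Bool × Tree → Bool × Tree
matchStep d _ (ok , nil)   = false , nil
matchStep d _ (ok , s ∙ t) = (if agree d s then ok else false) , t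

matchBody : Prog
matchBody = ifP (tlᵉ (# 0))
  (ifP (hdᵉ (# 1)) (ifP (hdᵉ (tlᵉ (# 0))) keep fail) (ifP (hdᵉ (tlᵉ (# 0))) fail keep))
  (exp (nilᵉ ∷ᵉ nilᵉ))
  where
  rest : Exp
  rest = tlᵉ (tlᵉ (# 0))
  keep fail : Prog
  keep = exp (hdᵉ (# 0) ∷ᵉ rest)
  fail = exp (nilᵉ ∷ᵉ rest)

matchFinish : Prog
matchFinish = ifP (tlᵉ allᵉ) (exp nilᵉ) (exp (hdᵉ allᵉ))

matchProg : Prog
matchProg = (loop (grow (con 0)) matchBody on ((trueᵉ ∷ᵉ # 1) ∷ᵉ # 0 ∷ᵉ nilᵉ)) ⨾ matchFinish

matchBits-⇒ : ∀ b t {env} → matchProg ∶ encodeBits b ∙ t ∙ env ⇒ encodeBool (match true b t)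
matchBits-⇒ b t = ⨾-⇒ (on-⇒ (grow-⇒ {encA = encodeBool} {encS = encodeMatch} matchStep b (true , t) step
  (λ d r s _ → growth d r s)))
  (finish b t true)
  where
  encodeMatch : Bool × Tree → Tree
  encodeMatch (ok , t) = encodeBool ok ∙ t
  step : ∀ d r s → matchBody ∶ encodeMatch s ∙ encodeBits (d ∷ r) ∙ nil ⇒ encodeMatch (matchStep d r s)
  step d     r (ok , nil)           = ifP-nil refl exp-⇒
  step true  r (ok , nil ∙ t)       = ifP-cons refl (ifP-cons refl (ifP-nil refl exp-⇒))
  step true  r (ok , (_ ∙ _) ∙ t)   = ifP-cons refl (ifP-cons refl (ifP-cons refl exp-⇒))
  step false r (ok , nil ∙ t)       = ifP-cons refl (ifP-nil refl (ifP-nil refl exp-⇒))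
  step false r (ok , (_ ∙ _) ∙ t)   = ifP-cons refl (ifP-nil refl (ifP-cons refl exp-⇒))
  growth : ∀ d r s → depth (encodeMatch (matchStep d r s)) ≤ depth (encodeMatch s)
  growth d r (ok , nil)   = s≤s z≤n
  growth d r (ok , s ∙ t) with agree d s
  ... | true  = s≤s (⊔-monoʳ-≤ (depth (encodeBool ok)) (depth-right s t))
  ... | false = s≤s (≤-trans (depth-right s t) (m≤n⊔m (depth (encodeBool ok)) _))
  finish : ∀ b t ok → matchFinish ∶ encodeMatch (foldTails matchStep b (ok , t)) ⇒ encodeBool (match ok b t)
  finish []      nil     ok = ifP-nil refl exp-⇒
  finish []      (_ ∙ _) ok = ifP-cons refl exp-⇒
  finish (d ∷ b) (s ∙ t) ok = finish b t _
  finish (d ∷ b) nil     ok = empty b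
    where
    empty : ∀ b → matchFinish ∶ encodeMatch (foldTails matchStep b (false , nil)) ⇒ nil
    empty []      = ifP-nil refl exp-⇒
    empty (d ∷ b) = empty b

matchℕ : ℕ → Tree → Bool
matchℕ n t = match true (bits n) t

matchℕ-refl : ∀ n → matchℕ n (encodeℕ n) ≡ true
matchℕ-refl n = subst (λ t → matchℕ n t ≡ true) (sym (encodeℕ-bits n)) (match-refl (bits n))

matchℕ-sound : ∀ m n → matchℕ m (encodeℕ n) ≡ true → m ≡ n
matchℕ-sound m n eq = trans (sym (val-bits m)) (trans (cong val
  (match-sound (bits m) (bits n) (subst (λ t → matchℕ m t ≡ true) (encodeℕ-bits n) eq))) (val-bits n))

match-⇒ : ∀ n t {env} → matchProg ∶ encodeℕ n ∙ t ∙ env ⇒ encodeBool (matchℕ n t)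
match-⇒ n t {env} = subst (λ s → matchProg ∶ s ∙ t ∙ env ⇒ encodeBool (matchℕ n t)) (sym (encodeℕ-bits n))
  (matchBits-⇒ (bits n) t)

-- The threshold sequence

halfBits : List Bool → List Bool
halfBits []          = []
halfBits (true ∷ b)  = b
halfBits (false ∷ b) = sucBits b

halfProg : Prog
halfProg = ifP (# 0) (ifP (hdᵉ (# 0)) (exp (tlᵉ (# 0))) (sucProg on (tlᵉ (# 0) ∷ᵉ nilᵉ))) (exp nilᵉ)

halfBits-⇒ : ∀ b {env} → halfProg ∶ encodeBits b ∙ env ⇒ encodeBits (halfBits b)
halfBits-⇒ []          = ifP-nil refl exp-⇒
halfBits-⇒ (true ∷ b)  = ifP-cons refl (ifP-cons refl exp-⇒)
halfBits-⇒ (false ∷ b) = ifP-cons refl (ifP-nil refl (on-⇒ (sucBits-⇒ b)))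

half : ℕ → ℕ
half n = val (halfBits (bits n))

half-⇒ : ∀ n {env} → halfProg ∶ encodeℕ n ∙ env ⇒ encodeℕ (half n)
half-⇒ n {env} = subst₂ (λ s t → halfProg ∶ s ∙ env ⇒ t) (sym (encodeℕ-bits n)) (encodeBits-val (halfBits (bits n)))
  (halfBits-⇒ (bits n))

half-bounds : ∀ n → 2 * half n ≤ n × n < 2 * suc (half n)
half-bounds n = subst (λ m → 2 * half n ≤ m × m < 2 * suc (half n)) (val-bits n) (go (bits n))
  where
  go : ∀ b → 2 * val (halfBits b) ≤ val b × val b < 2 * suc (val (halfBits b))
  go []          = z≤n , s≤s z≤n
  go (true ∷ b)  = n≤1+n _ , ≤-reflexive (sym (*-suc 2 (val b)))
  go (false ∷ b) rewrite val-sucBits b = ≤-refl , ≤-trans (s≤s (n≤1+n _)) (≤-reflexive (sym (*-suc 2 (suc (val b)))))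

-- Division by `2 ^ a`, rounded down. Taking a power of two as the divisor reduces division to
-- halving.
shift : ℕ → ℕ → ℕ
shift zero    n = n
shift (suc a) n = shift a (half n)

shiftProg : ℕ → Prog
shiftProg zero    = exp (# 0)
shiftProg (suc a) = halfProg ⨾ (shiftProg a on (allᵉ ∷ᵉ nilᵉ))

shift-⇒ : ∀ a n {env} → shiftProg a ∶ encodeℕ n ∙ env ⇒ encodeℕ (shift a n)
shift-⇒ zero    n = exp-⇒
shift-⇒ (suc a) n = ⨾-⇒ (half-⇒ n) (on-⇒ (shift-⇒ a (half n)))

shift-bounds : ∀ a n → 2 ^ a * shift a n ≤ n × n < 2 ^ a * suc (shift a n)
shift-bounds zero    n = ≤-reflexive (+-identityʳ n) , ≤-reflexive (sym (+-identityʳ (suc n)))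
shift-bounds (suc a) n with half-bounds n | shift-bounds a (half n)
... | h≤ , <h | s≤ , <s =
  ≤-trans (≤-reflexive (*-assoc 2 (2 ^ a) (shift a (half n)))) (≤-trans (*-monoʳ-≤ 2 s≤) h≤) ,
  ≤-trans <h (≤-trans (*-monoʳ-≤ 2 <s) (≤-reflexive (sym (*-assoc 2 (2 ^ a) _))))

-- Growth by the factor 1 + 1/2^a, rounded down; the additional unit lets the sequence leave 0 and
-- makes it strictly increasing.
next : ℕ → ℕ → ℕ
next a l = suc (shift a l + l)

nextProg : ℕ → Prog
nextProg a = shiftProg a ≫ ((addProg on (# 0 ∷ᵉ # 1 ∷ᵉ nilᵉ)) ⨾ (sucProg on (allᵉ ∷ᵉ nilᵉ)))

next-⇒ : ∀ a l {env} → nextProg a ∶ encodeℕ l ∙ env ⇒ encodeℕ (next a l)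
next-⇒ a l = ≫-⇒ (shift-⇒ a l) (⨾-⇒ (on-⇒ (add-⇒ (shift a l) l)) (on-⇒ (suc-⇒ (shift a l + l))))

threshold : ℕ → ℕ → ℕ
threshold a zero    = 0
threshold a (suc h) = next a (threshold a h)

shift≤ : ∀ a n → shift a n ≤ n
shift≤ a n = ≤-trans (m≤n*m (shift a n) (2 ^ a) {{m^n≢0 2 a}}) (proj₁ (shift-bounds a n))

len-next : ∀ a l → len (next a l) ≤ suc (len l)
len-next a l = len-double {next a l} {l} (s≤s (≤-trans (+-monoˡ-≤ l (shift≤ a l)) (slack 0 (lemma l))))
  where
  lemma : ∀ l → l + l + 0 ≡ 2 * l
  lemma = solve-∀

-- Points and walks

matchFin : ∀ {N} (i j : Fin N) → matchℕ (toℕ i) (encodeFin j) ≡ does (i Fin.≟ j)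
matchFin i j with i Fin.≟ j
... | yes refl = matchℕ-refl (toℕ i)
... | no  i≢j with matchℕ (toℕ i) (encodeFin j) in eq
...   | true  = contradiction (Fin.toℕ-injective (matchℕ-sound (toℕ i) (toℕ j) eq)) i≢j
...   | false = refl

infix 4 _∈?_

_∈?_ : ∀ {N} (i : Fin N) (is : List (Fin N)) → Dec (i ∈ is)
_∈?_ = DecMembership._∈?_ Fin._≟_

memberProg : Prog
memberProg = loop (grow (con 1)) (ifP (# 0) (exp (# 0)) (matchProg on (# 2 ∷ᵉ hdᵉ (# 1) ∷ᵉ nilᵉ))) on
  (nilᵉ ∷ᵉ # 1 ∷ᵉ # 0 ∷ᵉ nilᵉ)

member-⇒ : ∀ {N} (i : Fin N) is {env} → memberProg ∶ encodeFin i ∙ encodePoints is ∙ env ⇒ encodeBool (does (i ∈? is))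
member-⇒ i is = on-⇒ (⇒-resp (cong encodeBool (fold≡ is false))
  (grow-⇒ {encA = encodeFin} {encS = encodeBool} f is false step
    (λ j r s _ → ≤-trans (depth-encodeBool (f j r s)) (m≤m+n 1 _))))
  where
  f : Fin _ → List (Fin _) → Bool → Bool
  f j _ s = s ∨ matchℕ (toℕ i) (encodeFin j)
  step : ∀ j r s → ifP (# 0) (exp (# 0)) (matchProg on (# 2 ∷ᵉ hdᵉ (# 1) ∷ᵉ nilᵉ)) ∶
    encodeBool s ∙ encodePoints (j ∷ r) ∙ encodeFin i ∙ nil ⇒ encodeBool (f j r s)
  step j r true  = ifP-cons refl exp-⇒
  step j r false = ifP-nil refl (on-⇒ (match-⇒ (toℕ i) (encodeFin j)))
  fold≡ : ∀ is s → foldTails f is s ≡ s ∨ does (i ∈? is)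
  fold≡ []       true  = refl
  fold≡ []       false = refl
  fold≡ (j ∷ is) true  = fold≡ is true
  fold≡ (j ∷ is) false with matchℕ (toℕ i) (encodeFin j) | matchFin i j
  ... | true  | eq rewrite sym eq = fold≡ is true
  ... | false | eq rewrite sym eq = fold≡ is false

dropProg : Prog
dropProg = loop (grow (con 0)) (exp (tlᵉ (# 0)))

drop-⇒ : ∀ {A B : Set} (encA : A → Tree) (encB : B → Tree) as bs {env} →
  dropProg ∶ encL encB bs ∙ encL encA as ∙ env ⇒ encL encB (drop (length as) bs)
drop-⇒ encA encB as bs = ⇒-resp (cong (encL encB) (fold≡ as bs))
  (grow-⇒ {encA = encA} {encS = encL encB} (λ _ _ → drop 1) as bs (λ { _ _ [] → exp-⇒ ; _ _ (_ ∷ _) → exp-⇒ })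
    (λ { _ _ [] _ → z≤n ; _ _ (b ∷ bs) _ → depth-right (encB b) (encL encB bs) }))
  where
  fold≡ : ∀ {A B : Set} (as : List A) (bs : List B) → foldTails (λ _ _ → drop 1) as bs ≡ drop (length as) bs
  fold≡ []       bs       = refl
  fold≡ (a ∷ as) []       = trans (fold≡ as []) (List.drop-[] (length as))
  fold≡ (a ∷ as) (b ∷ bs) = fold≡ as bs

sameLengthProg : Prog
sameLengthProg = (dropProg on (# 1 ∷ᵉ # 0 ∷ᵉ nilᵉ)) ≫ ifP (# 0) (exp nilᵉ)
  ((dropProg on (# 1 ∷ᵉ # 2 ∷ᵉ nilᵉ)) ≫ ifP (# 0) (exp nilᵉ) (exp trueᵉ))

drop-∷⇒< : ∀ {A : Set} {a : A} k as {bs} → drop k as ≡ a ∷ bs → k < length as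
drop-∷⇒< zero    (a ∷ as) eq = s≤s z≤n
drop-∷⇒< (suc k) (a ∷ as) eq = s≤s (drop-∷⇒< k as eq)

drop-[]⇒≤ : ∀ {A : Set} k (as : List A) → drop k as ≡ [] → length as ≤ k
drop-[]⇒≤ zero    []       eq = z≤n
drop-[]⇒≤ (suc k) []       eq = z≤n
drop-[]⇒≤ (suc k) (a ∷ as) eq = s≤s (drop-[]⇒≤ k as eq)

-- The lists are dropped from each other in both directions; the lengths agree if nothing remains
-- either time. No arithmetic is involved.
sameLength-⇒ : ∀ {A : Set} (enc : A → Tree) as bs {env} →
  sameLengthProg ∶ encL enc as ∙ encL enc bs ∙ env ⇒ encodeBool (does (length as ≟ length bs))
sameLength-⇒ enc as bs {env} = ≫-⇒ (on-⇒ (drop-⇒ enc enc as bs)) (first (drop (length as) bs) refl)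
  where
  decide : ∀ {b} (d : Dec (length as ≡ length bs)) → ((length as ≡ length bs) → b ≡ true) →
    (length as ≢ length bs → b ≡ false) →
    encodeBool b ≡ encodeBool (does d)
  decide (yes p) t f = cong encodeBool (t p)
  decide (no ¬p) t f = cong encodeBool (f ¬p)
  rest : Prog
  rest = (dropProg on (# 1 ∷ᵉ # 2 ∷ᵉ nilᵉ)) ≫ ifP (# 0) (exp nilᵉ) (exp trueᵉ)
  second : ∀ cs → drop (length bs) as ≡ cs → length bs ≤ length as → ∀ {x} →
    ifP (# 0) (exp nilᵉ) (exp trueᵉ) ∶ encL enc cs ∙ x ⇒ encodeBool (does (length as ≟ length bs))
  second []       eq b≤a = ⇒-resp (decide {true} (length as ≟ length bs) (λ _ → refl)
    (λ ≢ → contradiction (≤-antisym (drop-[]⇒≤ (length bs) as eq) b≤a) ≢)) (ifP-nil refl exp-⇒)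
  second (_ ∷ _) eq b≤a = ⇒-resp (decide {false} (length as ≟ length bs)
    (λ ≡ → contradiction (drop-∷⇒< (length bs) as eq) (≤⇒≯ (≤-reflexive ≡))) (λ _ → refl)) (ifP-cons refl exp-⇒)
  first : ∀ cs → drop (length as) bs ≡ cs →
    ifP (# 0) (exp nilᵉ) rest ∶ encL enc cs ∙ encL enc as ∙ encL enc bs ∙ env ⇒ encodeBool (does (length as ≟ length bs))
  first []       eq = ifP-nil refl
    (≫-⇒ (on-⇒ (drop-⇒ enc enc bs as)) (second (drop (length bs) as) refl (drop-[]⇒≤ (length as) bs eq)))
  first (_ ∷ _) eq = ⇒-resp (decide {false} (length as ≟ length bs)
    (λ ≡ → contradiction (drop-∷⇒< (length as) bs eq) (≤⇒≯ (≤-reflexive (sym ≡)))) (λ _ → refl)) (ifP-cons refl exp-⇒)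

allPoints : ℕ → Tree
allPoints N = encodePoints (allFin N)

lookupBody : Prog
lookupBody = (matchProg on (# 2 ∷ᵉ hdᵉ (# 1) ∷ᵉ nilᵉ)) ≫
  ifP (# 0) (exp (hdᵉ (tlᵉ (# 1)) ∷ᵉ tlᵉ (tlᵉ (# 1)))) (exp (hdᵉ (# 1) ∷ᵉ tlᵉ (tlᵉ (# 1))))

lookupProg : Prog
lookupProg = (loop (grow (con 0)) lookupBody on ((nilᵉ ∷ᵉ # 1) ∷ᵉ # 2 ∷ᵉ # 0 ∷ᵉ nilᵉ)) ⨾ exp (hdᵉ allᵉ)

lookup-⇒ : ∀ {N} (i : Fin N) (g : Fin N → Tree) {env} → lookupProg ∶ encodeFin i ∙ encodeList
  (tabulate g) ∙ allPoints N ∙ env ⇒ g i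
lookup-⇒ {N} i g {env} = subst (λ ts → lookupProg ∶ encodeFin i ∙ encodeList ts ∙ allPoints N ∙ env ⇒ g i)
  (List.map-tabulate id g)
  (⇒-resp (fold≡ (allFin N) nil (inj₁ (∈-allFin i))) (⨾-⇒ (on-⇒
    (grow-⇒ {encA = encodeFin} {encS = enc} f (allFin N) (nil , encL g (allFin N)) step (λ j r s _ → growth j r s))) exp-⇒))
  where
  enc : Tree × Tree → Tree
  enc (res , row) = res ∙ row
  f : Fin N → List (Fin N) → Tree × Tree → Tree × Tree
  f j _ (res , row) = (if matchℕ (toℕ i) (encodeFin j) then hd row else res) , tl row
  step : ∀ j r s → lookupBody ∶ enc s ∙ encodePoints (j ∷ r) ∙ encodeFin i ∙ nil ⇒ enc (f j r s)
  step j r (res , row) = ≫-⇒ (on-⇒ (match-⇒ (toℕ i) (encodeFin j)))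
    (ifP-⇒ {y = λ b → (if b then hd row else res) ∙ tl row} (matchℕ (toℕ i) (encodeFin j)) refl (λ _ → exp-⇒) (λ _ → exp-⇒))
  growth : ∀ j r s → depth (enc (f j r s)) ≤ depth (enc s)
  growth j r (res , row) with matchℕ (toℕ i) (encodeFin j)
  ... | true  = s≤s (⊔-lub (≤-trans (depth-hd row) (m≤n⊔m (depth res) _)) (≤-trans (depth-tl row) (m≤n⊔m (depth res) _)))
  ... | false = s≤s (⊔-monoʳ-≤ (depth res) (depth-tl row))
  fold≡ : ∀ js res → i ∈ js ⊎ res ≡ g i → hd (enc (foldTails f js (res , encL g js))) ≡ g i
  fold≡ []       res (inj₂ eq) = eq
  fold≡ (j ∷ js) res h with matchℕ (toℕ i) (encodeFin j) in eq
  ... | true  = fold≡ js (g j) (inj₂ (cong g (sym (Fin.toℕ-injective (matchℕ-sound (toℕ i) (toℕ j) eq)))))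
  ... | false = fold≡ js res (later h)
    where
    later : i ∈ j ∷ js ⊎ res ≡ g i → i ∈ js ⊎ res ≡ g i
    later (inj₁ (here refl)) = contradiction (trans (sym eq) (matchℕ-refl (toℕ i))) λ ()
    later (inj₁ (there i∈))  = inj₁ i∈
    later (inj₂ eq)          = inj₂ eq

distProg : Prog
distProg = (lookupProg on (# 0 ∷ᵉ # 2 ∷ᵉ # 3 ∷ᵉ nilᵉ)) ≫ (lookupProg on (# 2 ∷ᵉ # 0 ∷ᵉ # 4 ∷ᵉ nilᵉ))

dist-⇒ : ∀ {N} (D : Metric N) u v {env} →
  distProg ∶ encodeFin u ∙ encodeFin v ∙ encodeMetric D ∙ allPoints N ∙ env ⇒ encodeℕ (dist D u v)
dist-⇒ D u v = ≫-⇒ (on-⇒ (lookup-⇒ u (λ i → encodeList (tabulate λ j → encodeℕ (dist D i j)))))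
  (on-⇒ (lookup-⇒ v (λ j → encodeℕ (dist D u j))))

-- One factor is unary, the length of a list. For the potential this list is what remains of all
-- points after dropping as many as are visited, so the number of unvisited points is never computed
-- as a numeral.
mulAddProg : Prog
mulAddProg = loop (grow (con 2 ⊕ 𝕏)) (addProg on (# 2 ∷ᵉ # 0 ∷ᵉ nilᵉ)) on (# 0 ∷ᵉ # 2 ∷ᵉ # 1 ∷ᵉ nilᵉ)

mulAdd-⇒ : ∀ {A : Set} (enc : A → Tree) t d as {env} →
  mulAddProg ∶ encodeℕ t ∙ encodeℕ d ∙ encL enc as ∙ env ⇒ encodeℕ (length as * d + t)
mulAdd-⇒ enc t d as = on-⇒ (⇒-resp (cong encodeℕ (fold≡ as t))
  (grow-⇒ {encA = enc} {encS = encodeℕ} (λ _ _ s → d + s) as t (λ _ _ s → on-⇒ (add-⇒ d s)) growth))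
  where
  fold≡ : ∀ {A : Set} (as : List A) t → foldTails (λ _ _ s → d + s) as t ≡ length as * d + t
  fold≡ []       t = refl
  fold≡ (_ ∷ as) t = trans (fold≡ as (d + t)) (lemma (length as * d) d t)
    where
    lemma : ∀ m d t → m + (d + t) ≡ d + m + t
    lemma = solve-∀
  growth : ∀ a r s → depth (encL enc (a ∷ r)) ≤ _ → depth (encodeℕ (d + s)) ≤
    2 + depth (encodeℕ t ∙ encL enc as ∙ encodeℕ d ∙ nil) + depth (encodeℕ s)
  growth a r s _ = ≤-trans (depth-encodeℕ (d + s)) (s≤s (≤-trans (len-+ d s) (s≤s (+-mono-≤ (≤-trans (len≤depth d)
    (≤-trans (depth-left (encodeℕ d) nil) (≤-trans (depth-right (encL enc as) (encodeℕ d ∙ nil))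
      (depth-right (encodeℕ t) (encL enc as ∙ encodeℕ d ∙ nil))))) (len≤depth s)))))

depth-∈ : ∀ {A : Set} (enc : A → Tree) {a as} → a ∈ as → depth (enc a) ≤ depth (encL enc as)
depth-∈ enc {as = b ∷ bs} (here refl) = depth-left (enc b) (encL enc bs)
depth-∈ enc {as = b ∷ bs} (there a∈)  = ≤-trans (depth-∈ enc a∈) (depth-right (enc b) (encL enc bs))

depth-tabulate : ∀ {N} (g : Fin N → Tree) i → depth (g i) ≤ depth (encodeList (tabulate g))
depth-tabulate {N} g i = subst (λ ts → depth (g i) ≤ depth (encodeList ts)) (List.map-tabulate id g) (depth-∈ g (∈-allFin i))

len-dist : ∀ {N} (D : Metric N) u v → len (dist D u v) ≤ depth (encodeMetric D)
len-dist D u v = ≤-trans (len≤depth (dist D u v)) (≤-trans (depth-tabulate (λ j → encodeℕ (dist D u j)) v)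
  (depth-tabulate (λ i → encodeList (tabulate λ j → encodeℕ (dist D i j))) u))

len-*-+ : ∀ k d t → len (k * d + t) ≤ k * suc (len d) + len t
len-*-+ zero    d t = ≤-refl
len-*-+ (suc k) d t = ≤-trans (≤-reflexive (cong len (+-assoc d (k * d) t))) (≤-trans (len-+ d (k * d + t))
  (≤-trans (s≤s (+-monoʳ-≤ (len d) (len-*-+ k d t)))
    (≤-reflexive (cong suc (sym (+-assoc (len d) (k * suc (len d)) (len t)))))))

length-allFin : ∀ N → length (allFin N) ≡ N
length-allFin N = List.length-tabulate {n = N} id

potentialBody : Prog
potentialBody = ifP (tlᵉ (# 1))
  ((distProg on (hdᵉ (# 1) ∷ᵉ hdᵉ (tlᵉ (# 1)) ∷ᵉ # 2 ∷ᵉ # 3 ∷ᵉ nilᵉ)) ≫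
   (dropProg on (# 4 ∷ᵉ tlᵉ (# 2) ∷ᵉ nilᵉ)) ≫
   (mulAddProg on (# 2 ∷ᵉ # 1 ∷ᵉ # 0 ∷ᵉ nilᵉ)))
  (exp (# 0))

potentialProg : Prog
potentialProg = loop (grow (con 1 ⊕ 𝕏 ⊗ (con 1 ⊕ 𝕏))) potentialBody on (nilᵉ ∷ᵉ (# 0 ∷ᵉ # 1) ∷ᵉ # 2 ∷ᵉ # 3 ∷ᵉ nilᵉ)

module _ {N} (D : Metric N) where

  -- Walks are stored in reverse.  After visiting the distinct points of L the walker stands at u, having come there
  -- directly from the last point of L; each step costs its length times the number of points not yet visited.
  potential : Fin N → List (Fin N) → ℕ
  potential u []      = 0
  potential u (v ∷ L) = (N ∸ suc (length L)) * dist D u v + potential v L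

  potential-⇒ : ∀ u L {env} →
    potentialProg ∶ encodeFin u ∙ encodePoints L ∙ encodeMetric D ∙ allPoints N ∙ env ⇒ encodeℕ (potential u L)
  potential-⇒ u L = on-⇒ (⇒-resp (cong encodeℕ (trans (fold≡ u L 0) (+-identityʳ _)))
    (grow-⇒ {encA = encodeFin} {encS = encodeℕ} f (u ∷ L) 0 step growth))
    where
    f : Fin N → List (Fin N) → ℕ → ℕ
    f v []      t = t
    f v (w ∷ L) t = (N ∸ suc (length L)) * dist D v w + t
    length-weight : ∀ w L → length (drop (length (w ∷ L)) (allFin N)) ≡ N ∸ suc (length L)
    length-weight w L = trans (List.length-drop (length (w ∷ L)) (allFin N)) (cong (_∸ suc (length L)) (length-allFin N))
    step : ∀ v r t → potentialBody ∶ encodeℕ t ∙ encodePoints (v ∷ r) ∙ encodeMetric D ∙ allPoints N ∙ nil ⇒ encodeℕ (f v r t)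
    step v []      t = ifP-nil refl exp-⇒
    step v (w ∷ r) t = ifP-cons refl (≫-⇒ (on-⇒ (dist-⇒ D v w)) (≫-⇒ (on-⇒ (drop-⇒ encodeFin encodeFin (w ∷ r) (allFin N)))
      (on-⇒ (⇒-resp (cong (λ k → encodeℕ (k * dist D v w + t)) (length-weight w r))
        (mulAdd-⇒ encodeFin t (dist D v w) (drop (length (w ∷ r)) (allFin N)))))))
    fold≡ : ∀ u L t → foldTails f (u ∷ L) t ≡ potential u L + t
    fold≡ u []      t = refl
    fold≡ u (v ∷ L) t = trans (fold≡ v L _) (lemma (potential v L) ((N ∸ suc (length L)) * dist D u v) t)
      where
      lemma : ∀ p q t → p + (q + t) ≡ q + p + t
      lemma = solve-∀
    X : ℕ
    X = depth (nil ∙ encodePoints (u ∷ L) ∙ encodeMetric D ∙ allPoints N ∙ nil)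
    tail≤X : depth (encodeMetric D ∙ allPoints N ∙ nil) ≤ X
    tail≤X = ≤-trans (depth-right (encodePoints (u ∷ L)) (encodeMetric D ∙ allPoints N ∙ nil))
      (depth-right nil (encodePoints (u ∷ L) ∙ encodeMetric D ∙ allPoints N ∙ nil))
    D≤X : depth (encodeMetric D) ≤ X
    D≤X = ≤-trans (depth-left (encodeMetric D) (allPoints N ∙ nil)) tail≤X
    N≤X : N ≤ X
    N≤X = ≤-trans (≤-reflexive (sym (length-allFin N))) (≤-trans (length≤depth-encL encodeFin (allFin N))
      (≤-trans (depth-left (allPoints N) nil) (≤-trans (depth-right (encodeMetric D) (allPoints N ∙ nil)) tail≤X)))
    growth : ∀ v r t → depth (encodePoints (v ∷ r)) ≤ X → depth (encodeℕ (f v r t)) ≤ (1 + X * (1 + X)) + depth (encodeℕ t)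
    growth v []      t _ = m≤n+m _ _
    growth v (w ∷ r) t _ = ≤-trans (depth-encodeℕ ((N ∸ suc (length r)) * dist D v w + t))
      (s≤s (≤-trans (len-*-+ (N ∸ suc (length r)) (dist D v w) t)
      (+-mono-≤ (*-mono-≤ (≤-trans (m∸n≤m N (suc (length r))) N≤X) (s≤s (≤-trans (len-dist D v w) D≤X))) (len≤depth t))))

visit : ∀ {N} → Fin N → List (Fin N) → List (Fin N)
visit i L = if does (i ∈? L) then L else i ∷ L

-- Gluing with shortcuts: points visited before are skipped, and new ones go in front because walks
-- are stored in reverse.
absorb : ∀ {N} → List (Fin N) → List (Fin N) → List (Fin N)
absorb = foldTails (λ i _ → visit i)

absorbBody : Prog
absorbBody = (memberProg on (hdᵉ (# 1) ∷ᵉ # 0 ∷ᵉ nilᵉ)) ≫ ifP (# 0) (exp (# 1)) (exp (hdᵉ (# 2) ∷ᵉ # 1))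

absorbProg : Prog
absorbProg = loop (grow (con 1 ⊕ 𝕏)) absorbBody on (# 1 ∷ᵉ # 0 ∷ᵉ nilᵉ)

absorb-⇒ : ∀ {N} (T L : List (Fin N)) {env} → absorbProg ∶ encodePoints T ∙ encodePoints L ∙ env ⇒ encodePoints (absorb T L)
absorb-⇒ T L = on-⇒ (grow-⇒ {encA = encodeFin} {encS = encodePoints} (λ i _ → visit i) T L step (λ i r L → growth i r L))
  where
  step : ∀ i r L → absorbBody ∶ encodePoints L ∙ encodePoints (i ∷ r) ∙ nil ⇒ encodePoints (visit i L)
  step i r L = ≫-⇒ (on-⇒ (member-⇒ i L)) (ifP-⇒ {y = λ b → encodePoints (if b then L else i ∷ L)} (does (i ∈? L)) refl
    (λ _ → exp-⇒) (λ _ → exp-⇒))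
  growth : ∀ i r L {X} → depth (encodePoints (i ∷ r)) ≤ X → depth (encodePoints (visit i L)) ≤ 1 + X + depth (encodePoints L)
  growth i r L {X} le with does (i ∈? L)
  ... | true  = m≤n+m _ (1 + X)
  ... | false = depth-∙-≤ {encodeFin i} {encodePoints L} (≤-trans (depth-left (encodeFin i) (encodePoints r)) le) ≤-refl

spine : Tree → List Tree
spine nil     = []
spine (s ∙ t) = s ∷ spine t

encL-spine : ∀ t → encL id (spine t) ≡ t
encL-spine nil     = refl
encL-spine (s ∙ t) = cong (s ∙_) (encL-spine t)

spine-encL : ∀ {A : Set} (enc : A → Tree) as → spine (encL enc as) ≡ map enc as
spine-encL enc []       = refl
spine-encL enc (a ∷ as) = cong (enc a ∷_) (spine-encL enc as)

matchesBody : Prog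
matchesBody = (matchProg on (hdᵉ (# 1) ∷ᵉ # 2 ∷ᵉ nilᵉ)) ≫ ifP (# 0) (exp (hdᵉ (# 2) ∷ᵉ # 1)) (exp (# 1))

decodeBody : Prog
decodeBody = loop (grow (con 1 ⊕ 𝕏)) matchesBody on (# 0 ∷ᵉ # 2 ∷ᵉ hdᵉ (# 1) ∷ᵉ nilᵉ)

decodeProg : Prog
decodeProg = (loop (grow (𝕏 ⊗ (con 1 ⊕ 𝕏))) decodeBody on (nilᵉ ∷ᵉ # 0 ∷ᵉ # 1 ∷ᵉ nilᵉ)) ⨾ (revOnto on (nilᵉ ∷ᵉ allᵉ ∷ᵉ nilᵉ))

module _ {N : ℕ} where

  pushMatch : Tree → Fin N → List (Fin N) → List (Fin N) → List (Fin N)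
  pushMatch t i _ L = if matchℕ (toℕ i) t then i ∷ L else L

  pushMatches : Tree → List (Fin N) → List (Fin N)
  pushMatches t = foldTails (pushMatch t) (allFin N)

  -- Reads any tree as a list of points; entries that are no point are skipped.
  decode : Tree → List (Fin N)
  decode y = foldTails (λ t _ → pushMatches t) (spine y) [] ʳ++ []

  decode-encodePoints : ∀ is → decode (encodePoints is) ≡ is
  decode-encodePoints is = trans (cong (λ ts → foldTails (λ t _ → pushMatches t) ts [] ʳ++ []) (spine-encL encodeFin is))
    (go is [])
    where
    miss : ∀ i js L → i ∉ js → foldTails (pushMatch (encodeFin i)) js L ≡ L
    miss i []       L i∉ = refl
    miss i (j ∷ js) L i∉ with matchℕ (toℕ j) (encodeFin i) in eq
    ... | true  = contradiction (here (Fin.toℕ-injective (sym (matchℕ-sound (toℕ j) (toℕ i) eq)))) i∉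
    ... | false = miss i js L (i∉ ∘ there)
    hit : ∀ i js L → Unique js → i ∈ js → foldTails (pushMatch (encodeFin i)) js L ≡ i ∷ L
    hit i (j ∷ js) L (j∉ ∷ u) i∈ with matchℕ (toℕ j) (encodeFin i) in eq | i∈
    ... | true  | _ with refl ← Fin.toℕ-injective (matchℕ-sound (toℕ j) (toℕ i) eq) =
      miss i js (i ∷ L) (λ i∈js → All.lookup j∉ i∈js refl)
    ... | false | here refl  = contradiction (trans (sym eq) (matchℕ-refl (toℕ i))) λ ()
    ... | false | there i∈js = hit i js L u i∈js
    go : ∀ is L → foldTails (λ t _ → pushMatches t) (map encodeFin is) L ʳ++ [] ≡ L ʳ++ is
    go []       L = refl
    go (i ∷ is) L = trans (cong (λ L′ → foldTails (λ t _ → pushMatches t) (map encodeFin is) L′ ʳ++ [])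
      (hit i (allFin N) L (Unique.allFin⁺ N) (∈-allFin i))) (go is (i ∷ L))

  decode-⇒ : ∀ y {env} → decodeProg ∶ y ∙ allPoints N ∙ env ⇒ encodePoints (decode y)
  decode-⇒ y {env} = ⨾-⇒ (on-⇒ (subst
    (λ t → loop (grow (𝕏 ⊗ (con 1 ⊕ 𝕏))) decodeBody ∶ nil ∙ t ∙ allPoints N ∙ nil ⇒ encodePoints
      (foldTails (λ t _ → pushMatches t) (spine y) [])) (encL-spine y)
      (grow-⇒ {encA = id} {encS = encodePoints} (λ t _ → pushMatches t) (spine y) [] step growth)))
    (on-⇒ (revOnto-⇒ encodeFin (foldTails (λ t _ → pushMatches t) (spine y) []) []))
    where
    growth₁ : ∀ t i L {X} → depth (encodeFin i) ≤ X → ∀ r → depth (encodePoints (pushMatch t i r L)) ≤ (1 + X) + depth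
      (encodePoints L)
    growth₁ t i L {X} le r with matchℕ (toℕ i) t
    ... | true  = depth-∙-≤ {encodeFin i} {encodePoints L} le ≤-refl
    ... | false = m≤n+m _ (1 + X)
    -- A crude bound that allows a push for every point, although a tree matches at most one of
    -- them.
    growth₂ : ∀ t is L {X} → depth (encodePoints is) ≤ X → depth (encodePoints (foldTails (pushMatch t) is L)) ≤
      length is * (1 + X) + depth (encodePoints L)
    growth₂ t []       L le = ≤-refl
    growth₂ t (i ∷ is) L {X} le = ≤-trans (growth₂ t is _ (≤-trans (depth-right (encodeFin i) (encodePoints is)) le))
      (≤-trans (+-monoʳ-≤ (length is * (1 + X)) (growth₁ t i L (≤-trans (depth-left (encodeFin i) (encodePoints is)) le) is))
        (≤-reflexive (lemma (length is * (1 + X)) (1 + X) (depth (encodePoints L)))))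
      where
      lemma : ∀ m x d → m + (x + d) ≡ x + m + d
      lemma = solve-∀
    step₁ : ∀ t i r L → matchesBody ∶ encodePoints L ∙ encodePoints (i ∷ r) ∙ t ∙ nil ⇒ encodePoints (pushMatch t i r L)
    step₁ t i r L = ≫-⇒ (on-⇒ (match-⇒ (toℕ i) t))
      (ifP-⇒ {y = λ b → encodePoints (if b then i ∷ L else L)} (matchℕ (toℕ i) t) refl
      (λ _ → exp-⇒) (λ _ → exp-⇒))
    step : ∀ t r L → decodeBody ∶ encodePoints L ∙ encL id (t ∷ r) ∙ allPoints N ∙ nil ⇒ encodePoints (pushMatches t L)
    step t r L = on-⇒ (grow-⇒ {encA = encodeFin} {encS = encodePoints} (pushMatch t) (allFin N) L (step₁ t)
      (λ i r L′ le → growth₁ t i L′ (≤-trans (depth-left (encodeFin i) (encodePoints r)) le) r))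
    growth : ∀ t r L → depth (encL id (t ∷ r)) ≤ depth (nil ∙ encL id (spine y) ∙ allPoints N ∙ nil) →
      let X = depth (nil ∙ encL id (spine y) ∙ allPoints N ∙ nil) in
      depth (encodePoints (pushMatches t L)) ≤ X * (1 + X) + depth (encodePoints L)
    growth t r L _ = ≤-trans (growth₂ t (allFin N) L pts≤) (+-monoˡ-≤ (depth (encodePoints L)) (*-monoˡ-≤ (1 + X)
      (≤-trans (length≤depth-encL encodeFin (allFin N)) pts≤)))
      where
      X : ℕ
      X = depth (nil ∙ encL id (spine y) ∙ allPoints N ∙ nil)
      pts≤ : depth (allPoints N) ≤ X
      pts≤ = ≤-trans (depth-left (allPoints N) nil) (≤-trans (depth-right (encL id (spine y)) (allPoints N ∙ nil))
        (depth-right nil (encL id (spine y) ∙ allPoints N ∙ nil)))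

depth-encL : ∀ {A : Set} (enc : A → Tree) {B} as → All (λ a → depth (enc a) ≤ B) as → depth (encL enc as) ≤ length as + B
depth-encL enc []       []         = z≤n
depth-encL enc {B} (a ∷ as) (a≤ ∷ as≤) = s≤s (⊔-lub (≤-trans a≤ (m≤n+m B (length as))) (depth-encL enc as as≤))

unique-lookup : ∀ {A : Set} {xs : List A} → Unique xs → ∀ i j → List.lookup xs i ≡ List.lookup xs j → i ≡ j
unique-lookup (_ ∷ _)  Fin.zero    Fin.zero    eq = refl
unique-lookup {xs = x ∷ xs} (x∉ ∷ _) Fin.zero (Fin.suc j) eq = contradiction eq (All.lookup x∉ (∈-lookup j))
unique-lookup {xs = x ∷ xs} (x∉ ∷ _) (Fin.suc i) Fin.zero eq = contradiction (sym eq) (All.lookup x∉ (∈-lookup i))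
unique-lookup (_ ∷ u)  (Fin.suc i) (Fin.suc j) eq = cong Fin.suc (unique-lookup u i j eq)

-- Pigeonhole principle: sending a position in `xs` to the position of the same element in `ys` is
-- injective.
unique-⊆ : ∀ {A : Set} {xs ys : List A} → Unique xs → (∀ {x} → x ∈ xs → x ∈ ys) → length xs ≤ length ys
unique-⊆ {xs = xs} {ys} u xs⊆ys = Fin.injective⇒≤ {f = λ i → Any.index (xs⊆ys (∈-lookup i))} λ {i} {j} eq →
  unique-lookup u i j (trans (lookup-index (xs⊆ys (∈-lookup i)))
    (trans (cong (List.lookup ys) eq) (sym (lookup-index (xs⊆ys (∈-lookup j))))))

unique-length : ∀ {N} {xs : List (Fin N)} → Unique xs → length xs ≤ N
unique-length {N} u = ≤-trans (unique-⊆ u (λ {x} _ → ∈-allFin x)) (≤-reflexive (length-allFin N))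

unique-visit : ∀ {N} i {L : List (Fin N)} → Unique L → Unique (visit i L)
unique-visit i {L} u with i ∈? L
... | yes _  = u
... | no  i∉ = All.tabulate (λ { j∈ refl → i∉ j∈ }) ∷ u

unique-absorb : ∀ {N} T {L : List (Fin N)} → Unique L → Unique (absorb T L)
unique-absorb []      u = u
unique-absorb (i ∷ T) u = unique-absorb T (unique-visit i u)

foldTails-∷ : ∀ {A B : Set} (g : A → B) as bs → foldTails (λ a _ s → g a ∷ s) as bs ≡ map g as ʳ++ bs
foldTails-∷ g []       bs = refl
foldTails-∷ g (a ∷ as) bs = foldTails-∷ g as (g a ∷ bs)

ʳ++-ʳ++ : ∀ {A : Set} (as : List A) → (as ʳ++ []) ʳ++ [] ≡ as
ʳ++-ʳ++ = List.reverse-involutive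

-- The table of the dynamic program

Table : ℕ → Set
Table N = List (List (Fin N))

encodeTable : ∀ {N} → Table N → Tree
encodeTable = encL encodePoints

updateBody : Prog
updateBody = (sameLengthProg on (hdᵉ (# 1) ∷ᵉ # 3 ∷ᵉ nilᵉ)) ≫ ifP (# 0)
  ((potentialProg on (# 6 ∷ᵉ hdᵉ (# 2) ∷ᵉ # 7 ∷ᵉ # 8 ∷ᵉ nilᵉ)) ≫ (ltProg on (# 4 ∷ᵉ # 0 ∷ᵉ nilᵉ)) ≫
    ifP (# 0) (exp (# 6 ∷ᵉ # 3)) (exp (hdᵉ (# 4) ∷ᵉ # 3)))
  (exp (hdᵉ (# 2) ∷ᵉ # 1))

updateProg : Prog
updateProg = (potentialProg on (# 2 ∷ᵉ # 0 ∷ᵉ # 3 ∷ᵉ # 4 ∷ᵉ nilᵉ)) ≫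
  (loop (grow (con 1 ⊕ 𝕏)) updateBody on (nilᵉ ∷ᵉ # 2 ∷ᵉ allᵉ)) ⨾ (revOnto on (nilᵉ ∷ᵉ allᵉ ∷ᵉ nilᵉ))

processBody : Prog
processBody = (absorbProg on (# 2 ∷ᵉ hdᵉ (# 1) ∷ᵉ nilᵉ)) ≫ (updateProg on (# 0 ∷ᵉ # 1 ∷ᵉ tlᵉ (tlᵉ (tlᵉ (tlᵉ allᵉ)))))

processProg : Prog
processProg = loop (con 3 ⊗ 𝕏) processBody on (# 0 ∷ᵉ # 0 ∷ᵉ tlᵉ allᵉ)

module _ {N} (D : Metric N) (r : Fin N) where

  -- A walk competes only with the table entry of its own length, so the lengths in the table never
  -- change.
  better : List (Fin N) → List (Fin N) → List (Fin N)
  better W V = if does (length V ≟ length W) then (if lt (potential D r W) (potential D r V) then W else V) else V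

  update : List (Fin N) → Table N → Table N
  update W = map (better W)

  -- The fold runs over the table as it was before: the tour is appended once to each old walk while
  -- improvements accumulate in the copy.
  process : List (Fin N) → Table N → Table N
  process T tab = foldTails (λ W _ → update (absorb T W)) tab tab

  context : Tree
  context = encodeFin r ∙ encodeMetric D ∙ allPoints N ∙ nil

  update-⇒ : ∀ W tab → updateProg ∶ encodePoints W ∙ encodeTable tab ∙ context ⇒ encodeTable (update W tab)
  update-⇒ W tab = ≫-⇒ (on-⇒ (potential-⇒ D r W)) (⨾-⇒
      (on-⇒ (grow-⇒ {encA = encodePoints} {encS = encodeTable} (λ V _ s → better W V ∷ s) tab [] step growth))
      (on-⇒ (⇒-resp (cong encodeTable result) (revOnto-⇒ encodePoints (foldTails (λ V _ s → better W V ∷ s) tab []) []))))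
    where
    φ env : Tree
    φ = encodeℕ (potential D r W)
    env = φ ∙ encodePoints W ∙ encodeTable tab ∙ context
    result : foldTails (λ V _ s → better W V ∷ s) tab [] ʳ++ [] ≡ update W tab
    result = trans (cong (_ʳ++ []) (foldTails-∷ (better W) tab [])) (ʳ++-ʳ++ (update W tab))
    step : ∀ V r′ s → updateBody ∶ encodeTable s ∙ encodeTable (V ∷ r′) ∙ env ⇒ encodeTable (better W V ∷ s)
    step V r′ s = ≫-⇒ (on-⇒ (sameLength-⇒ encodeFin V W)) (ifP-⇒
      {y = λ b → encodeTable ((if b then (if lt (potential D r W) (potential D r V) then W else V) else V) ∷ s)}
      (does (length V ≟ length W)) refl
      (λ _ → ≫-⇒ (on-⇒ (potential-⇒ D r V)) (≫-⇒ (on-⇒ (lt-⇒ (potential D r W) (potential D r V)))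
        (ifP-⇒ {y = λ b → encodeTable ((if b then W else V) ∷ s)} (lt (potential D r W) (potential D r V)) refl
          (λ _ → exp-⇒) (λ _ → exp-⇒))))
      (λ _ → exp-⇒))
    X : ℕ
    X = depth (nil ∙ encodeTable tab ∙ env)
    W≤X : depth (encodePoints W) ≤ X
    W≤X = ≤-trans (depth-left (encodePoints W) (encodeTable tab ∙ context))
      (≤-trans (depth-right φ (encodePoints W ∙ encodeTable tab ∙ context))
      (≤-trans (depth-right (encodeTable tab) env) (depth-right nil (encodeTable tab ∙ env))))
    better≤ : ∀ V → depth (encodePoints V) ≤ X → depth (encodePoints (better W V)) ≤ X
    better≤ V V≤X with does (length V ≟ length W) | lt (potential D r W) (potential D r V)
    ... | false | _     = V≤X
    ... | true  | true  = W≤X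
    ... | true  | false = V≤X
    growth : ∀ V r′ s → depth (encodeTable (V ∷ r′)) ≤ X → depth (encodeTable (better W V ∷ s)) ≤ (1 + X) + depth
      (encodeTable s)
    growth V r′ s le = depth-∙-≤ {encodePoints (better W V)} {encodeTable s}
      (better≤ V (≤-trans (depth-left (encodePoints V) (encodeTable r′)) le)) ≤-refl

  -- The depth of tables is controlled by this invariant and not by growth per step: walks without
  -- repetitions have at most `N` points, so tables stay shallow through any number of rounds.
  Sound : Table N → Set
  Sound tab = All Unique tab × length tab ≤ N

  sound-update : ∀ {W tab} → Unique W → Sound tab → Sound (update W tab)
  sound-update {W} {tab} u (us , l≤) = All.map⁺ (All.map (λ {V} → better-unique V) us) ,
    ≤-trans (≤-reflexive (List.length-map (better W) tab)) l≤
    where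
    better-unique : ∀ V → Unique V → Unique (better W V)
    better-unique V v with does (length V ≟ length W) | lt (potential D r W) (potential D r V)
    ... | false | _     = v
    ... | true  | true  = u
    ... | true  | false = v

  sound-process : ∀ T {tab} → Sound tab → Sound (process T tab)
  sound-process T {tab} s = go tab (proj₁ s) s
    where
    go : ∀ Ws {tab} → All Unique Ws → Sound tab → Sound (foldTails (λ W _ → update (absorb T W)) Ws tab)
    go []       []       s = s
    go (W ∷ Ws) (u ∷ us) s = go Ws us (sound-update (unique-absorb T u) s)

  -- Of the factor 3, one part accounts for the spine of the table, one for the spine of a walk and
  -- one for the numerals in it.
  depth-sound : ∀ {tab} → Sound tab → depth (encodeTable tab) ≤ 3 * depth (allPoints N)
  depth-sound {tab} (us , l≤) = ≤-trans (depth-encL encodePoints tab (All.map walk≤ us)) (≤-trans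
    (+-mono-≤ (≤-trans l≤ N≤) (+-monoˡ-≤ (depth (allPoints N)) N≤)) (≤-reflexive (lemma (depth (allPoints N)))))
    where
    N≤ : N ≤ depth (allPoints N)
    N≤ = ≤-trans (≤-reflexive (sym (length-allFin N))) (length≤depth-encL encodeFin (allFin N))
    walk≤ : ∀ {W} → Unique W → depth (encodePoints W) ≤ N + depth (allPoints N)
    walk≤ {W} u = ≤-trans (depth-encL encodeFin W (All.tabulate λ {i} _ → depth-∈ encodeFin (∈-allFin i)))
      (+-monoˡ-≤ (depth (allPoints N)) (unique-length u))
    lemma : ∀ p → p + (p + p) ≡ 3 * p
    lemma = solve-∀

  depth-context : depth (allPoints N) ≤ depth context
  depth-context = ≤-trans (depth-left (allPoints N) nil) (≤-trans (depth-right (encodeMetric D) (allPoints N ∙ nil))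
    (depth-right (encodeFin r) (encodeMetric D ∙ allPoints N ∙ nil)))

  process-⇒ : ∀ tab T → Sound tab → processProg ∶ encodeTable tab ∙ encodePoints T ∙ context ⇒ encodeTable (process T tab)
  process-⇒ tab T s = on-⇒ (fold-⇒ {encA = encodePoints} {encS = encodeTable} (λ W _ → update (absorb T W))
    (λ Ws tab′ → All Unique Ws × Sound tab′) tab tab (proj₁ s , s)
    (λ W r′ tab′ _ → ≫-⇒ (on-⇒ (absorb-⇒ T W)) (on-⇒ (update-⇒ (absorb T W) tab′)))
    (λ { W r′ tab′ (u ∷ us , s′) → us , sound-update (unique-absorb T u) s′ })
    (λ _ tab′ inv → ≤-trans (depth-sound (proj₂ inv)) (*-monoʳ-≤ 3 (≤-trans depth-context
      (≤-trans (depth-right (encodePoints T) context) (≤-trans (depth-right (encodeTable tab) (encodePoints T ∙ context))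
        (depth-right (encodeTable tab) (encodeTable tab ∙ encodePoints T ∙ context))))))))

-- Enumeration of the requirements

encodeDown : (ℕ → ℕ) → ℕ → Tree
encodeDown ℓ m = encodeList (map (encodeℕ ∘ ℓ) (downFrom m))

-- Tabulates a sequence in descending order, extending it by q values for each element of a clock.
module Sequence (ℓ : ℕ → ℕ) (ℓ0 : ℓ 0 ≡ 0) (len-ℓ : ∀ m → len (ℓ (suc m)) ≤ suc (len (ℓ m)))
  (stepProg : Prog) (step-⇒ : ∀ m {env} → stepProg ∶ encodeℕ (ℓ m) ∙ env ⇒ encodeℕ (ℓ (suc m))) where

  extendProg : ℕ → Prog
  extendProg zero    = exp (# 0)
  extendProg (suc q) = ((stepProg on (hdᵉ (# 0) ∷ᵉ nilᵉ)) ≫ exp (# 0 ∷ᵉ # 1)) ⨾ (extendProg q on (allᵉ ∷ᵉ nilᵉ))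

  extend-⇒ : ∀ q m {env} → extendProg q ∶ encodeDown ℓ (suc m) ∙ env ⇒ encodeDown ℓ (suc (q + m))
  extend-⇒ zero    m = exp-⇒
  extend-⇒ (suc q) m = ⨾-⇒ (≫-⇒ (on-⇒ (step-⇒ m)) exp-⇒)
    (on-⇒ (⇒-resp (cong (λ k → encodeDown ℓ (suc k)) (+-suc q m)) (extend-⇒ q (suc m))))

  depth-extend : ∀ q m → depth (encodeDown ℓ (suc (q + m))) ≤ q * 3 + depth (encodeDown ℓ (suc m))
  depth-extend zero    m = ≤-refl
  depth-extend (suc q) m = s≤s (⊔-lub
    (≤-trans (depth-encodeℕ (ℓ (suc (q + m)))) (≤-trans (s≤s (len-ℓ (q + m))) (s≤s (s≤s (≤-trans (len≤depth (ℓ (q + m)))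
      (≤-trans (depth-left (encodeℕ (ℓ (q + m))) (encodeDown ℓ (q + m))) (depth-extend q m)))))))
    (≤-trans (depth-extend q m) (m≤n+m _ 2)))

  sequenceProg : ℕ → Prog
  sequenceProg q = loop (grow (con (q * 3))) (extendProg q) on ((nilᵉ ∷ᵉ nilᵉ) ∷ᵉ # 0 ∷ᵉ nilᵉ)

  sequence-⇒ : ∀ {A : Set} (enc : A → Tree) q as {env} → sequenceProg q ∶ encL enc as ∙ env ⇒ encodeDown ℓ (suc (length as * q))
  sequence-⇒ enc q as {env} = on-⇒
    (subst (λ k → loop (grow (con (q * 3))) (extendProg q) ∶ (encodeℕ k ∙ nil) ∙ encL enc as ∙ nil ⇒ encodeDown ℓ
      (suc (length as * q))) ℓ0
    (⇒-resp (cong (λ k → encodeDown ℓ (suc k)) (trans (fold≡ as 0) (+-identityʳ _)))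
      (grow-⇒ {encA = enc} {encS = λ m → encodeDown ℓ (suc m)} (λ _ _ m → q + m) as 0 (λ _ _ m → extend-⇒ q m)
        (λ _ _ m _ → depth-extend q m))))
    where
    fold≡ : ∀ {A : Set} (as : List A) m → foldTails (λ _ _ m → q + m) as m ≡ length as * q + m
    fold≡ []       m = refl
    fold≡ (_ ∷ as) m = trans (fold≡ as (q + m)) (lemma (length as * q) q m)
      where
      lemma : ∀ k q m → k + (q + m) ≡ q + k + m
      lemma = solve-∀

length-ʳ++ : ∀ {A : Set} (xs ys : List A) → length (xs ʳ++ ys) ≡ length xs + length ys
length-ʳ++ []       ys = refl
length-ʳ++ (x ∷ xs) ys = trans (length-ʳ++ xs (x ∷ ys)) (+-suc (length xs) (length ys))

concatOnto : ∀ {A : Set} → List (List A) → List A → List A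
concatOnto = foldTails (λ l _ s → l ʳ++ s)

concatProg : Prog
concatProg = loop (grow (𝕏 ⊗ (con 1 ⊕ 𝕏))) (revOnto on (# 0 ∷ᵉ hdᵉ (# 1) ∷ᵉ nilᵉ))

concat-⇒ : ∀ {A : Set} (enc : A → Tree) lss s {env} →
  concatProg ∶ encL enc s ∙ encL (encL enc) lss ∙ env ⇒ encL enc (concatOnto lss s)
concat-⇒ enc lss s {env} = grow-⇒ {encA = encL enc} {encS = encL enc} (λ l _ s → l ʳ++ s) lss s
  (λ l r s → on-⇒ (revOnto-⇒ enc l s))
  (λ l r s′ le → growth l s′ (≤-trans (depth-left (encL enc l) (encL (encL enc) r)) le))
  where
  pushes : ∀ l s {X} → depth (encL enc l) ≤ X → depth (encL enc (l ʳ++ s)) ≤ length l * (1 + X) + depth (encL enc s)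
  pushes []      s le = ≤-refl
  pushes (a ∷ l) s {X} le = ≤-trans (pushes l (a ∷ s) (≤-trans (depth-right (enc a) (encL enc l)) le))
    (≤-trans (+-monoʳ-≤ (length l * (1 + X))
      (depth-∙-≤ {enc a} {encL enc s} (≤-trans (depth-left (enc a) (encL enc l)) le) ≤-refl))
      (≤-reflexive (lemma (length l * (1 + X)) X (depth (encL enc s)))))
    where
    lemma : ∀ m x d → m + suc (x + d) ≡ 1 + x + m + d
    lemma = solve-∀
  growth : ∀ l s {X} → depth (encL enc l) ≤ X → depth (encL enc (l ʳ++ s)) ≤ X * (1 + X) + depth (encL enc s)
  growth l s {X} le = ≤-trans (pushes l s le)
    (+-monoˡ-≤ (depth (encL enc s)) (*-monoˡ-≤ (1 + X) (≤-trans (length≤depth-encL enc l) le)))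

length≤concatOnto : ∀ {A : Set} (lss : List (List A)) s → length s ≤ length (concatOnto lss s)
length≤concatOnto []        s = ≤-refl
length≤concatOnto (l ∷ lss) s = ≤-trans (m≤n+m (length s) (length l))
  (≤-trans (≤-reflexive (sym (length-ʳ++ l s))) (length≤concatOnto lss (l ʳ++ s)))

∈⇒length≤concatOnto : ∀ {A : Set} {l : List A} {lss} s → l ∈ lss → length l ≤ length (concatOnto lss s)
∈⇒length≤concatOnto {lss = l ∷ lss} s (here refl) = ≤-trans (m≤m+n (length l) (length s))
  (≤-trans (≤-reflexive (sym (length-ʳ++ l s))) (length≤concatOnto lss (l ʳ++ s)))
∈⇒length≤concatOnto {lss = l ∷ lss} s (there l∈) = ∈⇒length≤concatOnto (l ʳ++ s) l∈

∈-ʳ++ : ∀ {A : Set} {x : A} l {s} → x ∈ l ⊎ x ∈ s → x ∈ l ʳ++ s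
∈-ʳ++ []      (inj₂ x∈)         = x∈
∈-ʳ++ (a ∷ l) (inj₁ (here refl)) = ∈-ʳ++ l (inj₂ (here refl))
∈-ʳ++ (a ∷ l) (inj₁ (there x∈)) = ∈-ʳ++ l (inj₁ x∈)
∈-ʳ++ (a ∷ l) (inj₂ x∈)         = ∈-ʳ++ l (inj₂ (there x∈))

∈-concatOnto : ∀ {A : Set} {x : A} lss s → x ∈ s → x ∈ concatOnto lss s
∈-concatOnto []        s x∈ = x∈
∈-concatOnto (l ∷ lss) s x∈ = ∈-concatOnto lss (l ʳ++ s) (∈-ʳ++ l (inj₂ x∈))

∈∈-concatOnto : ∀ {A : Set} {x : A} {l} lss s → x ∈ l → l ∈ lss → x ∈ concatOnto lss s
∈∈-concatOnto (l ∷ lss) s x∈ (here refl) = ∈-concatOnto lss (l ʳ++ s) (∈-ʳ++ l (inj₁ x∈))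
∈∈-concatOnto (l ∷ lss) s x∈ (there l∈)  = ∈∈-concatOnto lss (l ʳ++ s) x∈ l∈

-- The suffixes of a walk stored in reverse are its initial segments. Those of one complete walk
-- supply the initial table, with one walk for every number of visited points and the complete walk
-- first.
suffixes : ∀ {A : Set} → List A → List (List A)
suffixes []       = []
suffixes (a ∷ as) = (a ∷ as) ∷ suffixes as

suffixesProg : Prog
suffixesProg = (loop (grow (con 1 ⊕ 𝕏)) (exp (# 1 ∷ᵉ # 0)) on (nilᵉ ∷ᵉ # 0 ∷ᵉ nilᵉ)) ⨾ (revOnto on (nilᵉ ∷ᵉ allᵉ ∷ᵉ nilᵉ))

suffixes-⇒ : ∀ {A : Set} (enc : A → Tree) as {env} → suffixesProg ∶ encL enc as ∙ env ⇒ encL (encL enc) (suffixes as)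
suffixes-⇒ enc as = ⨾-⇒
  (on-⇒ (grow-⇒ {encA = enc} {encS = encL (encL enc)} (λ a r s → (a ∷ r) ∷ s) as [] (λ _ _ _ → exp-⇒)
    (λ a r s le → depth-∙-≤ {encL enc (a ∷ r)} {encL (encL enc) s} le ≤-refl)))
  (on-⇒ (⇒-resp (cong (encL (encL enc)) (trans (cong (_ʳ++ []) (fold≡ as [])) (ʳ++-ʳ++ (suffixes as))))
    (revOnto-⇒ (encL enc) (foldTails (λ a r s → (a ∷ r) ∷ s) as []) [])))
  where
  fold≡ : ∀ {A : Set} (as : List A) s → foldTails (λ a r s → (a ∷ r) ∷ s) as s ≡ suffixes as ʳ++ s
  fold≡ []       s = refl
  fold≡ (a ∷ as) s = fold≡ as ((a ∷ as) ∷ s)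

-- Nondecreasing vectors over 0, …, n ∸ 1, built from the last entry to the first; the next entry is any i < top.
record Entry (j : ℕ) : Set where
  constructor entry
  field
    top  : ℕ
    vec  : Fin j → ℕ
    mono : ∀ {g h} → g Fin.≤ h → vec g ≤ vec h
    low  : ∀ h → top ≤ suc (vec h)

open Entry public

cons : ∀ {j} (e : Entry j) i → i < top e → Entry (suc j)
cons e i i<top = entry (suc i) (λ { Fin.zero → i ; (Fin.suc h) → vec e h })
  (λ { {Fin.zero} {Fin.zero} _ → ≤-refl ; {Fin.zero} {Fin.suc h} _ → s≤s⁻¹ (≤-trans i<top (low e h))
     ; {Fin.suc g} {Fin.suc h} g≤h → mono e (s≤s⁻¹ g≤h) })
  (λ { Fin.zero → ≤-refl ; (Fin.suc h) → ≤-trans i<top (low e h) })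

-- The decision supplies the proof that `cons` requires. On the list `downFrom (top e)` it always
-- succeeds, and the program does not perform it.
pushCons : ∀ {j} (e : Entry j) i → Dec (i < top e) → List (Entry (suc j)) → List (Entry (suc j))
pushCons e i (yes i<top) s = cons e i i<top ∷ s
pushCons e i (no _)      s = s

expandEntry : ∀ {j} → Entry j → List (Entry (suc j)) → List (Entry (suc j))
expandEntry e = foldTails (λ i _ → pushCons e i (i <? top e)) (downFrom (top e))

expand : ∀ {j} → List (Entry j) → List (Entry (suc j))
expand es = foldTails (λ e _ → expandEntry e) es []

enumerate : ℕ → ∀ j → List (Entry j)
enumerate n zero    = entry n (λ ()) (λ { {()} }) (λ ()) ∷ []
enumerate n (suc j) = expand (enumerate n j)

expandEntry-⊇ : ∀ {j} (e : Entry j) {e′} is s → e′ ∈ s → e′ ∈ foldTails (λ i _ → pushCons e i (i <? top e)) is s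
expandEntry-⊇ e []       s e′∈ = e′∈
expandEntry-⊇ e (i ∷ is) s e′∈ with i <? top e
... | yes i<top = expandEntry-⊇ e is _ (there e′∈)
... | no  _     = expandEntry-⊇ e is s e′∈

∈-expandEntry : ∀ {j} (e : Entry j) i is s → i ∈ is → i < top e →
  ∃[ i<top ] (cons e i i<top ∈ foldTails (λ i _ → pushCons e i (i <? top e)) is s)
∈-expandEntry e i (k ∷ is) s i∈ i<top with k <? top e | i∈
... | yes k<top | here refl = k<top , expandEntry-⊇ e is _ (here refl)
... | no  k≮top | here refl = contradiction i<top k≮top
... | yes k<top | there i∈′ = ∈-expandEntry e i is _ i∈′ i<top
... | no  k≮top | there i∈′ = ∈-expandEntry e i is s i∈′ i<top

∈-downFrom : ∀ {i n} → i < n → i ∈ downFrom n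
∈-downFrom {i} {suc n} i<1+n with i ≟ n
... | yes refl = here refl
... | no  i≢n  = there (∈-downFrom (≤∧≢⇒< (s≤s⁻¹ i<1+n) i≢n))

∈-expand : ∀ {j} (es : List (Entry j)) s {e i} → e ∈ es → i < top e →
  ∃[ i<top ] (cons e i i<top ∈ foldTails (λ e _ → expandEntry e) es s)
∈-expand (e ∷ es) s (here refl) i<top with ∈-expandEntry e _ (downFrom (top e)) s (∈-downFrom i<top) i<top
... | p , c∈ = p , keep es c∈
  where
  keep : ∀ es {s e′} → e′ ∈ s → e′ ∈ foldTails (λ e _ → expandEntry e) es s
  keep []       e′∈ = e′∈
  keep (e ∷ es) e′∈ = keep es (expandEntry-⊇ e (downFrom (top e)) _ e′∈)
∈-expand (e ∷ es) s (there e∈) i<top = ∈-expand es (expandEntry e s) e∈ i<top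

-- The last component strengthens the induction: every value that may still be put in front of the
-- vector is among the choices of the entry found.
∈-enumerate : ∀ n j (v : Fin j → ℕ) → (∀ {g h} → g Fin.≤ h → v g ≤ v h) → (∀ h → v h < n) →
  ∃[ e ] (e ∈ enumerate n j × (∀ h → vec e h ≡ v h) × (∀ i → i < n → (∀ h → i ≤ v h) → i < top e))
∈-enumerate n zero    v v-mono v<n = _ , here refl , (λ ()) , λ i i<n _ → i<n
∈-enumerate n (suc j) v v-mono v<n
  with ∈-enumerate n j (v ∘ Fin.suc) (λ g≤h → v-mono (s≤s g≤h)) (v<n ∘ Fin.suc)
... | e , e∈ , vec≡ , top> with ∈-expand (enumerate n j) [] e∈ (top> (v Fin.zero) (v<n Fin.zero) (λ h → v-mono z≤n))
...   | i<top , c∈ = cons e (v Fin.zero) i<top , c∈ , (λ { Fin.zero → refl ; (Fin.suc h) → vec≡ h }) , λ i _ i≤ → s≤s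
  (i≤ Fin.zero)

-- The rest `# 1` of the descending list, starting at the chosen `i`, is itself the list of choices
-- of the extended entry, because the next value must not exceed `i`.
expandBody : Prog
expandBody = loop (grow (con 3 ⊕ 𝕏)) (exp ((# 1 ∷ᵉ hdᵉ (# 1) ∷ᵉ # 2) ∷ᵉ # 0)) on
  (# 0 ∷ᵉ hdᵉ (hdᵉ (# 1)) ∷ᵉ tlᵉ (hdᵉ (# 1)) ∷ᵉ nilᵉ)

expandProg : Prog
expandProg = loop (grow (𝕏 ⊗ (con 3 ⊕ 𝕏))) expandBody on (nilᵉ ∷ᵉ # 0 ∷ᵉ nilᵉ)

enumerateProg : ℕ → Prog
enumerateProg zero    = exp ((# 0 ∷ᵉ nilᵉ) ∷ᵉ nilᵉ)
enumerateProg (suc j) = enumerateProg j ⨾ (expandProg on (allᵉ ∷ᵉ nilᵉ))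

module _ (ℓ : ℕ → ℕ) where

  encodeVec : ∀ {j} → (Fin j → ℕ) → Tree
  encodeVec v = encodeList (tabulate (λ h → encodeℕ (ℓ (v h))))

  encodeEntry : ∀ {j} → Entry j → Tree
  encodeEntry e = encodeDown ℓ (top e) ∙ encodeVec (vec e)

  IsDown : ∀ {j} → Entry j → List ℕ → Set
  IsDown e r = ∃[ k ] (r ≡ downFrom k × k ≤ top e)

  pushCons-growth : ∀ {j} (e : Entry j) i s {X} → depth (encodeEntry e) ≤ X →
    depth (encL encodeEntry (pushCons e i (i <? top e) s)) ≤ (3 + X) + depth (encL encodeEntry s)
  pushCons-growth e i s {X} e≤ with i <? top e
  ... | no  _     = m≤n+m _ (3 + X)
  ... | yes i<top = depth-∙-≤ {encodeEntry (cons e i i<top)} {encL encodeEntry s}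
      (s≤s (⊔-lub (≤-trans down≤ (n≤1+n X)) (s≤s (⊔-lub
        (≤-trans (depth-left (encodeℕ (ℓ i)) (encodeDown ℓ i)) down≤)
        (≤-trans (depth-right (encodeDown ℓ (top e)) (encodeVec (vec e))) e≤))))) ≤-refl
    where
    down-mono : ∀ {k m} → k ≤′ m → depth (encodeDown ℓ k) ≤ depth (encodeDown ℓ m)
    down-mono ≤′-refl         = ≤-refl
    down-mono (≤′-step {m} h) = ≤-trans (down-mono h) (depth-right (encodeℕ (ℓ m)) (encodeDown ℓ m))
    down≤ : depth (encodeDown ℓ (suc i)) ≤ X
    down≤ = ≤-trans (down-mono (≤⇒≤′ i<top)) (≤-trans (depth-left (encodeDown ℓ (top e)) (encodeVec (vec e))) e≤)

  expandEntry-growth : ∀ {j} (e : Entry j) is s {X} → depth (encodeEntry e) ≤ X →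
    depth (encL encodeEntry (foldTails (λ i _ → pushCons e i (i <? top e)) is s)) ≤ length is * (3 + X) + depth
      (encL encodeEntry s)
  expandEntry-growth e []       s e≤ = ≤-refl
  expandEntry-growth e (i ∷ is) s {X} e≤ = ≤-trans (expandEntry-growth e is _ e≤)
    (≤-trans (+-monoʳ-≤ (length is * (3 + X)) (pushCons-growth e i s e≤))
      (≤-reflexive (lemma (length is * (3 + X)) (3 + X) (depth (encL encodeEntry s)))))
    where
    lemma : ∀ m x d → m + (x + d) ≡ x + m + d
    lemma = solve-∀

  expandBody-⇒ : ∀ {j} (e : Entry j) r s {env} →
    expandBody ∶ encL encodeEntry s ∙ encL encodeEntry (e ∷ r) ∙ env ⇒ encL encodeEntry (expandEntry e s)
  expandBody-⇒ e r s = on-⇒ (growᴵ-⇒ {encA = encodeℕ ∘ ℓ} {encS = encL encodeEntry} (λ i _ → pushCons e i (i <? top e))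
    (λ r _ → IsDown e r)
    (downFrom (top e)) s (top e , refl , ≤-refl) step (λ i r s → pres i r)
    (λ i r s′ _ _ → pushCons-growth e i s′ (≤-trans
      (s≤s (⊔-monoʳ-≤ (depth (encodeDown ℓ (top e))) (depth-left (encodeVec (vec e)) nil))) (input≤ s))))
    where
    input≤ : ∀ s → depth (encodeDown ℓ (top e) ∙ encodeVec (vec e) ∙ nil) ≤ depth
      (encL encodeEntry s ∙ encodeDown ℓ (top e) ∙ encodeVec (vec e) ∙ nil)
    input≤ s = depth-right (encL encodeEntry s) (encodeDown ℓ (top e) ∙ encodeVec (vec e) ∙ nil)
    step : ∀ i r s → IsDown e (i ∷ r) → exp ((# 1 ∷ᵉ hdᵉ (# 1) ∷ᵉ # 2) ∷ᵉ # 0) ∶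
      encL encodeEntry s ∙ encL (encodeℕ ∘ ℓ) (i ∷ r) ∙ encodeVec (vec e) ∙ nil ⇒ encL encodeEntry (pushCons e i (i <? top e) s)
    step i r s (suc k , refl , k≤) with i <? top e
    ... | yes i<top = exp-⇒
    ... | no  i≮top = contradiction k≤ i≮top
    pres : ∀ i r → IsDown e (i ∷ r) → IsDown e r
    pres i r (suc k , refl , k≤) = k , refl , ≤-trans (n≤1+n k) k≤

  expand-⇒ : ∀ {j} (es : List (Entry j)) {env} → expandProg ∶ encL encodeEntry es ∙ env ⇒ encL encodeEntry (expand es)
  expand-⇒ es = on-⇒ (grow-⇒ {encA = encodeEntry} {encS = encL encodeEntry} (λ e _ → expandEntry e) es []
    (λ e r s → expandBody-⇒ e r s)
    (λ e r s le → growth e s (≤-trans (depth-left (encodeEntry e) (encL encodeEntry r)) le)))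
    where
    length-downFrom≤ : ∀ m → length (downFrom m) ≤ depth (encodeDown ℓ m)
    length-downFrom≤ m = length≤depth-encL (encodeℕ ∘ ℓ) (downFrom m)
    growth : ∀ {j} (e : Entry j) s {X} → depth (encodeEntry e) ≤ X →
      depth (encL encodeEntry (expandEntry e s)) ≤ X * (3 + X) + depth (encL encodeEntry s)
    growth e s {X} e≤ = ≤-trans (expandEntry-growth e (downFrom (top e)) s e≤) (+-monoˡ-≤ _ (*-monoˡ-≤ (3 + X)
      (≤-trans (length-downFrom≤ (top e)) (≤-trans (depth-left (encodeDown ℓ (top e)) (encodeVec (vec e))) e≤))))

  enumerate-⇒ : ∀ n j {env} → enumerateProg j ∶ encodeDown ℓ n ∙ env ⇒ encL encodeEntry (enumerate n j)
  enumerate-⇒ n zero    = exp-⇒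
  enumerate-⇒ n (suc j) = ⨾-⇒ (enumerate-⇒ n j) (on-⇒ (expand-⇒ (enumerate n j)))

-- The algorithm

infixl 8 _↑_

_↑_ : Poly → ℕ → Poly
P ↑ zero  = con 1
P ↑ suc e = P ⊗ P ↑ e

↑-eval : ∀ P e n → (P ↑ e) ⟨ n ⟩ ≡ P ⟨ n ⟩ ^ e
↑-eval P zero    n = refl
↑-eval P (suc e) n = cong (P ⟨ n ⟩ *_) (↑-eval P e n)

numeralSize : Poly
numeralSize = con 1 ⊕ con 4 ⊗ 𝕏

listSize : Poly → Poly
listSize P = con 1 ⊕ 𝕏 ⊗ (con 1 ⊕ P)

size-encodeℕ : ∀ n → size (encodeℕ n) ≤ numeralSize ⟨ depth (encodeℕ n) ⟩
size-encodeℕ n = ≤-trans (subst (λ t → size t ≤ 1 + 4 * len n) (sym (encodeℕ-bits n)) (go (bits n)))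
  (s≤s (*-monoʳ-≤ 4 (len≤depth n)))
  where
  lemma : ∀ l → 4 + (1 + 4 * l) ≡ 1 + 4 * suc l
  lemma = solve-∀
  go : ∀ b → size (encodeBits b) ≤ 1 + 4 * length b
  go []          = ≤-refl
  go (false ∷ b) = ≤-trans (s≤s (s≤s (go b))) (≤-trans (m≤n+m _ 2) (≤-reflexive (lemma (length b))))
  go (true ∷ b)  = ≤-trans (s≤s (s≤s (s≤s (s≤s (go b))))) (≤-reflexive (lemma (length b)))

size-encL : ∀ {A : Set} (enc : A → Tree) P → (∀ a → size (enc a) ≤ P ⟨ depth (enc a) ⟩) → ∀ as →
  size (encL enc as) ≤ listSize P ⟨ depth (encL enc as) ⟩
size-encL enc P size≤ as = ≤-trans (go as ≤-refl) (s≤s (*-monoˡ-≤ _ (length≤depth-encL enc as)))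
  where
  go : ∀ bs {X} → depth (encL enc bs) ≤ X → size (encL enc bs) ≤ 1 + length bs * (1 + P ⟨ X ⟩)
  go []       le = ≤-refl
  go (b ∷ bs) {X} le = s≤s (≤-trans (+-mono-≤ (≤-trans (size≤ b) (poly-mono P (≤-trans (depth-left (enc b) (encL enc bs)) le)))
    (go bs (≤-trans (depth-right (enc b) (encL enc bs)) le))) (≤-reflexive (+-suc (P ⟨ X ⟩) _)))

size-tabulate : ∀ {N} (g : Fin N → Tree) P → (∀ i → size (g i) ≤ P ⟨ depth (g i) ⟩) →
  size (encodeList (tabulate g)) ≤ listSize P ⟨ depth (encodeList (tabulate g)) ⟩
size-tabulate {N} g P size≤ = subst (λ ts → size (encodeList ts) ≤ listSize P ⟨ depth (encodeList ts) ⟩)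
  (List.map-tabulate id g) (size-encL g P size≤ (allFin N))

-- The time of the oracle is bounded in the size of its input, while costs here refer to depth.
-- Arbitrary trees may have size exponential in their depth, but encoded instances are nested lists
-- of numerals, whose size is polynomial in it.
segSize : Poly
segSize = con 3 ⊕ (numeralSize ⊕ (listSize (listSize numeralSize) ⊕ (listSize numeralSize ⊕ listSize numeralSize)))

size-encodeSegTSP : ∀ {k} (I : SegTSP k) → size (encodeSegTSP I) ≤ segSize ⟨ depth (encodeSegTSP I) ⟩
size-encodeSegTSP I = ≤-trans (≤-reflexive (lemma (size o) (size m) (size l) (size u))) (s≤s (s≤s (s≤s
  (+-mono-≤ (≤-trans (size-encodeℕ (toℕ origin)) (poly-mono numeralSize (depth-left o (m ∙ l ∙ u))))
  (+-mono-≤ (≤-trans (size-tabulate row (listSize numeralSize)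
    (λ i → size-tabulate (λ j → encodeℕ (dist metric i j)) numeralSize (λ j → size-encodeℕ (dist metric i j))))
              (poly-mono (listSize (listSize numeralSize)) (≤-trans (depth-left m (l ∙ u)) (depth-right o (m ∙ l ∙ u)))))
  (+-mono-≤ (≤-trans (size-tabulate (λ h → encodeℕ (SegTSP.len I h)) numeralSize (λ h → size-encodeℕ (SegTSP.len I h)))
              (poly-mono (listSize numeralSize)
                (≤-trans (depth-left l u) (≤-trans (depth-right m (l ∙ u)) (depth-right o (m ∙ l ∙ u))))))
            (≤-trans (size-tabulate (λ h → encodeℕ (num h)) numeralSize (λ h → size-encodeℕ (num h)))
              (poly-mono (listSize numeralSize)
                (≤-trans (depth-right l u) (≤-trans (depth-right m (l ∙ u)) (depth-right o (m ∙ l ∙ u))))))))))))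
  where
  open SegTSP I using (n; metric; origin; num)
  row : Fin (suc n) → Tree
  row i = encodeList (tabulate λ j → encodeℕ (dist metric i j))
  o m l u : Tree
  o = encodeFin origin
  m = encodeMetric metric
  l = encodeList (tabulate λ h → encodeℕ (SegTSP.len I h))
  u = encodeList (tabulate λ h → encodeℕ (num h))
  lemma : ∀ o m l u → suc (o + suc (m + suc (l + u))) ≡ 3 + (o + (m + (l + u)))
  lemma = solve-∀

tabulate-toℕ : ∀ N (f : ℕ → ℕ) → tabulate {n = N} (f ∘ toℕ) ≡ List.applyUpTo f N
tabulate-toℕ zero    f = refl
tabulate-toℕ (suc N) f = cong (f 0 ∷_) (tabulate-toℕ N (f ∘ suc))

encode-upTo : ∀ N → encL encodeℕ (downFrom N ʳ++ []) ≡ allPoints N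
encode-upTo N = trans (cong (encL encodeℕ) (trans (List.reverse-downFrom N)
  (trans (sym (tabulate-toℕ N id)) (sym (List.map-tabulate id toℕ))))) (cong encodeList (sym (List.map-∘ (allFin N))))

encodeMetric-encL : ∀ {N} (D : Metric N) → encodeMetric D ≡ encL (encL encodeℕ) (tabulate λ i → tabulate (dist D i))
encodeMetric-encL D = cong encodeList (trans
  (List.tabulate-cong (λ i → cong encodeList (sym (List.map-tabulate (dist D i) encodeℕ))))
  (sym (List.map-tabulate (λ i → tabulate (dist D i)) (encL encodeℕ))))

first : ∀ {N} → Table N → List (Fin N)
first []        = []
first (W ∷ tab) = W

distances : ∀ {N} → Metric N → List ℕ
distances D = concatOnto (tabulate λ i → tabulate (dist D i)) []

-- A unary clock of polynomial length: it has at least as many elements as there are points and as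
-- any distance has digits, so its length controls the logarithm of every path length that matters.
clock : ∀ {N} → Metric N → List Tree
clock D = concatOnto (map (spine ∘ encodeℕ) (distances D)) (spine (encodeMetric D))

threshold-mono : ∀ a {g h} → g ≤ h → threshold a g ≤ threshold a h
threshold-mono a g≤h = go (≤⇒≤′ g≤h)
  where
  go : ∀ {g h} → g ≤′ h → threshold a g ≤ threshold a h
  go ≤′-refl         = ≤-refl
  go (≤′-step {h} l) = ≤-trans (go l) (≤-trans (m≤n+m (threshold a h) _) (n≤1+n _))

segmented : ∀ (a : ℕ) (I : TRP) {k} → Entry (suc k) → Entry (suc k) → SegTSP k
segmented a I le ne = record
  { n = TRP.n I ; metric = TRP.metric I ; origin = TRP.origin I
  ; len = threshold a ∘ vec le ; num = vec ne
  ; len-mono = threshold-mono a ∘ mono le ; num-mono = mono ne }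

module Algorithm {ℓ} (M : MetricClass ℓ) (α : ℝ) (k : ℕ) (solver : PolyTimeSegTSPApprox M k α) (a q : ℕ) where

  private
    module Thresholds = Sequence (threshold a) refl (len-next a ∘ threshold a) (nextProg a) (next-⇒ a ∘ threshold a)
    module Counts = Sequence id refl (λ m → len-double {suc m} {m} (s≤s (m≤m+n m _))) sucProg suc-⇒

  oracle : Prog
  oracle = raw (proj₁ solver) (con (proj₁ (proj₂ solver)) ⊗ segSize ↑ proj₁ (proj₂ (proj₂ solver)))

  answer : ∀ I → M (SegTSP.metric I) → Tree
  answer I mI = proj₁ (proj₂ (proj₂ (proj₂ solver)) I mI)

  answer-approx : ∀ I mI → IsSegTSPApprox I α (answer I mI)
  answer-approx I mI = proj₂ (proj₂ (proj₂ (proj₂ (proj₂ (proj₂ (proj₂ solver)) I mI))))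

  oracle-⇒ : ∀ I mI → oracle ∶ encodeSegTSP I ⇒ answer I mI
  oracle-⇒ I mI = finish (proj₂ (proj₂ (proj₂ (proj₂ solver)) I mI))
    where
    c e : ℕ
    c = proj₁ (proj₂ solver)
    e = proj₁ (proj₂ (proj₂ solver))
    finish : ∃[ t ] (⟦ proj₁ solver ⟧ encodeSegTSP I ⇓ answer I mI within t × t ≤ c * size (encodeSegTSP I) ^ e ×
      IsSegTSPApprox I α (answer I mI)) → oracle ∶ encodeSegTSP I ⇒ answer I mI
    finish (t , run , t≤ , _) = runs run (≤-trans t≤ (*-monoʳ-≤ c
      (≤-trans (^-monoˡ-≤ e (size-encodeSegTSP I)) (≤-reflexive (sym (↑-eval segSize e (depth (encodeSegTSP I))))))))

  body₃ body₂ body₁ mainProg : Prog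
  -- The variables are the table, the rest of the count entries, the current length entry, the
  -- origin, the metric and the points; the tail of an encoded entry is its vector.
  body₃ = (oracle on (# 3 ∷ᵉ # 4 ∷ᵉ tlᵉ (# 2) ∷ᵉ tlᵉ (hdᵉ (# 1)))) ≫ (decodeProg on (# 0 ∷ᵉ # 6 ∷ᵉ nilᵉ)) ≫
    (processProg on (# 2 ∷ᵉ # 0 ∷ᵉ tlᵉ (tlᵉ (tlᵉ (tlᵉ (tlᵉ allᵉ))))))
  body₂ = loop (con 3 ⊗ 𝕏) body₃ on (# 0 ∷ᵉ # 3 ∷ᵉ hdᵉ (# 1) ∷ᵉ tlᵉ (tlᵉ (tlᵉ (tlᵉ allᵉ))))
  body₁ = loop (con 3 ⊗ 𝕏) body₂ on (# 0 ∷ᵉ # 2 ∷ᵉ tlᵉ (tlᵉ allᵉ))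
  mainProg = exp (hdᵉ allᵉ ∷ᵉ tlᵉ allᵉ ∷ᵉ nilᵉ) ⨾ (
    (Counts.sequenceProg 1 on (# 1 ∷ᵉ nilᵉ)) ≫
    (revOnto on (nilᵉ ∷ᵉ tlᵉ (# 0) ∷ᵉ nilᵉ)) ≫
    (enumerateProg (suc k) on (# 1 ∷ᵉ nilᵉ)) ≫
    (concatProg on (nilᵉ ∷ᵉ # 4 ∷ᵉ nilᵉ)) ≫
    (concatProg on (# 5 ∷ᵉ # 0 ∷ᵉ nilᵉ)) ≫
    (Thresholds.sequenceProg q on (# 0 ∷ᵉ nilᵉ)) ≫
    (enumerateProg (suc k) on (# 0 ∷ᵉ nilᵉ)) ≫
    (absorbProg on (# 5 ∷ᵉ (# 7 ∷ᵉ nilᵉ) ∷ᵉ nilᵉ)) ≫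
    (suffixesProg on (# 0 ∷ᵉ nilᵉ)) ≫
    -- The list of thresholds `# 3` acts as a counter here: all candidates are tried once per
    -- threshold, which gives at least one round per window.
    (loop (con 3 ⊗ 𝕏) body₁ on (# 0 ∷ᵉ # 3 ∷ᵉ # 2 ∷ᵉ # 6 ∷ᵉ # 9 ∷ᵉ # 10 ∷ᵉ # 7 ∷ᵉ nilᵉ)) ⨾
    (revOnto on (nilᵉ ∷ᵉ hdᵉ allᵉ ∷ᵉ nilᵉ)))

  module Run (I : TRP) (mI : M (TRP.metric I)) where

    open TRP I renaming (metric to D; origin to r)

    N horizon : ℕ
    N = suc n
    horizon = suc (length (clock D) * q)

    lengthEntries countEntries : List (Entry (suc k))
    lengthEntries = enumerate horizon (suc k)
    countEntries  = enumerate (suc N) (suc k)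

    candidate : Entry (suc k) → Entry (suc k) → List (Fin N)
    candidate le ne = decode (answer (segmented a I le ne) mI)

    round₂ : Entry (suc k) → Table N → Table N
    round₂ le = foldTails (λ ne _ → process D r (candidate le ne)) countEntries

    round₁ : Table N → Table N
    round₁ = foldTails (λ le _ → round₂ le) lengthEntries

    table₀ table : Table N
    table₀ = suffixes (absorb (allFin N) (r ∷ []))
    table  = foldTails (λ _ _ → round₁) (downFrom horizon) table₀

    ctx : Tree
    ctx = context D r

    sound-foldTails : ∀ {A : Set} (f : A → Table N → Table N) → (∀ a {tab} → Sound D r tab → Sound D r (f a tab)) →
      ∀ as {tab} → Sound D r tab → Sound D r (foldTails (λ a _ → f a) as tab)
    sound-foldTails f pres []       s = s
    sound-foldTails f pres (a ∷ as) s = sound-foldTails f pres as (pres a s)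

    sound-round₂ : ∀ le {tab} → Sound D r tab → Sound D r (round₂ le tab)
    sound-round₂ le = sound-foldTails _ (λ ne → sound-process D r (candidate le ne)) countEntries

    sound-round₁ : ∀ {tab} → Sound D r tab → Sound D r (round₁ tab)
    sound-round₁ = sound-foldTails _ sound-round₂ lengthEntries

    sound-table₀ : Sound D r table₀
    sound-table₀ = go (absorb (allFin N) (r ∷ [])) unique , ≤-trans
      (≤-reflexive (length-suffixes (absorb (allFin N) (r ∷ [])))) (unique-length unique)
      where
      unique : Unique (absorb (allFin N) (r ∷ []))
      unique = unique-absorb (allFin N) ([] ∷ [])
      length-suffixes : ∀ {A : Set} (as : List A) → length (suffixes as) ≡ length as
      length-suffixes []       = refl
      length-suffixes (a ∷ as) = cong suc (length-suffixes as)
      go : ∀ L → Unique L → All Unique (suffixes L)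
      go []      []       = []
      go (i ∷ L) (i∉ ∷ u) = (i∉ ∷ u) ∷ go L u

    Points≤ : Tree → Set
    Points≤ env = depth (allPoints N) ≤ depth env

    table-loop : ∀ {A : Set} (enc : A → Tree) (f : A → Table N → Table N) {B env} → Points≤ env →
      (∀ a {tab} → Sound D r tab → Sound D r (f a tab)) →
      (∀ a as tab → Sound D r tab → B ∶ encodeTable tab ∙ encL enc (a ∷ as) ∙ env ⇒ encodeTable (f a tab)) →
      ∀ as tab → Sound D r tab → loop (con 3 ⊗ 𝕏) B ∶ encodeTable tab ∙ encL enc as ∙ env ⇒ encodeTable
        (foldTails (λ a _ → f a) as tab)
    table-loop enc f {B} {env} p≤ pres step as tab s = fold-⇒ {encA = enc} {encS = encodeTable} (λ a _ → f a)
      (λ _ → Sound D r) as tab s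
      step (λ a _ _ → pres a)
      (λ _ tab′ s′ → ≤-trans (depth-sound D r s′) (*-monoʳ-≤ 3 (≤-trans p≤ (≤-trans (depth-right (encL enc as) env)
        (depth-right (encodeTable tab) (encL enc as ∙ env))))))

    lv nv : Tree
    lv = encL (encodeEntry (threshold a)) lengthEntries
    nv = encL (encodeEntry id) countEntries

    body₃-⇒ : ∀ le ne r′ tab → Sound D r tab →
      body₃ ∶ encodeTable tab ∙ encL (encodeEntry id) (ne ∷ r′) ∙ encodeEntry (threshold a) le ∙ ctx ⇒ encodeTable
        (process D r (candidate le ne) tab)
    body₃-⇒ le ne r′ tab s = ≫-⇒ (on-⇒ (oracle-⇒ (segmented a I le ne) mI))
      (≫-⇒ (on-⇒ (decode-⇒ (answer (segmented a I le ne) mI)))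
      (on-⇒ (process-⇒ D r tab (candidate le ne) s)))

    body₂-⇒ : ∀ le r′ tab → Sound D r tab →
      body₂ ∶ encodeTable tab ∙ encL (encodeEntry (threshold a)) (le ∷ r′) ∙ lv ∙ nv ∙ ctx ⇒ encodeTable (round₂ le tab)
    body₂-⇒ le r′ tab s = on-⇒ (table-loop (encodeEntry id) (λ ne → process D r (candidate le ne))
      (≤-trans (depth-context D r) (depth-right (encodeEntry (threshold a) le) ctx))
      (λ ne → sound-process D r (candidate le ne)) (body₃-⇒ le) countEntries tab s)

    body₁-⇒ : ∀ (m : ℕ) r′ tab → Sound D r tab →
      body₁ ∶ encodeTable tab ∙ encL (encodeℕ ∘ threshold a) (m ∷ r′) ∙ lv ∙ nv ∙ ctx ⇒ encodeTable (round₁ tab)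
    body₁-⇒ m r′ tab s = on-⇒ (table-loop (encodeEntry (threshold a)) round₂ env≤ sound-round₂ body₂-⇒ lengthEntries tab s)
      where
      env≤ : Points≤ (lv ∙ nv ∙ ctx)
      env≤ = ≤-trans (depth-context D r) (≤-trans (depth-right nv ctx) (depth-right lv (nv ∙ ctx)))

    first-hd : ∀ (tab : Table N) → encodePoints (first tab) ≡ hd (encodeTable tab)
    first-hd []        = refl
    first-hd (W ∷ tab) = refl

    main-⇒ : mainProg ∶ encodeTRP I ⇒ encodePoints (reverse (first table))
    main-⇒ = ⨾-⇒ exp-⇒
      (≫-⇒ (on-⇒ counts)
      (≫-⇒ (on-⇒ (⇒-resp (encode-upTo N) (revOnto-⇒ encodeℕ (downFrom N) [])))
      (≫-⇒ (on-⇒ (enumerate-⇒ id (suc N) (suc k)))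
      (≫-⇒ (on-⇒ (subst (λ t → concatProg ∶ nil ∙ t ∙ nil ⇒ encL encodeℕ (distances D)) (sym (encodeMetric-encL D))
        (concat-⇒ encodeℕ (tabulate λ i → tabulate (dist D i)) [])))
      (≫-⇒ (on-⇒ digits)
      (≫-⇒ (on-⇒ (Thresholds.sequence-⇒ id q (clock D)))
      (≫-⇒ (on-⇒ (enumerate-⇒ (threshold a) horizon (suc k)))
      (≫-⇒ (on-⇒ (absorb-⇒ (allFin N) (r ∷ [])))
      (≫-⇒ (on-⇒ (suffixes-⇒ encodeFin (absorb (allFin N) (r ∷ []))))
      (⨾-⇒ (on-⇒ (table-loop (encodeℕ ∘ threshold a) (λ _ → round₁) env≤ (λ _ → sound-round₁) body₁-⇒
        (downFrom horizon) table₀ sound-table₀))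
      (on-⇒ (subst (λ t → revOnto ∶ nil ∙ t ∙ nil ⇒ encodePoints (reverse (first table))) (first-hd table)
        (revOnto-⇒ encodeFin (first table) [])))))))))))))
      where
      env≤ : Points≤ (lv ∙ nv ∙ ctx)
      env≤ = ≤-trans (depth-context D r) (≤-trans (depth-right nv ctx) (depth-right lv (nv ∙ ctx)))
      rows : List (List ℕ)
      rows = tabulate λ i → tabulate (dist D i)
      counts : Counts.sequenceProg 1 ∶ encodeMetric D ∙ nil ⇒ encodeDown id (suc N)
      counts = subst₂ (λ t m → Counts.sequenceProg 1 ∶ t ∙ nil ⇒ encodeDown id (suc m)) (sym (encodeMetric-encL D))
        (trans (*-identityʳ (length rows)) (List.length-tabulate (λ i → tabulate (dist D i))))
        (Counts.sequence-⇒ (encL encodeℕ) 1 rows)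
      encode-spines : ∀ ds → encL (encL id) (map (spine ∘ encodeℕ) ds) ≡ encL encodeℕ ds
      encode-spines []       = refl
      encode-spines (d ∷ ds) = cong₂ _∙_ (encL-spine (encodeℕ d)) (encode-spines ds)
      digits : concatProg ∶ encodeMetric D ∙ encL encodeℕ (distances D) ∙ nil ⇒ encL id (clock D)
      digits = subst₂ (λ s t → concatProg ∶ s ∙ t ∙ nil ⇒ encL id (clock D)) (encL-spine (encodeMetric D))
        (encode-spines (distances D))
        (concat-⇒ id (map (spine ∘ encodeℕ) (distances D)) (spine (encodeMetric D)))

-- Analysis of the dynamic program

when : ∀ {P : Set} → Dec P → ℕ → ℕ
when (yes _) x = x
when (no _)  x = 0

when-yes : ∀ {P : Set} (d : Dec P) {x} → P → when d x ≡ x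
when-yes (yes _) p = refl
when-yes (no ¬p) p = contradiction p ¬p

sumTo : ℕ → (ℕ → ℕ) → ℕ
sumTo zero    f = 0
sumTo (suc n) f = sumTo n f + f n

sumTo-mono : ∀ n {f g : ℕ → ℕ} → (∀ c → c < n → f c ≤ g c) → sumTo n f ≤ sumTo n g
sumTo-mono zero    f≤g = z≤n
sumTo-mono (suc n) f≤g = +-mono-≤ (sumTo-mono n (λ c c<n → f≤g c (m≤n⇒m≤1+n c<n))) (f≤g n ≤-refl)

sumTo-cong : ∀ n {f g : ℕ → ℕ} → (∀ c → c < n → f c ≡ g c) → sumTo n f ≡ sumTo n g
sumTo-cong zero    f≡g = refl
sumTo-cong (suc n) f≡g = cong₂ _+_ (sumTo-cong n (λ c c<n → f≡g c (m≤n⇒m≤1+n c<n))) (f≡g n ≤-refl)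

sumTo-+ : ∀ n (f g : ℕ → ℕ) → sumTo n (λ c → f c + g c) ≡ sumTo n f + sumTo n g
sumTo-+ zero    f g = refl
sumTo-+ (suc n) f g = trans (cong (_+ (f n + g n)) (sumTo-+ n f g)) (lemma (sumTo n f) (sumTo n g) (f n) (g n))
  where
  lemma : ∀ a b c d → a + b + (c + d) ≡ a + c + (b + d)
  lemma = solve-∀

sumTo-* : ∀ n k (f : ℕ → ℕ) → sumTo n (λ c → k * f c) ≡ k * sumTo n f
sumTo-* zero    k f = sym (*-zeroʳ k)
sumTo-* (suc n) k f = trans (cong (_+ k * f n) (sumTo-* n k f)) (sym (*-distribˡ-+ k (sumTo n f) (f n)))

sumTo-zero : ∀ n → sumTo n (λ _ → 0) ≡ 0
sumTo-zero zero    = refl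
sumTo-zero (suc n) = trans (+-identityʳ _) (sumTo-zero n)

sumTo-swap : ∀ m n (f : ℕ → ℕ → ℕ) → sumTo m (λ i → sumTo n (f i)) ≡ sumTo n (λ j → sumTo m (λ i → f i j))
sumTo-swap zero    n f = sym (sumTo-zero n)
sumTo-swap (suc m) n f = trans (cong (_+ sumTo n (f m)) (sumTo-swap m n f))
  (sym (sumTo-+ n (λ j → sumTo m (λ i → f i j)) (f m)))

-- Turns the weight N ∸ l of a step into one copy of the step for each point l, …, N ∸ 1.
weight≤sumTo : ∀ N l d {g : ℕ → ℕ} → (∀ c → c < N → l ≤ c → d ≤ g c) → (N ∸ l) * d ≤ sumTo N g
weight≤sumTo zero    l d le rewrite 0∸n≡0 l = z≤n
weight≤sumTo (suc N) l d {g} le with l ≤? N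
... | no  l≰N rewrite m≤n⇒m∸n≡0 (≰⇒> l≰N) = z≤n
... | yes l≤N rewrite +-∸-assoc 1 l≤N = ≤-trans (≤-reflexive (+-comm d _))
  (+-mono-≤ (weight≤sumTo N l d (λ c c<N → le c (m≤n⇒m≤1+n c<N))) (le N ≤-refl l≤N))

visit-∈ : ∀ {N} (t : Fin N) L → t ∈ visit t L
visit-∈ t L with t ∈? L
... | yes t∈ = t∈
... | no  _  = here refl

visit-⊇ : ∀ {N} (t : Fin N) L {i} → i ∈ L → i ∈ visit t L
visit-⊇ t L i∈ with t ∈? L
... | yes _ = i∈
... | no  _ = there i∈

visit-⁻ : ∀ {N} (t : Fin N) L {i} → i ∈ visit t L → i ≡ t ⊎ i ∈ L
visit-⁻ t L i∈ with t ∈? L | i∈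
... | yes _ | i∈L       = inj₂ i∈L
... | no  _ | here eq   = inj₁ eq
... | no  _ | there i∈L = inj₂ i∈L

visit-mono : ∀ {N} (t : Fin N) {S L} → (∀ {i} → i ∈ S → i ∈ L) → ∀ {i} → i ∈ visit t S → i ∈ visit t L
visit-mono t {S} {L} S⊆L i∈ with visit-⁻ t S i∈
... | inj₁ refl = visit-∈ t L
... | inj₂ i∈S  = visit-⊇ t L (S⊆L i∈S)

length-visit : ∀ {N} (t : Fin N) L → length L ≤ length (visit t L)
length-visit t L with t ∈? L
... | yes _ = ≤-refl
... | no  _ = n≤1+n _

absorb-⊇ : ∀ {N} (T : List (Fin N)) L {i} → i ∈ L → i ∈ absorb T L
absorb-⊇ []      L i∈ = i∈
absorb-⊇ (t ∷ T) L i∈ = absorb-⊇ T (visit t L) (visit-⊇ t L i∈)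

absorb-∈ : ∀ {N} (T : List (Fin N)) L {i} → i ∈ T → i ∈ absorb T L
absorb-∈ (t ∷ T) L (here refl) = absorb-⊇ T (visit t L) (visit-∈ t L)
absorb-∈ (t ∷ T) L (there i∈)  = absorb-∈ T (visit t L) i∈

absorb-mono : ∀ {N} (T : List (Fin N)) {S L} → (∀ {i} → i ∈ S → i ∈ L) → ∀ {i} → i ∈ absorb T S → i ∈ absorb T L
absorb-mono []      S⊆L = S⊆L
absorb-mono (t ∷ T) S⊆L = absorb-mono T (visit-mono t S⊆L)

end : ∀ {N} → Fin N → List (Fin N) → Fin N
end u []       = u
end u (t ∷ ts) = end t ts

end-∷ʳ : ∀ {N} (u : Fin N) ts v → end u (ts List.∷ʳ v) ≡ v
end-∷ʳ u []       v = refl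
end-∷ʳ u (t ∷ ts) v = end-∷ʳ t ts v

module _ {N} (D : Metric N) where

  -- A move on to `t` that records no point is shortcut to the direct step from the last recorded
  -- point `v`; both legs have the same weight, so the triangle inequality suffices.
  potential-move : ∀ u t L → potential D t L ≤ potential D u L + (N ∸ length L) * dist D u t
  potential-move u t []      = z≤n
  potential-move u t (v ∷ L) = ≤-trans (+-monoˡ-≤ (potential D v L) (*-monoʳ-≤ (N ∸ suc (length L)) (triangle D t u v)))
    (≤-reflexive (trans (cong (λ d → (N ∸ suc (length L)) * (d + dist D u v) + potential D v L) (dist-sym D t u))
      (lemma (N ∸ suc (length L)) (dist D u t) (dist D u v) (potential D v L))))
    where
    lemma : ∀ w a b p → w * (a + b) + p ≡ w * b + p + w * a
    lemma = solve-∀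

  potential-step : ∀ u t L → potential D t (visit t L) ≤ potential D u L + (N ∸ length L) * dist D u t
  potential-step u t L with t ∈? L
  ... | yes _ = potential-move u t L
  ... | no  _ rewrite dist-ii D t | *-zeroʳ (N ∸ suc (length L)) = potential-move u t L

  -- The distance travelled from u along ts until more than c points are visited, where S is visited already.
  lag : ℕ → List (Fin N) → Fin N → List (Fin N) → ℕ
  lag c S u []       = 0
  lag c S u (t ∷ ts) = when (length S ≤? c) (dist D u t) + lag c (visit t S) t ts

  restrict : ℕ → ℕ → ℕ → ℕ
  restrict m c x = when (m ≤? c) x

  restrict-+ : ∀ m c x y → restrict m c (x + y) ≡ restrict m c x + restrict m c y
  restrict-+ m c x y with m ≤? c
  ... | yes _ = refl
  ... | no  _ = refl

  -- `S` is what the tour alone has visited, `L ⊇ S` what the walker has. A step of weight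
  -- `N ∸ length L` is charged once to each index c from `length L` on. Such c are at least `m` and
  -- at least `length S`, so the tour alone is also still waiting to visit more than c points, and
  -- the step belongs to its lag.
  potential-absorb : ∀ m ts u {S L} → Unique S → Unique L → (∀ {i} → i ∈ S → i ∈ L) → m ≤ length L →
    potential D (end u ts) (absorb ts L) ≤ potential D u L + sumTo N (λ c → restrict m c (lag c S u ts))
  potential-absorb m []       u {S} {L} uS uL S⊆L m≤ = m≤m+n _ _
  potential-absorb m (t ∷ ts) u {S} {L} uS uL S⊆L m≤ = begin
    potential D (end t ts) (absorb ts (visit t L))
      ≤⟨ potential-absorb m ts t (unique-visit t uS) (unique-visit t uL) (visit-mono t S⊆L) (≤-trans m≤ (length-visit t L)) ⟩
    potential D t (visit t L) + sumTo N later
      ≤⟨ +-monoˡ-≤ (sumTo N later) (≤-trans (potential-step u t L)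
        (+-monoʳ-≤ (potential D u L) (weight≤sumTo N (length L) (dist D u t) now≥))) ⟩
    potential D u L + sumTo N now + sumTo N later
      ≡⟨ +-assoc (potential D u L) (sumTo N now) (sumTo N later) ⟩
    potential D u L + (sumTo N now + sumTo N later)
      ≡⟨ cong (potential D u L +_) (sym (sumTo-+ N now later)) ⟩
    potential D u L + sumTo N (λ c → now c + later c)
      ≡⟨ cong (potential D u L +_) (sumTo-cong N (λ c _ → sym (restrict-+ m c _ _))) ⟩
    potential D u L + sumTo N (λ c → restrict m c (lag c S u (t ∷ ts))) ∎
    where
    open ≤-Reasoning
    now later : ℕ → ℕ
    now c   = restrict m c (when (length S ≤? c) (dist D u t))
    later c = restrict m c (lag c (visit t S) t ts)
    now≥ : ∀ c → c < N → length L ≤ c → dist D u t ≤ now c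
    now≥ c _ L≤c = ≤-reflexive (sym
      (trans (when-yes (m ≤? c) (≤-trans m≤ L≤c)) (when-yes (length S ≤? c) (≤-trans (unique-⊆ uS S⊆L) L≤c))))

  lag≤pathLength : ∀ c S u ts → lag c S u ts ≤ pathLength D (u ∷ ts)
  lag≤pathLength c S u []       = z≤n
  lag≤pathLength c S u (t ∷ ts) with length S ≤? c
  ... | yes _ = +-monoʳ-≤ (dist D u t) (lag≤pathLength c (visit t S) t ts)
  ... | no  _ = ≤-trans (lag≤pathLength c (visit t S) t ts) (m≤n+m _ _)

  lag≡0 : ∀ c S u ts → c < length S → lag c S u ts ≡ 0
  lag≡0 c S u []       c<S = refl
  lag≡0 c S u (t ∷ ts) c<S with length S ≤? c
  ... | yes S≤c = contradiction c<S (≤⇒≯ S≤c)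
  ... | no  _   = lag≡0 c (visit t S) t ts (≤-trans c<S (length-visit t S))

  lag≤prefix : ∀ c S u i ts → c < length (absorb (take i ts) S) → lag c S u ts ≤ pathLength D (u ∷ take i ts)
  lag≤prefix c S u zero    ts       c< = ≤-reflexive (lag≡0 c S u ts c<)
  lag≤prefix c S u (suc i) []       c< = z≤n
  lag≤prefix c S u (suc i) (t ∷ ts) c< with length S ≤? c
  ... | yes _ = +-monoʳ-≤ (dist D u t) (lag≤prefix c (visit t S) t i ts c<)
  ... | no  _ = ≤-trans (lag≤prefix c (visit t S) t i ts c<) (m≤n+m _ _)

-- Stands for `d ≤ α * l`. The analysis uses only these closure properties, so all counting takes
-- place in ℕ and the Cauchy sequence α enters at the very end.
record Scale (_≼_ : ℕ → ℕ → Set) : Set where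
  field
    ≼-zero : 0 ≼ 0
    ≼-+    : ∀ {d e l m} → d ≼ l → e ≼ m → (d + e) ≼ (l + m)
    ≼-mono : ∀ {d d′ l l′} → d′ ≤ d → d ≼ l → l ≤ l′ → d′ ≼ l′

-- One right candidate among many suffices: `P` persists until `a` is processed, which turns it into
-- `Q`, and `Q` persists under whatever follows.
foldTails-reach : ∀ {A S : Set} (P Q : S → Set) (f : A → S → S) {a} as → a ∈ as →
  (∀ {b} → b ∈ as → ∀ s → P s → P (f b s)) → (∀ {b} → b ∈ as → ∀ s → Q s → Q (f b s)) → (∀ s → P s → Q (f a s)) →
  ∀ s → P s → Q (foldTails (λ b _ → f b) as s)
foldTails-reach P Q f (a ∷ as) (here refl) P→P Q→Q P→Q s p = keep as (Q→Q ∘ there) (f a s) (P→Q s p)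
  where
  keep : ∀ as → (∀ {b} → b ∈ as → ∀ s → Q s → Q (f b s)) → ∀ s → Q s → Q (foldTails (λ b _ → f b) as s)
  keep []       q→q s q = q
  keep (b ∷ as) q→q s q = keep as (q→q ∘ there) (f b s) (q→q (here refl) s q)
foldTails-reach P Q f (b ∷ as) (there a∈) P→P Q→Q P→Q s p =
  foldTails-reach P Q f as a∈ (P→P ∘ there) (Q→Q ∘ there) P→Q (f b s) (P→P (here refl) s p)

foldTails-keep : ∀ {A S : Set} (P : S → Set) (f : A → S → S) as → (∀ {b} → b ∈ as → ∀ s → P s → P (f b s)) →
  ∀ s → P s → P (foldTails (λ b _ → f b) as s)
foldTails-keep P f []       P→P s p = p
foldTails-keep P f (a ∷ as) P→P s p = foldTails-keep P f as (P→P ∘ there) (f a s) (P→P (here refl) s p)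

EndsAt : ∀ {N} → Fin N → List (Fin N) → Set
EndsAt r W = ∃[ L ] (W ≡ L List.∷ʳ r)

endsAt-visit : ∀ {N} {r : Fin N} t {L} → EndsAt r L → EndsAt r (visit t L)
endsAt-visit t {L} (L′ , eq) with t ∈? L
... | yes _ = L′ , eq
... | no  _ = t ∷ L′ , cong (t ∷_) eq

endsAt-absorb : ∀ {N} {r : Fin N} T {L} → EndsAt r L → EndsAt r (absorb T L)
endsAt-absorb []      e = e
endsAt-absorb (t ∷ T) e = endsAt-absorb T (endsAt-visit t e)

endsAt-nonempty : ∀ {N} {r : Fin N} {L} → EndsAt r L → 1 ≤ length L
endsAt-nonempty ([] , refl)    = ≤-refl
endsAt-nonempty (_ ∷ _ , refl) = s≤s z≤n

module DP {N} (D : Metric N) (r : Fin N) (lengths : List ℕ) (lengths-full : ∀ m → 1 ≤ m → m ≤ N → m ∈ lengths)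
  {_≼_ : ℕ → ℕ → Set} (scale : Scale _≼_) where

  open Scale scale

  sumTo-≼ : ∀ n {f g : ℕ → ℕ} → (∀ c → c < n → f c ≼ g c) → sumTo n f ≼ sumTo n g
  sumTo-≼ zero    f≼g = ≼-zero
  sumTo-≼ (suc n) f≼g = ≼-+ (sumTo-≼ n (λ c c<n → f≼g c (m≤n⇒m≤1+n c<n))) (f≼g n ≤-refl)

  Walk : List (Fin N) → Set
  Walk W = Unique W × EndsAt r W

  Legal : Table N → Set
  Legal tab = All Walk tab × map length tab ≡ lengths

  -- At least `m` points instead of exactly `m`, because absorbing a tour may visit more points than
  -- its requirements demand.
  Good : ℕ → ℕ → Table N → Set
  Good m x tab = ∃[ W ] (W ∈ tab × m ≤ length W × potential D r W ≼ x)

  length-better : ∀ W V → length (better D r W V) ≡ length V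
  length-better W V with length V ≟ length W
  ... | no  V≢W rewrite dec-false (length V ≟ length W) V≢W = refl
  ... | yes V≡W rewrite dec-true (length V ≟ length W) V≡W with lt (potential D r W) (potential D r V)
  ...   | true  = sym V≡W
  ...   | false = refl

  potential-better : ∀ W V → potential D r (better D r W V) ≤ potential D r V
  potential-better W V with does (length V ≟ length W) | lt (potential D r W) (potential D r V) in eq
  ... | false | _     = ≤-refl
  ... | true  | false = ≤-refl
  ... | true  | true  = <⇒≤ (lt-true _ _ eq)

  better-hit : ∀ W V → length V ≡ length W → potential D r (better D r W V) ≤ potential D r W
  better-hit W V V≡W rewrite dec-true (length V ≟ length W) V≡W with lt (potential D r W) (potential D r V) in eq
  ... | true  = ≤-refl
  ... | false = lt-false _ _ eq

  walk-better : ∀ {W V} → Walk W → Walk V → Walk (better D r W V)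
  walk-better {W} {V} w v with does (length V ≟ length W) | lt (potential D r W) (potential D r V)
  ... | false | _     = v
  ... | true  | false = v
  ... | true  | true  = w

  legal-update : ∀ {W tab} → Walk W → Legal tab → Legal (update D r W tab)
  legal-update {W} {tab} w (ws , eq) = All.map⁺ (All.map (walk-better w) ws) ,
    trans (sym (List.map-∘ tab)) (trans (List.map-cong (length-better W) tab) eq)

  good-update : ∀ W {m x tab} → Good m x tab → Good m x (update D r W tab)
  good-update W (V , V∈ , m≤ , p) = better D r W V , ∈-map⁺ (better D r W) V∈ , ≤-trans m≤
    (≤-reflexive (sym (length-better W V))) ,
    ≼-mono (potential-better W V) p ≤-refl

  good-hit : ∀ W {m x tab} → Walk W → Legal tab → m ≤ length W → potential D r W ≼ x → Good m x (update D r W tab)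
  good-hit W {tab = tab} (u , e) (ws , eq) m≤ p
    with ∈-map⁻ length (subst (length W ∈_) (sym eq) (lengths-full (length W) (endsAt-nonempty e) (unique-length u)))
  ... | V , V∈ , W≡V = better D r W V , ∈-map⁺ (better D r W) V∈ ,
    ≤-trans m≤ (≤-reflexive (trans W≡V (sym (length-better W V)))) , ≼-mono (better-hit W V (sym W≡V)) p ≤-refl

  walk-absorb : ∀ T {W} → Walk W → Walk (absorb T W)
  walk-absorb T (u , e) = unique-absorb T u , endsAt-absorb T e

  legal-process : ∀ T {tab} → Legal tab → Legal (process D r T tab)
  legal-process T {tab} leg = foldTails-keep Legal (λ W → update D r (absorb T W)) tab
    (λ W∈ tab′ → legal-update (walk-absorb T (All.lookup (proj₁ leg) W∈))) tab leg

  good-process : ∀ T {m x tab} → Good m x tab → Good m x (process D r T tab)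
  good-process T {m} {x} {tab} = foldTails-keep (Good m x) (λ W → update D r (absorb T W)) tab
    (λ {W} _ _ → good-update (absorb T W)) tab

  -- The walk `W` behind the premise lies in the old table, so `absorb T W` is proposed when the
  -- fold reaches it, and no later update loses the gain. It has `n` points since the tour alone
  -- already visits that many.
  process-hit : ∀ T {m n x tab} (g : ℕ → ℕ) → Legal tab → Good m x tab → end r T ≡ r → n ≤ length (absorb T []) →
    (∀ c → c < N → m ≤ c → lag D c [] r T ≼ g c) → Good n (x + sumTo N g) (process D r T tab)
  process-hit T {m} {n} {x} {tab} g leg (W , W∈ , m≤ , p) end≡ n≤ lag≼ =
    foldTails-reach Legal (Good n (x + sumTo N g)) (λ W → update D r (absorb T W)) tab W∈
      (λ V∈ tab′ → legal-update (walk-absorb T (All.lookup (proj₁ leg) V∈)))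
      (λ {V} _ _ → good-update (absorb T V))
      (λ tab′ leg′ → good-hit (absorb T W) (walk-absorb T w) leg′
        (≤-trans n≤ (unique-⊆ (unique-absorb T []) (absorb-mono T λ ()))) cost≼) tab leg
    where
    w : Walk W
    w = All.lookup (proj₁ leg) W∈
    restrict≼ : ∀ c → c < N → restrict D m c (lag D c [] r T) ≼ g c
    restrict≼ c c<N with m ≤? c
    ... | yes m≤c = lag≼ c c<N m≤c
    ... | no  _   = ≼-mono z≤n ≼-zero z≤n
    cost≼ : potential D r (absorb T W) ≼ (x + sumTo N g)
    cost≼ = ≼-mono (subst (λ v → potential D v (absorb T W) ≤ potential D r W + sumTo N
      (λ c → restrict D m c (lag D c [] r T))) end≡
      (potential-absorb D m T r [] (proj₁ w) (λ ()) m≤)) (≼-+ p (sumTo-≼ N restrict≼)) ≤-refl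

-- Complete walks as solutions and potentials as their values

unique-ʳ++ : ∀ {A : Set} {xs ys : List A} → Unique xs → Unique ys → (∀ {x} → x ∈ xs → x ∉ ys) → Unique (xs ʳ++ ys)
unique-ʳ++ []       v disjoint = v
unique-ʳ++ {xs = x ∷ xs} {ys} (x∉ ∷ u) v disjoint = unique-ʳ++ u (All.tabulate (λ { y∈ refl → disjoint (here refl) y∈ }) ∷ v)
  λ { z∈ (here refl) → All.lookup x∉ z∈ refl ; z∈ (there z∈ys) → disjoint (there z∈) z∈ys }

unique-complete : ∀ {N} {xs : List (Fin N)} → Unique xs → length xs ≡ N → ∀ i → i ∈ xs
unique-complete {N} {xs} u eq i with i ∈? xs
... | yes i∈ = i∈
... | no  i∉ = contradiction (unique-length (All.tabulate (λ { j∈ refl → i∉ j∈ }) ∷ u))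
  (<⇒≱ (≤-reflexive (cong suc (sym eq))))

sumTo-front : ∀ n f → sumTo (suc n) f ≡ f 0 + sumTo n (f ∘ suc)
sumTo-front zero    f = sym (+-identityʳ (f 0))
sumTo-front (suc n) f = trans (cong (_+ f (suc n)) (sumTo-front n f)) (+-assoc (f 0) (sumTo n (f ∘ suc)) (f (suc n)))

sum-tabulate : ∀ n f → sum (tabulate {n = n} (f ∘ toℕ)) ≡ sumTo n f
sum-tabulate zero    f = refl
sum-tabulate (suc n) f = trans (cong (f 0 +_) (sum-tabulate n (f ∘ suc))) (sym (sumTo-front n f))

tabulate-lookup-cast : ∀ {A : Set} {n} (xs : List A) (eq : n ≡ length xs) → tabulate (List.lookup xs ∘ Fin.cast eq) ≡ xs
tabulate-lookup-cast xs refl = trans (List.tabulate-cong (λ i → cong (List.lookup xs) (Fin.cast-is-id refl i)))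
  (List.tabulate-lookup xs)

module _ {N} (D : Metric N) where

  pathLength-ʳ++ : ∀ xs y ys → pathLength D (xs ʳ++ (y ∷ ys)) ≡ pathLength D (y ∷ xs) + pathLength D (y ∷ ys)
  pathLength-ʳ++ []       y ys = refl
  pathLength-ʳ++ (x ∷ xs) y ys = trans (pathLength-ʳ++ xs x (y ∷ ys))
    (trans (cong (λ d → pathLength D (x ∷ xs) + (d + pathLength D (y ∷ ys))) (dist-sym D x y))
      (lemma (pathLength D (x ∷ xs)) (dist D y x) (pathLength D (y ∷ ys))))
    where
    lemma : ∀ p d q → p + (d + q) ≡ d + p + q
    lemma = solve-∀

  pathLength-reverse : ∀ L → pathLength D (reverse L) ≡ pathLength D L
  pathLength-reverse []      = refl
  pathLength-reverse (x ∷ L) = trans (pathLength-ʳ++ L x []) (+-identityʳ _)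

  completionSum : List (Fin N) → ℕ
  completionSum xs = sumTo (length xs) (λ i → pathLength D (take (suc i) xs))

  suffixSum : List (Fin N) → ℕ
  suffixSum []      = 0
  suffixSum (x ∷ L) = suffixSum L + pathLength D (x ∷ L)

  take-++ˡ : ∀ {A : Set} i (xs ys : List A) → i ≤ length xs → take i (xs ++ ys) ≡ take i xs
  take-++ˡ zero    xs       ys i≤ = refl
  take-++ˡ (suc i) (x ∷ xs) ys i≤ = cong (x ∷_) (take-++ˡ i xs ys (s≤s⁻¹ i≤))

  completionSum-reverse : ∀ L → completionSum (reverse L) ≡ suffixSum L
  completionSum-reverse []      = refl
  completionSum-reverse (x ∷ L) = trans
    (cong₂ (λ n xs → sumTo n (λ i → pathLength D (take (suc i) xs))) length≡ (List.unfold-reverse x L))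
    (cong₂ _+_
      (trans (sumTo-cong (length L) (λ i i<L → cong (pathLength D)
        (take-++ˡ (suc i) (reverse L) (x ∷ []) (≤-trans i<L (≤-reflexive (sym (List.length-reverse L)))))))
        (trans (cong (λ n → sumTo n (λ i → pathLength D (take (suc i) (reverse L)))) (sym (List.length-reverse L)))
          (completionSum-reverse L)))
      (trans (cong (pathLength D) (trans (List.take-all (suc (length L)) (reverse L ++ x ∷ []) (≤-reflexive full))
        (sym (List.unfold-reverse x L))))
        (pathLength-reverse (x ∷ L))))
    where
    length≡ : length (reverse (x ∷ L)) ≡ suc (length L)
    length≡ = List.length-reverse (x ∷ L)
    full : length (reverse L ++ x ∷ []) ≡ suc (length L)
    full = trans (cong length (sym (List.unfold-reverse x L))) length≡

  -- Summation by parts: weighting steps by the number of unvisited points amounts to adding the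
  -- completion times of the visited points and, for each unvisited one, the length travelled so
  -- far.
  potential≡ : ∀ x L → suc (length L) ≤ N → potential D x L ≡ (N ∸ suc (length L)) * pathLength D (x ∷ L) + suffixSum (x ∷ L)
  potential≡ x []      _ = sym (trans (+-identityʳ _) (*-zeroʳ (N ∸ 1)))
  potential≡ x (y ∷ L) ≤N = trans (cong₂ (λ w p → w * dist D x y + p) weight (potential≡ y L (<⇒≤ ≤N)))
    (trans (cong (λ w → suc e * dist D x y + (w * pathLength D (y ∷ L) + suffixSum (y ∷ L))) weight)
      (lemma e (dist D x y) (pathLength D (y ∷ L)) (suffixSum (y ∷ L))))
    where
    e : ℕ
    e = N ∸ suc (suc (length L))
    weight : N ∸ suc (length L) ≡ suc e
    weight = +-∸-assoc 1 ≤N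
    lemma : ∀ e d p s → suc e * d + (suc e * p + s) ≡ e * (d + p) + (s + (d + p))
    lemma = solve-∀

  potential-full : ∀ r L → length L ≡ N → potential D r L ≡ suffixSum L
  potential-full r []      eq = refl
  potential-full r (x ∷ L) eq = trans (cong₂ (λ w p → w * dist D r x + p) weight (potential≡ x L (≤-reflexive eq)))
    (cong (λ w → w * pathLength D (x ∷ L) + suffixSum (x ∷ L)) weight)
    where
    weight : N ∸ suc (length L) ≡ 0
    weight = trans (cong (N ∸_) eq) (n∸n≡0 N)

module _ (I : TRP) where

  open TRP I renaming (metric to D; origin to r)
  open Solution

  sequence-value : ∀ (Π : Solution I) → value Π ≡ completionSum D (sequence Π)
  sequence-value Π = trans (sum-tabulate (suc n) (λ i → pathLength D (take (suc i) (sequence Π))))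
    (cong (λ m → sumTo m (λ i → pathLength D (take (suc i) (sequence Π)))) (sym (List.length-tabulate (perm Π ⟨$⟩ʳ_))))

  module _ (L : List (Fin (suc n))) (unique : Unique L) (full : length L ≡ suc n) (ends : EndsAt r L) where

    private
      xs : List (Fin (suc n))
      xs = reverse L
      xs-unique : Unique xs
      xs-unique = unique-ʳ++ unique [] (λ _ ())
      xs-full : suc n ≡ length xs
      xs-full = sym (trans (List.length-reverse L) full)
      xs-complete : ∀ i → i ∈ xs
      xs-complete = unique-complete xs-unique (sym xs-full)
      to from : Fin (suc n) → Fin (suc n)
      to i   = List.lookup xs (Fin.cast xs-full i)
      from i = Fin.cast (sym xs-full) (Any.index (xs-complete i))
      to-from : ∀ i → to (from i) ≡ i
      to-from i = trans (cong (List.lookup xs) (trans (Fin.cast-trans (sym xs-full) xs-full _) (Fin.cast-is-id refl _)))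
        (sym (lookup-index (xs-complete i)))
      from-to : ∀ i → from (to i) ≡ i
      from-to i = trans (cong (Fin.cast (sym xs-full)) (unique-lookup xs-unique _ _ (sym (lookup-index (xs-complete (to i))))))
        (trans (Fin.cast-trans xs-full (sym xs-full) i) (Fin.cast-is-id refl i))
      tabulate-to : tabulate to ≡ xs
      tabulate-to = tabulate-lookup-cast xs xs-full
      xs-start : ∃[ ys ] (xs ≡ r ∷ ys)
      xs-start = reverse (proj₁ ends) , trans (cong reverse (proj₂ ends)) (List.reverse-++ (proj₁ ends) (r ∷ []))

    walkSolution : Solution I
    walkSolution = record
      { perm        = permutation to from to-from from-to
      ; starts-at-r = List.∷-injectiveˡ (trans tabulate-to (proj₂ xs-start)) }

    walkSolution-sequence : sequence walkSolution ≡ xs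
    walkSolution-sequence = tabulate-to

    walkSolution-value : value walkSolution ≡ potential D r L
    walkSolution-value = trans (sequence-value walkSolution) (trans (cong (completionSum D) walkSolution-sequence)
      (trans (completionSum-reverse D L) (sym (potential-full D r L full))))

-- Thresholds and windows

unless : ∀ {P : Set} → Dec P → ℕ → ℕ
unless (yes _) x = 0
unless (no _)  x = x

module _ (a : ℕ) where

  private
    p : ℕ
    p = 2 ^ a
    l : ℕ → ℕ
    l = threshold a

  -- Rounding in `next` loses less than the unit that is added, so the growth factor is at least 1 +
  -- 1/p; it exceeds that only by the effect of this unit, which becomes the `suc` in `suc (l h)`.
  threshold-upper : ∀ h → p * l (suc h) ≤ suc p * suc (l h)
  threshold-upper h = ≤-trans (≤-reflexive (lemma₁ p (shift a (l h)) (l h)))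
    (≤-trans (+-monoʳ-≤ (p + p * l h) (proj₁ (shift-bounds a (l h)))) (slack 1 (lemma₂ p (l h))))
    where
    lemma₁ : ∀ p s l → p * suc (s + l) ≡ p + p * l + p * s
    lemma₁ = solve-∀
    lemma₂ : ∀ p l → p + p * l + l + 1 ≡ suc p * suc l
    lemma₂ = solve-∀

  threshold-lower : ∀ h → suc p * l h ≤ p * l (suc h)
  threshold-lower h = ≤-trans (≤-reflexive (+-comm (l h) (p * l h)))
    (≤-trans (+-monoʳ-≤ (p * l h) (<⇒≤ (proj₂ (shift-bounds a (l h))))) (≤-reflexive (lemma p (shift a (l h)) (l h))))
    where
    lemma : ∀ p s l → p * l + p * suc s ≡ p * suc (s + l)
    lemma = solve-∀

  -- Bernoulli's inequality for the factor 1 + 1/p: every step adds at least a p-th of `l h`.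
  threshold-linear : ∀ h i → p * l h + i * l h ≤ p * l (i + h)
  threshold-linear h zero    = ≤-reflexive (+-identityʳ _)
  threshold-linear h (suc i) = ≤-trans (≤-reflexive (lemma (p * l h) (l h) (i * l h)))
    (≤-trans (+-mono-≤ (threshold-mono a (m≤n+m h i)) (threshold-linear h i)) (threshold-lower (i + h)))
    where
    lemma : ∀ q l i → q + (l + i) ≡ l + (q + i)
    lemma = solve-∀

  -- Leaves room for the return trip: following a path of length at most `l b` and going back fits
  -- into `l (p + b)`.
  threshold-double : ∀ h → 2 * l h ≤ l (p + h)
  threshold-double h = *-cancelˡ-≤ p {{m^n≢0 2 a}} (≤-trans (≤-reflexive (lemma p (l h))) (threshold-linear h p))
    where
    lemma : ∀ p l → p * (2 * l) ≡ p * l + p * l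
    lemma = solve-∀

  threshold-≥ : ∀ h → h ≤ l h
  threshold-≥ zero    = z≤n
  threshold-≥ (suc h) = s≤s (≤-trans (threshold-≥ h) (m≤n+m (l h) _))

  -- Crude, as a step adds at most the threshold itself and a unit, which the threshold also
  -- dominates from index 1 on. Only `i = p` matters, where it bounds the cost of a restart by a
  -- constant multiple of the boundary.
  threshold-triple : ∀ b i → 1 ≤ b → l (i + b) ≤ 3 ^ i * l b
  threshold-triple b zero    1≤b = ≤-reflexive (sym (+-identityʳ _))
  threshold-triple b (suc i) 1≤b = ≤-trans
    (+-mono-≤ (≤-trans 1≤b (≤-trans (m≤n+m b i) (threshold-≥ (i + b)))) (+-monoˡ-≤ (l (i + b)) (shift≤ a (l (i + b)))))
    (≤-trans (≤-reflexive (lemma (l (i + b))))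
      (≤-trans (*-monoʳ-≤ 3 (threshold-triple b i 1≤b)) (≤-reflexive (sym (*-assoc 3 (3 ^ i) (l b))))))
    where
    lemma : ∀ l → l + (l + l) ≡ 3 * l
    lemma = solve-∀

  threshold-exp : ∀ e → 2 ^ e ≤ l (suc e * p)
  threshold-exp zero    = ≤-trans (m^n>0 2 a) (≤-trans (≤-reflexive (sym (+-identityʳ p))) (threshold-≥ (1 * p)))
  threshold-exp (suc e) = ≤-trans (*-monoʳ-≤ 2 (threshold-exp e)) (threshold-double (suc e * p))

  -- A geometric series: by `threshold-lower`, the bound for the earlier terms is at most `p` times
  -- the new term.
  threshold-sum : ∀ m → sumTo (suc m) (l ∘ suc) ≤ suc p * l (suc m)
  threshold-sum zero    = ≤-trans (≤-reflexive (sym (+-identityʳ (l 1)))) (*-monoˡ-≤ (l 1) (s≤s (z≤n {p})))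
  threshold-sum (suc m) = ≤-trans (+-monoˡ-≤ (l (2 + m)) (≤-trans (threshold-sum m) (threshold-lower (suc m))))
    (≤-reflexive (+-comm (p * l (2 + m)) (l (2 + m))))

  -- The least h ≤ k with c ≤ l h, provided that c ≤ l k.
  search : ℕ → ℕ → ℕ
  search c zero    = zero
  search c (suc k) with c ≤? l k
  ... | yes _ = search c k
  ... | no  _ = suc k

  search-≤ : ∀ c k → c ≤ l k → c ≤ l (search c k)
  search-≤ c zero    c≤ = c≤
  search-≤ c (suc k) c≤ with c ≤? l k
  ... | yes c≤k = search-≤ c k c≤k
  ... | no  _   = c≤

  search-least : ∀ c k b → c ≤ l b → search c k ≤ b
  search-least c zero    b c≤ = z≤n
  search-least c (suc k) b c≤ with c ≤? l k
  ... | yes _   = search-least c k b c≤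
  ... | no  c≰k = ≰⇒> (λ b≤k → c≰k (≤-trans c≤ (threshold-mono a b≤k)))

  -- If the search stops at `suc k`, then `l k < c`, and this strictness absorbs the unit in
  -- `threshold-upper`.
  search-upper : ∀ c k → p * l (search c k) ≤ suc p * c
  search-upper c zero    = ≤-trans (≤-reflexive (*-zeroʳ p)) z≤n
  search-upper c (suc k) with c ≤? l k
  ... | yes _   = search-upper c k
  ... | no  c≰k = ≤-trans (threshold-upper k) (*-monoʳ-≤ (suc p) (≰⇒> c≰k))

  roundUp : ℕ → ℕ
  roundUp c = search c c

  roundUp-≤ : ∀ c → c ≤ l (roundUp c)
  roundUp-≤ c = search-≤ c c (threshold-≥ c)

  roundUp-> : ∀ {c b} → ¬ (c ≤ l b) → b < roundUp c
  roundUp-> {c} c≰ = ≰⇒> (λ r≤b → c≰ (≤-trans (roundUp-≤ c) (threshold-mono a r≤b)))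

  -- The share of a point with completion time c in the extra cost of ending a window at index b.
  pending : ℕ → ℕ → ℕ
  pending c b = unless (c ≤? l b) (l b)

  pending-sum : ∀ c m → sumTo m (λ i → pending c (suc i)) ≤ suc p * c
  pending-sum c zero    = z≤n
  pending-sum c (suc m) with c ≤? l (suc m)
  ... | yes _   = ≤-trans (≤-reflexive (+-identityʳ _)) (pending-sum c m)
  ... | no  c≰ = ≤-trans (+-monoˡ-≤ (l (suc m)) (sumTo-mono m (λ i _ → pending≤ (suc i)))) (≤-trans (threshold-sum m)
      (*-monoʳ-≤ (suc p) (<⇒≤ (≰⇒> c≰))))
    where
    pending≤ : ∀ b → pending c b ≤ l b
    pending≤ b with c ≤? l b
    ... | yes _ = z≤n
    ... | no  _ = ≤-refl

sumTo-append : ∀ m n f → sumTo (m + n) f ≡ sumTo m f + sumTo n (λ i → f (m + i))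
sumTo-append m zero    f = trans (cong (λ k → sumTo k f) (+-identityʳ m)) (sym (+-identityʳ _))
sumTo-append m (suc n) f = trans (cong (λ k → sumTo k f) (+-suc m n))
  (trans (cong (_+ f (m + n)) (sumTo-append m n f)) (+-assoc (sumTo m f) _ _))

-- The boundaries for all offsets together run through every index exactly once; this is the
-- averaging over offsets.
sumTo-blocks : ∀ H J f → sumTo H (λ s → sumTo J (λ j → f (j * H + s))) ≡ sumTo (J * H) f
sumTo-blocks H zero    f = sumTo-zero H
sumTo-blocks H (suc J) f = trans (sumTo-+ H (λ s → sumTo J (λ j → f (j * H + s))) (λ s → f (J * H + s)))
  (trans (cong (_+ sumTo H (λ s → f (J * H + s))) (sumTo-blocks H J f))
    (trans (sym (sumTo-append (J * H) H f)) (cong (λ k → sumTo k f) (+-comm (J * H) H))))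

pigeonhole-sum : ∀ H .{{_ : NonZero H}} (f : ℕ → ℕ) → ∃[ s ] (s < H × H * f s ≤ sumTo H f)
pigeonhole-sum (suc zero) f = 0 , s≤s z≤n , ≤-reflexive (+-identityʳ (f 0))
pigeonhole-sum (suc (suc H)) f with pigeonhole-sum (suc H) f
... | s , s< , le with f s ≤? f (suc H)
...   | yes fs≤ = s , m≤n⇒m≤1+n s< , ≤-trans (≤-reflexive (+-comm (f s) (suc H * f s))) (+-mono-≤ le fs≤)
...   | no  fs≰ = suc H , ≤-refl , ≤-trans (≤-reflexive (+-comm (f (suc H)) (suc H * f (suc H))))
      (+-monoˡ-≤ (f (suc H)) (≤-trans (*-monoʳ-≤ (suc H) (<⇒≤ (≰⇒> fs≰))) le))

choose : ∀ {P : Set} → Dec P → ℕ → ℕ → ℕ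
choose (yes _) x y = x
choose (no _)  x y = y

pathLength-take : ∀ {N} (D : Metric N) i j xs → i ≤ j → pathLength D (take i xs) ≤ pathLength D (take j xs)
pathLength-take D zero          j             xs           i≤j = z≤n
pathLength-take D (suc i)       (suc j)       []           i≤j = z≤n
pathLength-take D (suc zero)    (suc j)       (x ∷ xs)     i≤j = z≤n
pathLength-take D (suc (suc i)) (suc (suc j)) (x ∷ [])     i≤j = z≤n
pathLength-take D (suc (suc i)) (suc (suc j)) (x ∷ y ∷ xs) i≤j = +-monoʳ-≤ (dist D x y)
  (pathLength-take D (suc i) (suc j) (y ∷ xs) (s≤s⁻¹ i≤j))
pathLength-take D (suc (suc i)) (suc zero)    xs           (s≤s ())

pathLength-return : ∀ {N} (D : Metric N) y ys z → pathLength D (y ∷ ys List.∷ʳ z) ≤ 2 * pathLength D (y ∷ ys) + dist D y z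
pathLength-return D y []       z = ≤-reflexive (+-identityʳ _)
pathLength-return D y (x ∷ ys) z = ≤-trans (+-monoʳ-≤ (dist D y x) (≤-trans (pathLength-return D x ys z)
    (+-monoʳ-≤ (2 * pathLength D (x ∷ ys)) (triangle D x y z))))
  (≤-reflexive (trans (cong (λ d → dist D y x + (2 * pathLength D (x ∷ ys) + (d + dist D y z))) (dist-sym D x y))
    (lemma (dist D y x) (pathLength D (x ∷ ys)) (dist D y z))))
  where
  lemma : ∀ d p e → d + (2 * p + (d + e)) ≡ 2 * (d + p) + e
  lemma = solve-∀

take-∷ʳ : ∀ {A : Set} i m (xs : List A) z → i ≤ m → m ≤ length xs → take i (take m xs List.∷ʳ z) ≡ take i xs
take-∷ʳ zero    m       xs       z i≤m m≤ = refl
take-∷ʳ (suc i) (suc m) (x ∷ xs) z i≤m m≤ = cong (x ∷_) (take-∷ʳ i m xs z (s≤s⁻¹ i≤m) (s≤s⁻¹ m≤))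

length-take-≤ : ∀ {A : Set} i (xs : List A) → i ≤ length xs → length (take i xs) ≡ i
length-take-≤ i xs i≤ = trans (List.length-take i xs) (m≤n⇒m⊓n≡m i≤)

take-⊆ : ∀ {A : Set} i (xs : List A) {x} → x ∈ take i xs → x ∈ xs
take-⊆ (suc i) (x ∷ xs) (here eq)  = here eq
take-⊆ (suc i) (x ∷ xs) (there x∈) = there (take-⊆ i xs x∈)

unique-numVisited : ∀ {N} {xs : List (Fin N)} → Unique xs → length xs ≤ numVisited xs
unique-numVisited u = unique-⊆ u (∈-deduplicate⁺ Fin._≟_)

numVisited-absorb : ∀ {N} i (T : List (Fin N)) → numVisited (take i T) ≤ length (absorb (take i T) [])
numVisited-absorb i T = unique-⊆ (deduplicate-! Fin._≟_ (take i T))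
  (λ x∈ → absorb-∈ (take i T) [] (∈-deduplicate⁻ Fin._≟_ (take i T) x∈))

numVisited-absorb-all : ∀ {N} i (T : List (Fin N)) → numVisited (take i T) ≤ length (absorb T [])
numVisited-absorb-all i T = unique-⊆ (deduplicate-! Fin._≟_ (take i T))
  (λ x∈ → absorb-∈ T [] (take-⊆ i T (∈-deduplicate⁻ Fin._≟_ (take i T) x∈)))

-- Requirements read off a given solution

module Windows (a H : ℕ) (I : TRP) (ys : List (Fin (suc (TRP.n I))))
  (unique : Unique (TRP.origin I ∷ ys)) (full : length (TRP.origin I ∷ ys) ≡ suc (TRP.n I)) where

  open TRP I renaming (metric to D; origin to r)

  private
    p N : ℕ
    p = 2 ^ a
    N = suc n
    l : ℕ → ℕ
    l = threshold a
    xs : List (Fin N)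
    xs = r ∷ ys

  completion : ℕ → ℕ
  completion c = pathLength D (take (suc c) xs)

  -- The number of c < k with completion c ≤ x, since completion is nondecreasing.
  count : ℕ → ℕ → ℕ
  count zero    x = 0
  count (suc k) x = choose (completion k ≤? x) (suc k) (count k x)

  count-≤ : ∀ k x → count k x ≤ k
  count-≤ zero    x = z≤n
  count-≤ (suc k) x with completion k ≤? x
  ... | yes _ = ≤-refl
  ... | no  _ = m≤n⇒m≤1+n (count-≤ k x)

  <count : ∀ k x c → c < count k x → completion c ≤ x
  <count (suc k) x c c< with completion k ≤? x
  ... | yes C≤x = ≤-trans (pathLength-take D (suc c) (suc k) xs c<) C≤x
  ... | no  _   = <count k x c c<

  count> : ∀ k x c → c < k → completion c ≤ x → c < count k x
  count> (suc k) x c c<k C≤x with completion k ≤? x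
  ... | yes _   = c<k
  ... | no  C≰x = count> k x c (≤∧≢⇒< (s≤s⁻¹ c<k) λ { refl → C≰x C≤x }) C≤x

  count-mono : ∀ k {x y} → x ≤ y → count k x ≤ count k y
  count-mono zero    x≤y = z≤n
  count-mono (suc k) {x} {y} x≤y with completion k ≤? x | completion k ≤? y
  ... | yes _   | yes _   = ≤-refl
  ... | yes C≤x | no  C≰y = contradiction (≤-trans C≤x x≤y) C≰y
  ... | no  _   | yes _   = m≤n⇒m≤1+n (count-≤ k x)
  ... | no  _   | no  _   = count-mono k x≤y

  window : ℕ → ℕ → ℕ
  window b t = b ∸ (H ∸ t)

  -- The last H + 1 thresholds up to index b, followed by one that leaves room for the return to the origin.
  lengthIndex : ℕ → Fin (suc (suc H)) → ℕ
  lengthIndex b h = choose (toℕ h ≤? H) (window b (toℕ h)) (p + b)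

  -- At the last `h`, where `toℕ h` is `suc H`, truncated subtraction makes the window index `b`
  -- once more: this requirement asks for no further points and only limits the total length.
  required : ℕ → Fin (suc (suc H)) → ℕ
  required b h = count N (l (window b (toℕ h)))

  window-mono : ∀ b {s t} → s ≤ t → window b s ≤ window b t
  window-mono b s≤t = ∸-monoʳ-≤ b (∸-monoʳ-≤ H s≤t)

  window-≤ : ∀ b t → window b t ≤ b
  window-≤ b t = m∸n≤m b (H ∸ t)

  lengthIndex-mono : ∀ b {g h} → g Fin.≤ h → lengthIndex b g ≤ lengthIndex b h
  lengthIndex-mono b {g} {h} g≤h with toℕ g ≤? H | toℕ h ≤? H
  ... | yes _   | yes _   = window-mono b g≤h
  ... | yes _   | no  _   = ≤-trans (window-≤ b (toℕ g)) (m≤n+m b p)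
  ... | no  g≰H | yes h≤H = contradiction (≤-trans g≤h h≤H) g≰H
  ... | no  _   | no  _   = ≤-refl

  lengthIndex-≤ : ∀ b h → lengthIndex b h ≤ p + b
  lengthIndex-≤ b h with toℕ h ≤? H
  ... | yes _ = ≤-trans (window-≤ b (toℕ h)) (m≤n+m b p)
  ... | no  _ = ≤-refl

  required-mono : ∀ b {g h} → g Fin.≤ h → required b g ≤ required b h
  required-mono b g≤h = count-mono N (threshold-mono a (window-mono b g≤h))

  required-≤ : ∀ b h → required b h ≤ N
  required-≤ b h = count-≤ N _

  lengthIndex-last : ∀ b → lengthIndex b (Fin.fromℕ (suc H)) ≡ p + b
  lengthIndex-last b with toℕ (Fin.fromℕ (suc H)) ≤? H
  ... | yes ≤H = contradiction (≤-trans (≤-reflexive (sym (Fin.toℕ-fromℕ (suc H)))) ≤H) 1+n≰n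
  ... | no  _  = refl

  window-last : ∀ b → window b (toℕ (Fin.fromℕ (suc H))) ≡ b
  window-last b = cong (b ∸_) (trans (cong (H ∸_) (Fin.toℕ-fromℕ (suc H))) (m≤n⇒m∸n≡0 (n≤1+n H)))

  position : ∀ {b h} → h ≤ b → b ≤ h + H → ∃[ g ] (lengthIndex b g ≡ h × window b (toℕ g) ≡ h)
  position {b} {h} h≤b b≤h+H = g , trans (chosen (toℕ g ≤? H)) win , win
    where
    t≤H : H ∸ (b ∸ h) ≤ H
    t≤H = m∸n≤m H (b ∸ h)
    g : Fin (suc (suc H))
    g = Fin.fromℕ< {H ∸ (b ∸ h)} (s≤s (m≤n⇒m≤1+n t≤H))
    toℕ-g : toℕ g ≡ H ∸ (b ∸ h)
    toℕ-g = Fin.toℕ-fromℕ< (s≤s (m≤n⇒m≤1+n t≤H))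
    win : window b (toℕ g) ≡ h
    win = trans (cong (λ t → b ∸ (H ∸ t)) toℕ-g) (trans (cong (b ∸_) (m∸[m∸n]≡n (m≤n+o⇒m∸n≤o b h b≤h+H))) (m∸[m∸n]≡n h≤b))
    chosen : (d : Dec (toℕ g ≤ H)) → choose d (window b (toℕ g)) (p + b) ≡ window b (toℕ g)
    chosen (yes _)  = refl
    chosen (no g≰H) = contradiction (≤-trans (≤-reflexive toℕ-g) t≤H) g≰H

  -- When a tour meeting the requirements of the window ending at b has visited more than c points.
  limit : ℕ → ℕ → ℕ
  limit b c = choose (completion c ≤? l b) (l (roundUp a (completion c))) (l (p + b))

  module _ (b : ℕ) (le ne : Entry (suc (suc H))) (le≡ : ∀ h → vec le h ≡ lengthIndex b h)
    (ne≡ : ∀ h → vec ne h ≡ required b h) where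

    private
      S : SegTSP (suc H)
      S = segmented a I le ne
      m : ℕ
      m = count N (l b)
      m≥1 : 1 ≤ m
      m≥1 = count> N (l b) 0 (s≤s z≤n) z≤n
      m≡ : suc (pred m) ≡ m
      m≡ = suc-pred m {{>-nonZero m≥1}}
      prefix : ∀ i → i ≤ m → take i (tour S (take (pred m) ys)) ≡ take i xs
      prefix i i≤m = take-∷ʳ i (suc (pred m)) xs r (≤-trans i≤m (≤-reflexive (sym m≡)))
        (≤-trans (≤-reflexive m≡) (≤-trans (count-≤ N (l b)) (≤-reflexive (sym full))))
      last : Fin (suc (suc H))
      last = Fin.fromℕ (suc H)
      ne-last : vec ne last ≡ m
      ne-last = trans (ne≡ last) (cong (λ i → count N (l i)) (window-last b))

    -- The witness follows the given solution through the `m` points finished by `l b` and then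
    -- returns to the origin, which at most doubles its length. Its first `m` stops are those of the
    -- solution, so the counts are met on time.
    window-feasible : Feasible S
    window-feasible = take (pred m) ys , meets , total
      where
      total : pathLength D (tour S (take (pred m) ys)) ≤ l (vec le last)
      total = ≤-trans (pathLength-return D r (take (pred m) ys) r)
        (≤-trans (≤-reflexive (trans (cong (2 * completion (pred m) +_) (dist-ii D r)) (+-identityʳ _)))
        (≤-trans (*-monoʳ-≤ 2 (<count N (l b) (pred m) (≤-reflexive m≡))) (≤-trans (threshold-double a b)
          (≤-reflexive (cong l (sym (trans (le≡ last) (lengthIndex-last b))))))))
      short : ∀ i x → i ≤ count N x → pathLength D (take i xs) ≤ x
      short zero    x i≤ = z≤n
      short (suc c) x i≤ = <count N x c i≤
      req≤m : ∀ h → required b h ≤ m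
      req≤m h = count-mono N (threshold-mono a (window-≤ b (toℕ h)))
      window≤length : ∀ h → window b (toℕ h) ≤ lengthIndex b h
      window≤length h with toℕ h ≤? H
      ... | yes _ = ≤-refl
      ... | no  _ = ≤-trans (window-≤ b (toℕ h)) (m≤n+m b p)
      meets : ∀ h → ∃[ i ] (pathLength D (take i (tour S (take (pred m) ys))) ≤ l (vec le h) × vec ne h ≤ numVisited
        (take i (tour S (take (pred m) ys))))
      meets h = required b h ,
        subst₂ _≤_ (cong (pathLength D) (sym (prefix (required b h) (req≤m h)))) (cong l (sym (le≡ h)))
          (≤-trans (short (required b h) (l (window b (toℕ h))) ≤-refl) (threshold-mono a (window≤length h))) ,
        subst₂ _≤_ (sym (ne≡ h)) (cong numVisited (sym (prefix (required b h) (req≤m h))))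
          (≤-trans (≤-reflexive (sym (length-take-≤ (required b h) xs (≤-trans (required-≤ b h) (≤-reflexive (sym full))))))
            (unique-numVisited (Unique.take⁺ (required b h) unique)))

    module _ {_≼_ : ℕ → ℕ → Set} (scale : Scale _≼_) (vs : List (Fin N)) (meets : Meets S _≼_ (tour S vs)) where

      open Scale scale

      tour-end : end r (tour S vs) ≡ r
      tour-end = end-∷ʳ r vs r

      tour-visits : m ≤ length (absorb (tour S vs) [])
      tour-visits with proj₁ meets last
      ... | i , _ , visited = ≤-trans (≤-reflexive (sym ne-last)) (≤-trans visited (numVisited-absorb-all i (tour S vs)))

      lag-prefix : ∀ c i {d} → pathLength D (take i (tour S vs)) ≼ d → c < numVisited (take i (tour S vs)) → lag D c [] r
        (tour S vs) ≼ d
      lag-prefix c (suc i) ≼d c< = ≼-mono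
        (≤-trans (lag≤prefix D c [] r (suc i) (tour S vs) (≤-trans c< (numVisited-absorb (suc i) (tour S vs))))
        (≤-reflexive (cong (_+ pathLength D (take (suc i) (tour S vs))) (dist-ii D r)))) ≼d ≤-refl

      -- For a point finished by the boundary, the requirement at its rounded completion time
      -- applies; `near` says that the window reaches back that far. Otherwise the length of the
      -- whole tour is the bound.
      tour-lag : ∀ c → c < N → (completion c ≤ l b → b ≤ roundUp a (completion c) + H) → lag D c [] r (tour S vs) ≼ limit b c
      tour-lag c c<N near with completion c ≤? l b
      ... | no  _   = ≼-mono (≤-trans (lag≤pathLength D c [] r (tour S vs))
        (≤-reflexive (cong (_+ pathLength D (tour S vs)) (dist-ii D r))))
        (proj₂ meets) (≤-reflexive (cong l (trans (le≡ last) (lengthIndex-last b))))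
      ... | yes C≤ with position (search-least a (completion c) (completion c) b C≤) (near C≤)
      ...   | g , length≡ , window≡ with proj₁ meets g
      ...     | i , ≼len , visited = ≼-mono ≤-refl (lag-prefix c i ≼len (≤-trans
        (count> N (l (roundUp a (completion c))) c c<N (roundUp-≤ a (completion c)))
        (≤-trans (≤-reflexive (sym (trans (ne≡ g) (cong (λ i → count N (l i)) window≡)))) visited)))
        (≤-reflexive (cong l (trans (le≡ g) length≡)))

-- Gluing the windows

iterate : ∀ {S : Set} → ℕ → (S → S) → S → S
iterate zero    f s = s
iterate (suc k) f s = f (iterate k f s)

iterate-suc : ∀ {S : Set} k (f : S → S) s → iterate k f (f s) ≡ f (iterate k f s)
iterate-suc zero    f s = refl
iterate-suc (suc k) f s = cong f (iterate-suc k f s)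

foldTails-iterate : ∀ {A S : Set} (f : S → S) (as : List A) s → foldTails (λ _ _ → f) as s ≡ iterate (length as) f s
foldTails-iterate f []       s = refl
foldTails-iterate f (a ∷ as) s = trans (foldTails-iterate f as (f s)) (iterate-suc (length as) f s)

suffix-lengths : ∀ {A : Set} (L : List A) m → 1 ≤ m → m ≤ length L → m ∈ map length (suffixes L)
suffix-lengths []      (suc m) 1≤m ()
suffix-lengths (x ∷ L) m 1≤m m≤ with m ≟ suc (length L)
... | yes refl = here refl
... | no  m≢   = there (suffix-lengths L m 1≤m (s≤s⁻¹ (≤∧≢⇒< m≤ m≢)))

suffix-lengths-≤ : ∀ {A : Set} (L : List A) m → m ∈ map length (suffixes L) → m ≤ length L
suffix-lengths-≤ (x ∷ L) m (here refl) = ≤-refl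
suffix-lengths-≤ (x ∷ L) m (there m∈)  = m≤n⇒m≤1+n (suffix-lengths-≤ L m m∈)

endsAt-suffixes : ∀ {N} {r : Fin N} L → EndsAt r L → All (EndsAt r) (suffixes L)
endsAt-suffixes []      _              = []
endsAt-suffixes (x ∷ L) ([] , refl)     = ([] , refl) ∷ []
endsAt-suffixes (x ∷ L) (y ∷ L′ , refl) = (y ∷ L′ , refl) ∷ endsAt-suffixes L (L′ , refl)

pathLength-bound : ∀ {N} (D : Metric N) B → (∀ u v → dist D u v ≤ B) → ∀ xs → pathLength D xs ≤ length xs * B
pathLength-bound D B d≤B []           = z≤n
pathLength-bound D B d≤B (x ∷ [])     = z≤n
pathLength-bound D B d≤B (x ∷ y ∷ xs) = +-mono-≤ (d≤B x y) (pathLength-bound D B d≤B (y ∷ xs))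

module _ {N} (D : Metric N) where

  points≤clock : N ≤ length (clock D)
  points≤clock = ≤-trans (≤-reflexive (sym rows))
    (length≤concatOnto (map (spine ∘ encodeℕ) (distances D)) (spine (encodeMetric D)))
    where
    rows : length (spine (encodeMetric D)) ≡ N
    rows = trans (cong (length ∘ spine) (encodeMetric-encL D))
      (trans (cong length (spine-encL (encL encodeℕ) (tabulate λ i → tabulate (dist D i))))
      (trans (List.length-map (encL encodeℕ) (tabulate λ i → tabulate (dist D i)))
        (List.length-tabulate (λ i → tabulate (dist D i)))))

  len-dist≤clock : ∀ u v → len (dist D u v) ≤ length (clock D)
  len-dist≤clock u v = ≤-trans (≤-reflexive (sym digits)) (∈⇒length≤concatOnto (spine (encodeMetric D))
    (∈-map⁺ (spine ∘ encodeℕ) (∈∈-concatOnto (tabulate λ i → tabulate (dist D i)) []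
      (∈-tabulate⁺ v) (∈-tabulate⁺ {f = λ i → tabulate (dist D i)} u))))
    where
    digits : length (spine (encodeℕ (dist D u v))) ≡ len (dist D u v)
    digits = trans (cong (length ∘ spine) (encodeℕ-bits (dist D u v)))
      (trans (cong length (spine-encL encodeBool (bits (dist D u v))))
      (List.length-map encodeBool (bits (dist D u v))))

  -- At most `N ≤ 2 ^ κ` steps of length at most `2 ^ suc κ` each.
  pathLength≤2^clock : ∀ xs → length xs ≤ N → pathLength D xs ≤ 2 ^ (length (clock D) + suc (length (clock D)))
  pathLength≤2^clock xs xs≤N = ≤-trans (pathLength-bound D (2 ^ suc κ) dist≤ xs)
    (≤-trans (*-monoˡ-≤ (2 ^ suc κ) (≤-trans (≤-trans xs≤N points≤clock) (<⇒≤ (m<2^m κ))))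
      (≤-reflexive (sym (^-distribˡ-+-* 2 κ (suc κ)))))
    where
    κ : ℕ
    κ = length (clock D)
    dist≤ : ∀ u v → dist D u v ≤ 2 ^ suc κ
    dist≤ u v = ≤-trans (m≤n+m (dist D u v) 2) (≤-trans (<2^len (dist D u v)) (^-monoʳ-≤ 2 (s≤s (len-dist≤clock u v))))

module Analysis {ℓ} (M : MetricClass ℓ) (α : ℝ) (a H : ℕ) (solver : PolyTimeSegTSPApprox M (suc H) α) (q : ℕ)
  (I : TRP) (mI : M (TRP.metric I)) {_≼_ : ℕ → ℕ → Set} (scale : Scale _≼_)
  (≤ᴿ⇒≼ : ∀ {d l} → fromℕ d ≤ᴿ α *ᴿ fromℕ l → d ≼ l) where

  open TRP I renaming (metric to D; origin to r)
  open Algorithm M α (suc H) solver a q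
  open Run I mI

  private
    L₀ : List (Fin N)
    L₀ = absorb (allFin N) (r ∷ [])

  length-L₀ : length L₀ ≡ N
  length-L₀ = ≤-antisym (unique-length (unique-absorb (allFin N) ([] ∷ [])))
    (≤-trans (≤-reflexive (sym (length-allFin N))) (unique-⊆ (Unique.allFin⁺ N) (absorb-∈ (allFin N) (r ∷ []))))

  lengths-full : ∀ m → 1 ≤ m → m ≤ N → m ∈ map length table₀
  lengths-full m 1≤m m≤N = suffix-lengths L₀ m 1≤m (≤-trans m≤N (≤-reflexive (sym length-L₀)))

  open DP D r (map length table₀) lengths-full scale

  legal-table₀ : Legal table₀
  legal-table₀ = All.zip (proj₁ sound-table₀ , endsAt-suffixes L₀ (endsAt-absorb (allFin N) ([] , refl))) , refl

  legal-round₂ : ∀ le {tab} → Legal tab → Legal (round₂ le tab)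
  legal-round₂ le {tab} = foldTails-keep Legal (λ ne → process D r (candidate le ne)) countEntries
    (λ {ne} _ tab → legal-process (candidate le ne)) tab

  good-round₂ : ∀ le {m x tab} → Good m x tab → Good m x (round₂ le tab)
  good-round₂ le {m} {x} {tab} = foldTails-keep (Good m x) (λ ne → process D r (candidate le ne)) countEntries
    (λ {ne} _ tab → good-process (candidate le ne)) tab

  legal-round₁ : ∀ {tab} → Legal tab → Legal (round₁ tab)
  legal-round₁ {tab} = foldTails-keep Legal round₂ lengthEntries (λ {le} _ tab → legal-round₂ le) tab

  good-round₁ : ∀ {m x tab} → Good m x tab → Good m x (round₁ tab)
  good-round₁ {m} {x} {tab} = foldTails-keep (Good m x) round₂ lengthEntries (λ {le} _ tab → good-round₂ le) tab

  legal-iterate : ∀ k → Legal (iterate k round₁ table₀)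
  legal-iterate zero    = legal-table₀
  legal-iterate (suc k) = legal-round₁ (legal-iterate k)

  good-table : ∀ k {m x} → k ≤ horizon → Good m x (iterate k round₁ table₀) → Good m x table
  good-table k {m} {x} k≤ good = subst (Good m x) (sym (trans (foldTails-iterate round₁ (downFrom horizon) table₀)
    (cong (λ j → iterate j round₁ table₀) (List.length-downFrom horizon)))) (later (≤⇒≤′ k≤))
    where
    later : ∀ {j} → k ≤′ j → Good m x (iterate j round₁ table₀)
    later ≤′-refl     = good
    later (≤′-step h) = good-round₁ (later h)

  legal-table : Legal table
  legal-table = subst Legal (sym (foldTails-iterate round₁ (downFrom horizon) table₀))
    (legal-iterate (length (downFrom horizon)))

  -- Lengths decrease strictly along the table and never change, so the first entry is the only walk
  -- through all `N` points, and whatever is known of some complete walk in the table holds for it.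
  first-walk : Walk (first table) × length (first table) ≡ N × (∀ {x} → Good N x table → potential D r (first table) ≼ x)
  first-walk = go L₀ length-L₀ table legal-table
    where
    go : ∀ L → length L ≡ N → ∀ tab → All Walk tab × map length tab ≡ map length (suffixes L) →
      Walk (first tab) × length (first tab) ≡ N × (∀ {x} → Good N x tab → potential D r (first tab) ≼ x)
    go (i ∷ L) L≡N (W ∷ tab) (w ∷ _ , eq) = w , trans (List.∷-injectiveˡ eq) L≡N , best
      where
      best : ∀ {x} → Good N x (W ∷ tab) → potential D r W ≼ x
      best (V , here refl , _ , p)    = p
      best (V , there V∈ , N≤ , _) = contradiction (≤-trans N≤ (suffix-lengths-≤ L (length V)
        (subst (length V ∈_) (List.∷-injectiveʳ eq) (∈-map⁺ length V∈)))) (<⇒≱ (≤-reflexive L≡N))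

  module _ (ys : List (Fin N)) (unique : Unique (r ∷ ys)) (full : length (r ∷ ys) ≡ N) where

    open Windows a H I ys unique full

    private
      p Q : ℕ
      p = 2 ^ a
      Q = 3 ^ p
      l R : ℕ → ℕ
      l = threshold a
      R c = l (roundUp a (completion c))

    module _ (b m x : ℕ) (g : ℕ → ℕ)
      (near : ∀ c → c < N → m ≤ c → completion c ≤ l b → b ≤ roundUp a (completion c) + H)
      (limit≤ : ∀ c → c < N → m ≤ c → limit b c ≤ g c) where

      private
        Before After : Table N → Set
        Before tab = Legal tab × Good m x tab
        After      = Good (count N (l b)) (x + sumTo N g)

      module _ (le ne : Entry (suc (suc H))) (le≡ : ∀ h → vec le h ≡ lengthIndex b h)
        (ne≡ : ∀ h → vec ne h ≡ required b h) where

        candidate-hit : ∀ tab → Before tab → After (process D r (candidate le ne) tab)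
        candidate-hit tab (leg , good) = hit (answer-approx (segmented a I le ne) mI (window-feasible b le ne le≡ ne≡))
          where
          hit : ∃[ vs ] (answer (segmented a I le ne) mI ≡ encodePoints (tour (segmented a I le ne) vs) ×
            Meets (segmented a I le ne) (λ d l → fromℕ d ≤ᴿ α *ᴿ fromℕ l) (tour (segmented a I le ne) vs)) →
            After (process D r (candidate le ne) tab)
          hit (vs , y≡ , meetsᴿ) = subst (λ T → After (process D r T tab))
            (sym (trans (cong decode y≡) (decode-encodePoints T)))
            (process-hit T g leg good (tour-end b le ne le≡ ne≡ scale vs meets) (tour-visits b le ne le≡ ne≡ scale vs meets)
              (λ c c<N m≤c → Scale.≼-mono scale ≤-refl (tour-lag b le ne le≡ ne≡ scale vs meets c c<N (near c c<N m≤c))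
                (limit≤ c c<N m≤c)))
            where
            T : List (Fin N)
            T = tour (segmented a I le ne) vs
            meets : Meets (segmented a I le ne) _≼_ T
            meets = (λ h → proj₁ (proj₁ meetsᴿ h) , ≤ᴿ⇒≼ (proj₁ (proj₂ (proj₁ meetsᴿ h))) , proj₂ (proj₂ (proj₁ meetsᴿ h))) ,
              ≤ᴿ⇒≼ (proj₂ meetsᴿ)

        entries-hit : le ∈ lengthEntries → ne ∈ countEntries → ∀ tab → Before tab → After (round₁ tab)
        entries-hit le∈ ne∈ = foldTails-reach Before After round₂ lengthEntries le∈
          (λ {le} _ tab pre → legal-round₂ le (proj₁ pre) , good-round₂ le (proj₂ pre)) (λ {le} _ tab → good-round₂ le)
          (foldTails-reach Before After (λ ne → process D r (candidate le ne)) countEntries ne∈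
            (λ {ne} _ tab pre → legal-process (candidate le ne) (proj₁ pre) , good-process (candidate le ne) (proj₂ pre))
            (λ {ne} _ tab → good-process (candidate le ne))
            candidate-hit)

      -- Every round tries all enumerated pairs, so the pair of vectors belonging to `b` is among
      -- them. The hypothesis covers the largest length index, which is `p + b`.
      round-hit : p + b < horizon → ∀ tab → Legal tab → Good m x tab → After (round₁ tab)
      round-hit b< tab leg good = go
        (∈-enumerate horizon (suc (suc H)) (lengthIndex b) (lengthIndex-mono b) (λ h → ≤-trans (s≤s (lengthIndex-≤ b h)) b<))
        (∈-enumerate (suc N) (suc (suc H)) (required b) (required-mono b) (λ h → s≤s (required-≤ b h)))
        where
        go : ∃[ le ] (le ∈ lengthEntries × (∀ h → vec le h ≡ lengthIndex b h) × _) →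
          ∃[ ne ] (ne ∈ countEntries × (∀ h → vec ne h ≡ required b h) × _) → After (round₁ tab)
        go (le , le∈ , le≡ , _) (ne , ne∈ , ne≡ , _) = entries-hit le ne le≡ ne≡ le∈ ne∈ tab (leg , good)

    module _ (s : ℕ) (s<H : s < H) where

      boundary : ℕ → ℕ
      boundary j = suc (j * H + s)

      -- What the point with index c has cost by the end of window j: its rounded completion time, once it is reached, and Q
      -- times every boundary threshold that was passed before.
      charge : ℕ → ℕ → ℕ
      charge j c = when (completion c ≤? l (boundary j)) (R c) + Q * sumTo (suc j) (λ i → pending a (completion c) (boundary i))

      limit≤pending : ∀ b c → 1 ≤ b → limit b c ≤ when (completion c ≤? l b) (R c) + Q * pending a (completion c) b
      limit≤pending b c 1≤b with completion c ≤? l b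
      ... | yes _ = m≤m+n _ _
      ... | no  _ = threshold-triple a b p 1≤b

      -- Induction over the windows, one round for each. Indices below the count at boundary `j` are
      -- settled and cause no cost in window `suc j`; all others have completion times beyond that
      -- boundary, hence within the reach of the next window.
      chain : ∀ j → p + boundary j < horizon → Good (count N (l (boundary j))) (sumTo N (charge j))
        (iterate (suc j) round₁ table₀)
      -- The first boundary is `suc s ≤ H`, so the first window reaches down to index 0. It starts
      -- from the walk that consists of the origin alone.
      chain zero b< = round-hit (boundary 0) 0 0 (charge 0) (λ c _ _ _ → ≤-trans s<H (m≤n+m H _))
        (λ c _ _ → limit≤pending (boundary 0) c (s≤s z≤n)) b< table₀ legal-table₀ start
        where
        start : Good 0 0 table₀
        start with suffix-lengths L₀ 1 ≤-refl (≤-trans (s≤s z≤n) (≤-reflexive (sym length-L₀)))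
        ... | 1∈ with ∈-map⁻ length 1∈
        ...   | W , W∈ , eq = W , W∈ , z≤n , Scale.≼-mono scale
          (≤-reflexive (single W eq (proj₂ (All.lookup (proj₁ legal-table₀) W∈)))) (Scale.≼-zero scale) z≤n
          where
          single : ∀ W → 1 ≡ length W → EndsAt r W → potential D r W ≡ 0
          single (x ∷ []) _ ([] , refl)        = trans (+-identityʳ _) (trans (cong (n *_) (dist-ii D r)) (*-zeroʳ n))
          single (x ∷ []) _ (_ ∷ [] , ())
          single (x ∷ []) _ (_ ∷ _ ∷ _ , ())
      chain (suc j) b< = widen (round-hit (boundary (suc j)) (count N (l (boundary j))) (sumTo N (charge j)) new near new≥ b<
          (iterate (suc j) round₁ table₀) (legal-iterate (suc j)) (chain j (≤-trans (s≤s (+-monoʳ-≤ p boundary≤)) b<)))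
        where
        boundary≤ : boundary j ≤ boundary (suc j)
        boundary≤ = s≤s (+-monoˡ-≤ s (m≤n+m (j * H) H))
        -- Zero for a finished point keeps its earlier charge final; an unfinished point has so far
        -- paid only for restarts.
        new : ℕ → ℕ
        new c = unless (completion c ≤? l (boundary j)) (limit (boundary (suc j)) c)
        unfinished : ∀ c → c < N → count N (l (boundary j)) ≤ c → ¬ (completion c ≤ l (boundary j))
        unfinished c c<N ≤c C≤ = contradiction (count> N (l (boundary j)) c c<N C≤) (≤⇒≯ ≤c)
        new≥ : ∀ c → c < N → count N (l (boundary j)) ≤ c → limit (boundary (suc j)) c ≤ new c
        new≥ c c<N ≤c with completion c ≤? l (boundary j)
        ... | yes C≤ = contradiction C≤ (unfinished c c<N ≤c)
        ... | no  _  = ≤-refl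
        near : ∀ c → c < N → count N (l (boundary j)) ≤ c → completion c ≤ l (boundary (suc j)) →
          boundary (suc j) ≤ roundUp a (completion c) + H
        near c c<N ≤c _ = ≤-trans (≤-reflexive (lemma H (j * H) s))
          (+-monoˡ-≤ H (<⇒≤ (roundUp-> a {completion c} {boundary j} (unfinished c c<N ≤c))))
          where
          lemma : ∀ h jh s → suc (h + jh + s) ≡ suc (jh + s) + h
          lemma = solve-∀
        pend : ℕ → ℕ → ℕ
        pend c i = pending a (completion c) (boundary i)
        pay : ∀ c t (d : Dec (completion c ≤ l (boundary j))) → when d (R c) + Q * t + unless d (limit (boundary (suc j)) c) ≤
          when (completion c ≤? l (boundary (suc j))) (R c) + Q * (t + pend c (suc j))
        pay c t (yes C≤) = ≤-trans (≤-reflexive (+-identityʳ _)) (+-mono-≤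
          (≤-reflexive (sym (when-yes (completion c ≤? l (boundary (suc j))) (≤-trans C≤ (threshold-mono a boundary≤)))))
          (*-monoʳ-≤ Q (m≤m+n t (pend c (suc j)))))
        pay c t (no _)   = ≤-trans (+-monoʳ-≤ (Q * t) (limit≤pending (boundary (suc j)) c (s≤s z≤n)))
          (≤-reflexive (lemma Q t (when (completion c ≤? l (boundary (suc j))) (R c)) (pend c (suc j))))
          where
          lemma : ∀ q s w t → q * s + (w + q * t) ≡ w + q * (s + t)
          lemma = solve-∀
        paid : ∀ c → charge j c + new c ≤ charge (suc j) c
        paid c = pay c (sumTo (suc j) (pend c)) (completion c ≤? l (boundary j))
        widen : ∀ {m tab} → Good m (sumTo N (charge j) + sumTo N new) tab → Good m (sumTo N (charge (suc j))) tab
        widen (W , W∈ , m≤ , p) = W , W∈ , m≤ , Scale.≼-mono scale ≤-refl p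
          (≤-trans (≤-reflexive (sym (sumTo-+ N (charge j) new))) (sumTo-mono N (λ c _ → paid c)))

-- Choice of the offset and total cost

when-≤ : ∀ {P : Set} (d : Dec P) x → when d x ≤ x
when-≤ (yes _) x = ≤-refl
when-≤ (no _)  x = z≤n

module Estimate {ℓ} (M : MetricClass ℓ) (α : ℝ) (a H : ℕ) (solver : PolyTimeSegTSPApprox M (suc H) α) (q : ℕ)
  (I : TRP) (mI : M (TRP.metric I)) {_≼_ : ℕ → ℕ → Set} (scale : Scale _≼_)
  (≤ᴿ⇒≼ : ∀ {d l} → fromℕ d ≤ᴿ α *ᴿ fromℕ l → d ≼ l)
  (ys : List (Fin (suc (TRP.n I)))) (unique : Unique (TRP.origin I ∷ ys)) (full : length (TRP.origin I ∷ ys) ≡ suc (TRP.n I))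
  (H≡ : H ≡ suc (2 ^ a) * (2 ^ a * 3 ^ (2 ^ a))) (q≡ : q ≡ 2 ^ a + 4 * (2 ^ a * H) + H) where

  open TRP I renaming (metric to D; origin to r)
  open Algorithm M α (suc H) solver a q using (module Run)
  open Run I mI using (N; horizon; table)
  open Windows a H I ys unique full using (completion; count; count>)
  open Analysis M α a H solver q I mI scale ≤ᴿ⇒≼ using (first-walk; good-table; chain; charge)

  private
    p Q κ E : ℕ
    p = 2 ^ a
    Q = 3 ^ p
    κ = length (clock D)
    -- By `threshold-exp`, the threshold with this index is at least `2 ^ (κ + suc κ)`, the bound on
    -- path lengths in terms of the clock.
    E = suc (κ + suc κ) * p

    H≥1 : 1 ≤ H
    H≥1 = ≤-trans (*-mono-≤ (s≤s (z≤n {p})) (*-mono-≤ (m^n>0 2 a) (m^n>0 3 p))) (≤-reflexive (sym H≡))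

    κ≥1 : 1 ≤ κ
    κ≥1 = ≤-trans (s≤s z≤n) (points≤clock D)

  -- The boundary indices for offset s; the offset is chosen by averaging over s < H.
  index : ℕ → ℕ → ℕ
  index s j = suc (j * H + s)

  E≤index : ∀ s → E ≤ index s E
  E≤index s = ≤-trans (m≤m*n E H {{>-nonZero H≥1}}) (≤-trans (m≤m+n (E * H) s) (n≤1+n _))

  -- This dictates `q`. For each element of the clock, `p` serves the extra length index,
  -- `4 * (p * H)` the product `E * H` since `2κ + 2 ≤ 4κ`, and `H` the offset.
  index<horizon : ∀ s → s < H → p + index s E < horizon
  index<horizon s s<H = s≤s (begin
      p + suc (E * H + s)
        ≡⟨ lemma₁ p (E * H) s ⟩
      p + E * H + suc s
        ≤⟨ +-mono-≤ (+-monoʳ-≤ p (*-monoˡ-≤ H (*-monoˡ-≤ p 2+2κ≤))) s<H ⟩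
      p + 4 * κ * p * H + H
        ≤⟨ +-mono-≤ (+-monoˡ-≤ (4 * κ * p * H) (m≤n*m p κ {{>-nonZero κ≥1}})) (m≤n*m H κ {{>-nonZero κ≥1}}) ⟩
      κ * p + 4 * κ * p * H + κ * H
        ≡⟨ lemma₂ κ p H ⟩
      κ * (p + 4 * (p * H) + H)
        ≡⟨ cong (κ *_) (sym q≡) ⟩
      κ * q ∎)
    where
    open ≤-Reasoning
    lemma₁ : ∀ p e s → p + suc (e + s) ≡ p + e + suc s
    lemma₁ = solve-∀
    lemma₂ : ∀ k p h → k * p + 4 * k * p * h + k * h ≡ k * (p + 4 * (p * h) + h)
    lemma₂ = solve-∀
    lemma₃ : ∀ k → suc (k + suc k) ≡ 2 * 1 + 2 * k
    lemma₃ = solve-∀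
    lemma₄ : ∀ k → 2 * k + 2 * k ≡ 4 * k
    lemma₄ = solve-∀
    2+2κ≤ : suc (κ + suc κ) ≤ 4 * κ
    2+2κ≤ = ≤-trans (≤-reflexive (lemma₃ κ)) (≤-trans (+-monoˡ-≤ (2 * κ) (*-monoʳ-≤ 2 κ≥1)) (≤-reflexive (lemma₄ κ)))

  finished : ∀ s → N ≤ count N (threshold a (index s E))
  finished s = count> N (threshold a (index s E)) n ≤-refl
    (≤-trans (≤-trans (pathLength-take D N N (r ∷ ys) ≤-refl)
      (pathLength≤2^clock D (take N (r ∷ ys)) (≤-trans (≤-reflexive (List.length-take N (r ∷ ys))) (m⊓n≤m N _))))
      (≤-trans (threshold-exp a (κ + suc κ)) (threshold-mono a (E≤index s))))

  total : ℕ
  total = sumTo N completion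

  overhead : ℕ → ℕ
  overhead s = sumTo N (λ c → sumTo (suc E) (λ i → pending a (completion c) (index s i)))

  -- After exchanging sums, a single point meets each boundary index once over all offsets and
  -- windows, and `pending-sum` applies to it.
  overhead-sum : sumTo H overhead ≤ suc p * total
  overhead-sum = begin
    sumTo H overhead
      ≡⟨ sumTo-swap H N (λ s c → sumTo (suc E) (λ i → pending a (completion c) (index s i))) ⟩
    sumTo N (λ c → sumTo H (λ s → sumTo (suc E) (λ i → pending a (completion c) (index s i))))
      ≤⟨ sumTo-mono N (λ c _ → ≤-trans (≤-reflexive (sumTo-blocks H (suc E) (λ i → pending a (completion c) (suc i))))
           (pending-sum a (completion c) (suc E * H))) ⟩
    sumTo N (λ c → suc p * completion c)
      ≡⟨ sumTo-* N (suc p) completion ⟩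
    suc p * total ∎
    where open ≤-Reasoning

  rounded : ℕ → ℕ
  rounded c = threshold a (roundUp a (completion c))

  charge-sum : ∀ s (s<H : s < H) → H * overhead s ≤ suc p * total →
    p * sumTo N (charge ys unique full s s<H E) ≤ (2 + p) * total
  charge-sum s s<H few = begin
    p * sumTo N (charge ys unique full s s<H E)
      ≤⟨ *-monoʳ-≤ p (sumTo-mono N (λ c _ → +-monoˡ-≤ (Q * late c)
        (when-≤ (completion c ≤? threshold a (index s E)) (rounded c)))) ⟩
    p * sumTo N (λ c → rounded c + Q * late c)
      ≡⟨ cong (p *_) (trans (sumTo-+ N rounded (λ c → Q * late c)) (cong (sumTo N rounded +_) (sumTo-* N Q late))) ⟩
    p * (sumTo N rounded + Q * overhead s)
      ≡⟨ trans (*-distribˡ-+ p (sumTo N rounded) _) (cong₂ _+_ (sym (sumTo-* N p rounded)) (sym (*-assoc p Q (overhead s)))) ⟩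
    sumTo N (λ c → p * rounded c) + p * Q * overhead s
      ≤⟨ +-mono-≤ (sumTo-mono N (λ c _ → search-upper a (completion c) (completion c))) cheap ⟩
    sumTo N (λ c → suc p * completion c) + total
      ≡⟨ cong (_+ total) (sumTo-* N (suc p) completion) ⟩
    suc p * total + total
      ≡⟨ +-comm (suc p * total) total ⟩
    (2 + p) * total ∎
    where
    open ≤-Reasoning
    late : ℕ → ℕ
    late c = sumTo (suc E) (λ i → pending a (completion c) (index s i))
    cheap : p * Q * overhead s ≤ total
    -- `H` is `suc p * (p * Q)` for the sake of this cancellation: `suc p` comes from the geometric
    -- sum, `Q` from the restarts, and `p` makes the overhead a p-th of the total.
    cheap = *-cancelˡ-≤ (suc p) (≤-trans
      (≤-reflexive (sym (trans (cong (_* overhead s) H≡) (*-assoc (suc p) (p * Q) (overhead s))))) few)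

  estimate : ∃[ X ] (potential D r (first table) ≼ X × p * X ≤ (2 + p) * total)
  estimate = go (pigeonhole-sum H {{>-nonZero H≥1}} overhead)
    where
    go : ∃[ s ] (s < H × H * overhead s ≤ sumTo H overhead) → ∃[ X ] (potential D r (first table) ≼ X × p * X ≤ (2 + p) * total)
    go (s , s<H , few) = sumTo N (charge ys unique full s s<H E) ,
      proj₂ (proj₂ first-walk) (widen
        (good-table (suc E) (≤-trans (s≤s (≤-trans (E≤index s) (m≤n+m (index s E) p))) (index<horizon s s<H))
        (chain ys unique full s s<H E (index<horizon s s<H)))) ,
      charge-sum s s<H (≤-trans few overhead-sum)
      where
      widen : ∃[ W ] (W ∈ table × count N (threshold a (index s E)) ≤ length W × potential D r W ≼ sumTo N
        (charge ys unique full s s<H E)) →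
        ∃[ W ] (W ∈ table × N ≤ length W × potential D r W ≼ sumTo N (charge ys unique full s s<H E))
      widen (W , W∈ , ≤W , p) = W , W∈ , ≤-trans (finished s) ≤W , p

-- Real factors

ι : ℕ → ℚ
ι n = ℤ.+ n ℚ./ 1

toℚᵘ-ι : ∀ n → ℚ.toℚᵘ (ι n) ℚᵘ.≃ ℚᵘ.mkℚᵘ (ℤ.+ n) 0
toℚᵘ-ι n = ℚ.toℚᵘ-fromℚᵘ (ℚᵘ.mkℚᵘ (ℤ.+ n) 0)

ι-+ : ∀ m n → ι (m + n) ≡ ι m ℚ.+ ι n
ι-+ m n = ℚ.toℚᵘ-injective (ℚᵘ.≃-trans (toℚᵘ-ι (m + n)) (ℚᵘ.≃-trans
  (ℚᵘ.*≡* (cong (ℤ._* ℤ.1ℤ) (trans (ℤ.pos-+ m n) (sym (cong₂ ℤ._+_ (ℤ.*-identityʳ (ℤ.+ m)) (ℤ.*-identityʳ (ℤ.+ n)))))))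
  (ℚᵘ.≃-sym (ℚᵘ.≃-trans (ℚ.toℚᵘ-homo-+ (ι m) (ι n)) (ℚᵘ.+-cong (toℚᵘ-ι m) (toℚᵘ-ι n))))))

ι-* : ∀ m n → ι (m * n) ≡ ι m ℚ.* ι n
ι-* m n = ℚ.toℚᵘ-injective (ℚᵘ.≃-trans (toℚᵘ-ι (m * n)) (ℚᵘ.≃-trans
  (ℚᵘ.*≡* (cong (ℤ._* ℤ.1ℤ) (ℤ.pos-* m n)))
  (ℚᵘ.≃-sym (ℚᵘ.≃-trans (ℚ.toℚᵘ-homo-* (ι m) (ι n)) (ℚᵘ.*-cong (toℚᵘ-ι m) (toℚᵘ-ι n))))))

ι-mono : ∀ {m n} → m ≤ n → ι m ℚ.≤ ι n
ι-mono {m} {n} m≤n = ℚ.toℚᵘ-cancel-≤ (ℚᵘ.≤-respˡ-≃ (ℚᵘ.≃-sym (toℚᵘ-ι m)) (ℚᵘ.≤-respʳ-≃ (ℚᵘ.≃-sym (toℚᵘ-ι n))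
  (ℚᵘ.*≤* (ℤ.*-monoʳ-≤-nonNeg ℤ.1ℤ (ℤ.+≤+ m≤n)))))

-- Multiplied by its denominator, a rational becomes its numerator, and a positive numerator is at
-- least 1.
archimedean : ∀ δ → ℚ.0ℚ ℚ.< δ → ι 1 ℚ.≤ δ ℚ.* ι (ℚ.denominatorℕ δ)
archimedean δ@(ℚ.mkℚ (ℤ.+ 0) d _) (ℚ.*<* (ℤ.+<+ ()))
archimedean δ@(ℚ.mkℚ (ℤ.+ suc k) d _) _ = ℚ.≤-trans (ι-mono (s≤s (z≤n {k}))) (ℚ.≤-reflexive (ℚ.toℚᵘ-injective
  (ℚᵘ.≃-trans (toℚᵘ-ι (suc k)) (ℚᵘ.≃-trans
    (ℚᵘ.*≡* (trans (cong (λ e → ℤ.+ suc k ℤ.* ℤ.+ e) (*-identityʳ (suc d))) (sym (ℤ.*-identityʳ _))))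
    (ℚᵘ.≃-sym (ℚᵘ.≃-trans (ℚ.toℚᵘ-homo-* δ (ι (suc d))) (ℚᵘ.*-cong (ℚᵘ.≃-refl {ℚ.toℚᵘ δ}) (toℚᵘ-ι (suc d)))))))))
archimedean (ℚ.mkℚ (ℤ.-[1+ k ]) d _) (ℚ.*<* ())

power-archimedean : ∀ δ → ℚ.0ℚ ℚ.< δ → ι 2 ℚ.≤ δ ℚ.* ι (2 ^ (ℚ.denominatorℕ δ * 2))
power-archimedean δ 0<δ = begin
  ι 2
    ≡⟨ sym (ℚ.*-identityˡ (ι 2)) ⟩
  ι 1 ℚ.* ι 2
    ≤⟨ ℚ.*-monoʳ-≤-nonNeg (ι 2) (archimedean δ 0<δ) ⟩
  δ ℚ.* ι d ℚ.* ι 2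
    ≡⟨ trans (ℚ.*-assoc δ (ι d) (ι 2)) (cong (δ ℚ.*_) (sym (ι-* d 2))) ⟩
  δ ℚ.* ι (d * 2)
    ≤⟨ ℚ.*-monoˡ-≤-nonNeg δ {{ℚ.pos⇒nonNeg δ {{ℚ.positive 0<δ}}}} (ι-mono (<⇒≤ (m<2^m (d * 2)))) ⟩
  δ ℚ.* ι (2 ^ (d * 2)) ∎
  where
  open ℚ.≤-Reasoning
  d : ℕ
  d = ℚ.denominatorℕ δ

module _ (α : ℝ) (1≤α : 1ᴿ ≤ᴿ α) where

  -- Holds only from some term on: `1 ≤ α` is used with tolerance one half. Multiplying inequalities
  -- by terms of α requires it.
  α-nonNeg : ∃[ N ] (∀ n → N ≤ n → ℚ.NonNegative (seq α n))
  α-nonNeg with 1≤α ℚ.½ (ℚ.positive⁻¹ ℚ.½)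
  ... | N , 1≤ = N , λ n N≤n → ℚ.nonNegative (begin
      ℚ.0ℚ                            ≤⟨ ℚ.<⇒≤ (ℚ.positive⁻¹ ℚ.½) ⟩
      ι 1 ℚ.- ℚ.½                     ≤⟨ ℚ.+-monoˡ-≤ (ℚ.- ℚ.½) (1≤ n N≤n) ⟩
      (seq α n ℚ.+ ℚ.½) ℚ.- ℚ.½       ≡⟨ ℚ.+-assoc (seq α n) ℚ.½ (ℚ.- ℚ.½) ⟩
      seq α n ℚ.+ ℚ.0ℚ                ≡⟨ ℚ.+-identityʳ (seq α n) ⟩
      seq α n                         ∎)
    where open ℚ.≤-Reasoning

  α-scale : Scale (λ d l → fromℕ d ≤ᴿ α *ᴿ fromℕ l)
  α-scale = record { ≼-zero = zero-within ; ≼-+ = λ {d} {e} {l} {m} → +-within {d} {e} {l} {m} ; ≼-mono =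
    λ {d} {d′} {l} {l′} → mono-within {d} {d′} {l} {l′} }
    where
    open ℚ.≤-Reasoning
    zero-within : fromℕ 0 ≤ᴿ α *ᴿ fromℕ 0
    zero-within δ 0<δ = 0 , λ n _ → ℚ.≤-trans (ℚ.<⇒≤ 0<δ)
      (ℚ.≤-reflexive (sym (trans (cong (ℚ._+ δ) (ℚ.*-zeroʳ (seq α n))) (ℚ.+-identityˡ δ))))
    +-within : ∀ {d e l m} → fromℕ d ≤ᴿ α *ᴿ fromℕ l → fromℕ e ≤ᴿ α *ᴿ fromℕ m → fromℕ (d + e) ≤ᴿ α *ᴿ fromℕ (l + m)
    +-within {d} {e} {l} {m} d≤ e≤ δ 0<δ = proj₁ (d≤ h 0<h) + proj₁ (e≤ h 0<h) , λ n N≤n → begin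
        ι (d + e)
          ≡⟨ ι-+ d e ⟩
        ι d ℚ.+ ι e
          ≤⟨ ℚ.+-mono-≤ (proj₂ (d≤ h 0<h) n (≤-trans (m≤m+n _ _) N≤n)) (proj₂ (e≤ h 0<h) n (≤-trans (m≤n+m _ _) N≤n)) ⟩
        (seq α n ℚ.* ι l ℚ.+ h) ℚ.+ (seq α n ℚ.* ι m ℚ.+ h)
          ≡⟨ collect (seq α n) (ι l) (ι m) h ⟩
        seq α n ℚ.* (ι l ℚ.+ ι m) ℚ.+ (h ℚ.+ h)
          ≡⟨ cong₂ (λ s t → seq α n ℚ.* s ℚ.+ t) (sym (ι-+ l m)) halves ⟩
        seq α n ℚ.* ι (l + m) ℚ.+ δ ∎
      where
      h : ℚ
      h = ℚ.½ ℚ.* δ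
      0<h : ℚ.0ℚ ℚ.< h
      0<h = ℚ.positive⁻¹ h {{ℚ.pos*pos⇒pos ℚ.½ δ {{ℚ.positive 0<δ}}}}
      halves : h ℚ.+ h ≡ δ
      halves = trans (sym (ℚ.*-distribʳ-+ δ ℚ.½ ℚ.½)) (ℚ.*-identityˡ δ)
      collect : ∀ a l m h → (a ℚ.* l ℚ.+ h) ℚ.+ (a ℚ.* m ℚ.+ h) ≡ a ℚ.* (l ℚ.+ m) ℚ.+ (h ℚ.+ h)
      collect = +-*-Solver.solve 4 (λ a l m h → (a :* l :+ h) :+ (a :* m :+ h) := a :* (l :+ m) :+ (h :+ h)) refl
        where open +-*-Solver
    mono-within : ∀ {d d′ l l′} → d′ ≤ d → fromℕ d ≤ᴿ α *ᴿ fromℕ l → l ≤ l′ → fromℕ d′ ≤ᴿ α *ᴿ fromℕ l′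
    mono-within {d} {d′} {l} {l′} d′≤d d≤ l≤l′ δ 0<δ = proj₁ (d≤ δ 0<δ) + proj₁ α-nonNeg , λ n N≤n → begin
        ι d′                        ≤⟨ ι-mono d′≤d ⟩
        ι d                         ≤⟨ proj₂ (d≤ δ 0<δ) n (≤-trans (m≤m+n _ _) N≤n) ⟩
        seq α n ℚ.* ι l ℚ.+ δ       ≤⟨ ℚ.+-monoˡ-≤ δ
          (ℚ.*-monoˡ-≤-nonNeg (seq α n) {{proj₂ α-nonNeg n (≤-trans (m≤n+m _ _) N≤n)}} (ι-mono l≤l′)) ⟩
        seq α n ℚ.* ι l′ ℚ.+ δ      ∎

  -- The factor 1 + 2/p is at most 1 + δ; everything is multiplied by `p` to avoid division.
  ratio-≤ : ∀ p .{{_ : NonZero p}} δ X W → p * X ≤ (2 + p) * W → ι 2 ℚ.≤ δ ℚ.* ι p → ι X ℚ.≤ (ℚ.1ℚ ℚ.+ δ) ℚ.* ι W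
  ratio-≤ p@(suc _) δ X W pX≤ 2≤ = ℚ.*-cancelˡ-≤-pos
    (ι p) {{ℚ.positive (ℚ.<-≤-trans (ℚ.positive⁻¹ (ι 1)) (ι-mono {1} {p} (s≤s z≤n)))}} (begin
      ι p ℚ.* ι X
        ≡⟨ sym (ι-* p X) ⟩
      ι (p * X)
        ≤⟨ ι-mono pX≤ ⟩
      ι ((2 + p) * W)
        ≡⟨ trans (ι-* (2 + p) W) (cong (ℚ._* ι W) (ι-+ 2 p)) ⟩
      (ι 2 ℚ.+ ι p) ℚ.* ι W
        ≤⟨ ℚ.*-monoʳ-≤-nonNeg (ι W) {{ℚ.nonNegative (ι-mono {0} {W} z≤n)}} (ℚ.+-monoˡ-≤ (ι p) 2≤) ⟩
      (δ ℚ.* ι p ℚ.+ ι p) ℚ.* ι W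
        ≡⟨ collect δ (ι p) (ι W) ⟩
      ι p ℚ.* ((ℚ.1ℚ ℚ.+ δ) ℚ.* ι W) ∎)
    where
    open ℚ.≤-Reasoning
    collect : ∀ d p w → (d ℚ.* p ℚ.+ p) ℚ.* w ≡ p ℚ.* ((ℚ.1ℚ ℚ.+ d) ℚ.* w)
    collect = +-*-Solver.solve 3 (λ d p w → (d :* p :+ p) :* w := p :* ((con ℚ.1ℚ :+ d) :* w)) refl
      where open +-*-Solver using (_:*_; _:+_; _:=_; con)

  -- The witness of `0 < ε` is a rational `δ` below all late terms of ε, so the rational estimate
  -- can be applied term by term.
  ratio-within : ∀ p .{{_ : NonZero p}} V X W ε δ N → (∀ n → N ≤ n → ι 0 ℚ.+ δ ℚ.≤ seq ε n) → ι 2 ℚ.≤ δ ℚ.* ι p →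
    fromℕ V ≤ᴿ α *ᴿ fromℕ X → p * X ≤ (2 + p) * W → fromℕ V ≤ᴿ (α *ᴿ (1ᴿ +ᴿ ε)) *ᴿ fromℕ W
  ratio-within p V X W ε δ N δ≤ε 2≤ V≤ pX≤ η 0<η = proj₁ (V≤ η 0<η) + (proj₁ α-nonNeg + N) , λ n N≤n → begin
      ι V
        ≤⟨ proj₂ (V≤ η 0<η) n (≤-trans (m≤m+n _ _) N≤n) ⟩
      seq α n ℚ.* ι X ℚ.+ η
        ≤⟨ ℚ.+-monoˡ-≤ η (ℚ.*-monoˡ-≤-nonNeg
          (seq α n) {{proj₂ α-nonNeg n (≤-trans (≤-trans (m≤m+n A N) (m≤n+m (A + N) B)) N≤n)}}
             (ℚ.≤-trans (ratio-≤ p δ X W pX≤ 2≤) (ℚ.*-monoʳ-≤-nonNeg (ι W) {{ℚ.nonNegative (ι-mono {0} {W} z≤n)}}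
               (ℚ.+-monoʳ-≤ (ι 1) (ℚ.≤-trans (ℚ.≤-reflexive (sym (ℚ.+-identityˡ δ)))
                 (δ≤ε n (≤-trans (≤-trans (m≤n+m N A) (m≤n+m (A + N) B)) N≤n))))))) ⟩
      seq α n ℚ.* ((ι 1 ℚ.+ seq ε n) ℚ.* ι W) ℚ.+ η
        ≡⟨ cong (ℚ._+ η) (sym (ℚ.*-assoc (seq α n) (ι 1 ℚ.+ seq ε n) (ι W))) ⟩
      seq α n ℚ.* (ι 1 ℚ.+ seq ε n) ℚ.* ι W ℚ.+ η ∎
    where
    open ℚ.≤-Reasoning
    A B : ℕ
    A = proj₁ α-nonNeg
    B = proj₁ (V≤ η 0<η)

-- Comparison with a solution and assembly of the algorithm

module _ (I : TRP) (Π : Solution I) where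

  open TRP I renaming (metric to D; origin to r)
  open Solution

  private
    N : ℕ
    N = suc n

  otherStops : List (Fin N)
  otherStops = tabulate (λ i → perm Π ⟨$⟩ʳ Fin.suc i)

  stops≡sequence : r ∷ otherStops ≡ sequence Π
  stops≡sequence = cong (_∷ otherStops) (sym (starts-at-r Π))

  stops-unique : Unique (r ∷ otherStops)
  stops-unique = subst Unique (sym stops≡sequence)
    (Unique.tabulate⁺ (λ eq → trans (sym (inverseˡ (perm Π))) (trans (cong (perm Π ⟨$⟩ˡ_) eq) (inverseˡ (perm Π)))))

  stops-full : length (r ∷ otherStops) ≡ N
  stops-full = cong suc (List.length-tabulate (λ i → perm Π ⟨$⟩ʳ Fin.suc i))

  stops-total : sumTo N (λ c → pathLength D (take (suc c) (r ∷ otherStops))) ≡ value Π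
  stops-total = trans (cong (λ m → sumTo m (λ c → pathLength D (take (suc c) (r ∷ otherStops)))) (sym stops-full))
    (trans (cong (completionSum D) stops≡sequence) (sym (sequence-value I Π)))

size≥1 : ∀ t → 1 ≤ size t
size≥1 nil     = ≤-refl
size≥1 (s ∙ t) = s≤s z≤n

polyTimeSolvable : ∀ {ℓ} {I : Set} {encode : I → Tree} {Dom : I → Set ℓ} {Correct : I → Tree → Set} P →
  (∀ i → Dom i → ∃[ y ] ((P ∶ encode i ⇒ y) × Correct i y)) → PolyTimeSolvable encode Dom Correct
polyTimeSolvable {I = I} {encode} {Dom} {Correct} P solve = code P , proj₁ B * 2 ^ proj₁ (proj₂ B) , proj₁
  (proj₂ B) , λ i dom → result i (solve i dom)
  where
  B : ∃[ c ] ∃[ e ] (∀ n → cost P ⟨ n ⟩ ≤ c * suc n ^ e)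
  B = poly-bound (cost P)
  c e : ℕ
  c = proj₁ B
  e = proj₁ (proj₂ B)
  bound : ∀ t → cost P ⟨ depth t ⟩ ≤ c * 2 ^ e * size t ^ e
  bound t = begin
    cost P ⟨ depth t ⟩          ≤⟨ poly-mono (cost P) (depth≤size t) ⟩
    cost P ⟨ size t ⟩           ≤⟨ proj₂ (proj₂ B) (size t) ⟩
    c * suc (size t) ^ e        ≤⟨ *-monoʳ-≤ c
      (^-monoˡ-≤ e (≤-trans (+-monoˡ-≤ (size t) (size≥1 t)) (≤-reflexive (cong (size t +_) (sym (+-identityʳ (size t))))))) ⟩
    c * (2 * size t) ^ e        ≡⟨ cong (c *_) (^-distribʳ-* e 2 (size t)) ⟩
    c * (2 ^ e * size t ^ e)    ≡⟨ sym (*-assoc c (2 ^ e) (size t ^ e)) ⟩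
    c * 2 ^ e * size t ^ e      ∎
    where open ≤-Reasoning
  result : ∀ i → ∃[ y ] ((P ∶ encode i ⇒ y) × Correct i y) →
    ∃[ y ] ∃[ t ] (⟦ code P ⟧ encode i ⇓ y within t × t ≤ c * 2 ^ e * size (encode i) ^ e × Correct i y)
  result i (y , runs {t} r t≤ , correct) = y , t , r , ≤-trans t≤ (bound (encode i)) , correct

module Reduction {ℓ} (M : MetricClass ℓ) (α : ℝ) (1≤α : 1ᴿ ≤ᴿ α) (ε : ℝ) (δ : ℚ) (n₀ : ℕ)
  (δ≤ε : ∀ n → n₀ ≤ n → ι 0 ℚ.+ δ ℚ.≤ seq ε n)
  (a H q : ℕ) (2≤δp : ι 2 ℚ.≤ δ ℚ.* ι (2 ^ a))
  (H≡ : H ≡ suc (2 ^ a) * (2 ^ a * 3 ^ (2 ^ a))) (q≡ : q ≡ 2 ^ a + 4 * (2 ^ a * H) + H)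
  (solver : PolyTimeSegTSPApprox M (suc H) α) where

  open Algorithm M α (suc H) solver a q using (mainProg; module Run)

  module _ (I : TRP) (mI : M (TRP.metric I)) where

    open TRP I using () renaming (metric to D; origin to r)
    open Run I mI using (table; main-⇒)
    open Analysis M α a H solver q I mI (α-scale α 1≤α) id using (first-walk)

    tourSolution : Solution I
    tourSolution = walkSolution I (first table) (proj₁ (proj₁ first-walk)) (proj₁ (proj₂ first-walk)) (proj₂ (proj₁ first-walk))

    approximates : ∀ Π → fromℕ (Solution.value tourSolution) ≤ᴿ (α *ᴿ (1ᴿ +ᴿ ε)) *ᴿ fromℕ (Solution.value Π)
    approximates Π = finish estimate
      where
      open Estimate M α a H solver q I mI (α-scale α 1≤α) id (otherStops I Π) (stops-unique I Π)
        (stops-full I Π) H≡ q≡ using (estimate; total)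
      finish : ∃[ X ] (fromℕ (potential D r (first table)) ≤ᴿ α *ᴿ fromℕ X × 2 ^ a * X ≤ (2 + 2 ^ a) * total) →
        fromℕ (Solution.value tourSolution) ≤ᴿ (α *ᴿ (1ᴿ +ᴿ ε)) *ᴿ fromℕ (Solution.value Π)
      finish (X , V≤ , pX≤) = ratio-within α 1≤α (2 ^ a) {{m^n≢0 2 a}} (Solution.value tourSolution) X
        (Solution.value Π) ε δ n₀ δ≤ε 2≤δp
        (subst (λ v → fromℕ v ≤ᴿ α *ᴿ fromℕ X)
          (sym (walkSolution-value I (first table) (proj₁ (proj₁ first-walk)) (proj₁ (proj₂ first-walk))
            (proj₂ (proj₁ first-walk)))) V≤)
        (subst (λ w → 2 ^ a * X ≤ (2 + 2 ^ a) * w) (stops-total I Π) pX≤)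

    solution-⇒ : ∃[ y ] ((mainProg ∶ encodeTRP I ⇒ y) × IsTRPApprox I (α *ᴿ (1ᴿ +ᴿ ε)) y)
    solution-⇒ = encodePoints (reverse (first table)) , main-⇒ , tourSolution ,
      cong encodePoints (sym (walkSolution-sequence I (first table) (proj₁ (proj₁ first-walk)) (proj₁ (proj₂ first-walk))
        (proj₂ (proj₁ first-walk)))) ,
      λ Π _ → approximates Π

  reduction : PolyTimeTRPApprox M (α *ᴿ (1ᴿ +ᴿ ε))
  reduction = polyTimeSolvable mainProg solution-⇒

theorem1 : ∀ {ℓ} (M : MetricClass ℓ) (α : ℝ) → 1ᴿ ≤ᴿ α →
    (∀ k → PolyTimeSegTSPApprox M k α) →
    ∀ ε → 0ᴿ <ᴿ ε → PolyTimeTRPApprox M (α *ᴿ (1ᴿ +ᴿ ε))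
theorem1 M α 1≤α solvers ε (δ , 0<δ , n₀ , δ≤ε) =
  Reduction.reduction M α 1≤α ε δ n₀ δ≤ε a H q (power-archimedean δ 0<δ) refl refl (solvers (suc H))
  where
  a H q : ℕ
  -- `p = 2 ^ a` exceeds twice the denominator of `δ`, hence `2 ≤ δ * p`. A power of two is needed
  -- for `shift`, and its exponent may be chosen this generously because `δ` is fixed.
  a = ℚ.denominatorℕ δ * 2
  H = suc (2 ^ a) * (2 ^ a * 3 ^ (2 ^ a))
  q = 2 ^ a + 4 * (2 ^ a * H) + H
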